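{- Let $G$ be a connected graph of order $n$ with stability number $\alpha$ (so $1\le\alpha\le n-1$ when $n\ge 2$). Then $F(G)\le f_{\sf TC}(n,\alpha)$, with equality if and only if $G\simeq TC_{n,\alpha}$ when $(n,\alpha)\neq(5,2)$, and if and only if $G\simeq TC_{5,2}$ or $G\simeq C_5$ (the cycle on $5$ vertices) when $(n,\alpha)=(5,2)$.
   Context: All graphs are finite, simple and undirected. The Fibonacci index $F(G)$ is the number of stable sets of $G$, including the empty set; $\alpha(G)$ is the stability number. For $1\le\alpha\le n$, the Turán graph $T_{n,\alpha}$ is the disjoint union of $\alpha$ cliques whose orders sum to $n$ and differ pairwise by at most one. For $1\le\alpha\le n-1$, the Turán-connected graph $TC_{n,\alpha}$ is obtained from $T_{n,\alpha}$ by choosing a vertex $v$ in a clique of size $\lceil n/\alpha\rceil$ and adding $\alpha-1$ edges joining $v$ to one vertex of each of the other $\alpha-1$ cliques. $f_{\sf TC}(n,\alpha)$ denotes $F(TC_{n,\alpha})$. -}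

module Defs where

open import Data.Bool using (Bool; true; false; _∧_; _∨_; not)
import Data.Bool.Properties as BoolP
open import Data.Nat using (ℕ; zero; suc; _≤_; _<_; _≡ᵇ_; _<ᵇ_; NonZero; _%_)
open import Data.Fin using (Fin; toℕ)
open import Data.Fin.Subset using (Subset; _∈_; ∣_∣)
open import Data.Fin.Subset.Properties using (_∈?_)
open import Data.Fin.Properties using (all?)
open import Data.Fin.Permutation using (Permutation′; _⟨$⟩ʳ_)
open import Data.List using (List; []; _∷_; map; _++_; length; filter)
open import Data.Vec using (Vec; []; _∷_)
open import Data.Product using (_×_; ∃; _,_)
open import Relation.Binary.PropositionalEquality using (_≡_; refl; cong; cong₂)
open import Relation.Nullary using (Dec)
open import Relation.Nullary.Decidable using (_→-dec_)

record Graph (n : ℕ) : Set where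
  field
    adj    : Fin n → Fin n → Bool
    sym    : ∀ i j → adj i j ≡ adj j i
    irrefl : ∀ i → adj i i ≡ false
open Graph public

IsStable : ∀ {n} → Graph n → Subset n → Set
IsStable G S = ∀ i j → i ∈ S → j ∈ S → adj G i j ≡ false

isStable? : ∀ {n} (G : Graph n) (S : Subset n) → Dec (IsStable G S)
isStable? G S = all? λ i → all? λ j →
  (i ∈? S) →-dec ((j ∈? S) →-dec BoolP._≟_ (adj G i j) false)

allSubsets : ∀ n → List (Subset n)
allSubsets zero = [] ∷ []
allSubsets (suc n) = map (false ∷_) (allSubsets n) ++ map (true ∷_) (allSubsets n)

F : ∀ {n} → Graph n → ℕ
F G = length (filter (isStable? G) (allSubsets _))

IsStabilityNumber : ∀ {n} → Graph n → ℕ → Set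
IsStabilityNumber G a =
  (∃ λ S → IsStable G S × ∣ S ∣ ≡ a) × (∀ S → IsStable G S → ∣ S ∣ ≤ a)

data Reachable {n} (G : Graph n) : Fin n → Fin n → Set where
  here : ∀ {u} → Reachable G u u
  step : ∀ {u v w} → adj G u v ≡ true → Reachable G v w → Reachable G u w

Connected : ∀ {n} → Graph n → Set
Connected G = ∀ u v → Reachable G u v

_≅_ : ∀ {n} → Graph n → Graph n → Set
_≅_ {n} G H = ∃ λ (σ : Permutation′ n) →
  ∀ i j → adj G i j ≡ adj H (σ ⟨$⟩ʳ i) (σ ⟨$⟩ʳ j)

_=ᶠ_ : ∀ {n} → Fin n → Fin n → Bool
i =ᶠ j = toℕ i ≡ᵇ toℕ j

≡ᵇ-sym : ∀ m k → (m ≡ᵇ k) ≡ (k ≡ᵇ m)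
≡ᵇ-sym zero zero = refl
≡ᵇ-sym zero (suc k) = refl
≡ᵇ-sym (suc m) zero = refl
≡ᵇ-sym (suc m) (suc k) = ≡ᵇ-sym m k

≡ᵇ-refl : ∀ m → (m ≡ᵇ m) ≡ true
≡ᵇ-refl zero = refl
≡ᵇ-refl (suc m) = ≡ᵇ-refl m

mkGraph : ∀ {n} → (Fin n → Fin n → Bool) → Graph n
mkGraph r = record
  { adj    = λ i j → not (i =ᶠ j) ∧ (r i j ∨ r j i)
  ; sym    = λ i j → cong₂ (λ x y → not x ∧ y) (≡ᵇ-sym (toℕ i) (toℕ j)) (BoolP.∨-comm (r i j) (r j i))
  ; irrefl = λ i → cong (λ x → not x ∧ (r i i ∨ r i i)) (≡ᵇ-refl (toℕ i))
  }

-- Turán-connected graph TC_{n,a} on Fin n.  Vertex i lies in clique (i mod a),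
-- so the a cliques have orders ⌈n/a⌉ or ⌊n/a⌋ (differing by at most one), and
-- clique 0 has order ⌈n/a⌉.  The chosen vertex v = 0 (in clique 0) is joined
-- to vertex j, which lies in clique j, for each 1 ≤ j < a.
TC : ∀ n a → .{{NonZero a}} → Graph n
TC n a = mkGraph λ i j →
  ((toℕ i % a) ≡ᵇ (toℕ j % a)) ∨ ((toℕ i ≡ᵇ 0) ∧ (toℕ j <ᵇ a))

fTC : ∀ n a → .{{NonZero a}} → ℕ
fTC n a = F (TC n a)

Cycle : ∀ n → Graph n
Cycle zero = mkGraph λ _ _ → false
Cycle (suc m) = mkGraph λ i j → ((suc (toℕ i)) % (suc m)) ≡ᵇ toℕ j

{-# OPTIONS --safe #-}
module Submission where

-- Deleting a vertex v splits the stable sets of G into those of G - v and those of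
-- G - N[v], so F(G) = F(G - v) + F(G - N[v]).  A graph with more than k α vertices has a
-- vertex of degree at least k, and induction gives Turán's bound for arbitrary graphs,
-- attained only by disjoint unions of balanced cliques.
--
-- For connected G write n = k α + x + 1 with 0 ≤ x < α.  If c is a cut vertex, a suitable
-- component A of G - c satisfies α(G) = α(A) + α(G - A); applying induction to A and to
-- G - A bounds F(G) by the index of two Turán-connected graphs joined at their centres,
-- which is improved by turning all other cliques into leaves of the larger centre.  If G has
-- no cut vertex, a vertex of degree above k gives a strict inequality; otherwise greedy
-- deletion shows that G is k-regular with n = k α + 1, where deleting any vertex gives the
-- bound, and equality forces every G - N[v] to be a union of cliques, which leaves only
-- complete graphs and C₅.  In the remaining equality cases some G - u is a union of cliques,
-- and comparing clique sizes identifies G with TC.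

open import Defs
open import Data.Bool using (Bool; true; false; _∧_; _∨_; not; if_then_else_)
import Data.Bool as Bool
open import Data.Bool.Properties using (∨-zeroʳ; T-≡)
open import Data.Nat
  using (ℕ; zero; suc; _+_; _*_; _∸_; _^_; _/_; _%_; _⊔_; _≤_; _<_; _≡ᵇ_; _<ᵇ_; _≤?_; _≟_; z≤n; s≤s; NonZero; >-nonZero)
open import Data.Nat.DivMod using (m≡m%n+[m/n]*n; m%n<n; m≥n⇒m/n>0; [m+kn]%n≡m%n; m<n⇒m%n≡m)
open import Data.Nat.ListAction using (sum; product)
open import Data.Nat.ListAction.Properties using (sum-++; product-++)
open import Data.Nat.Properties hiding (_≟_; _≤?_)
open import Data.Nat.Tactic.RingSolver using (solve-∀)
open import Data.Fin using (Fin; zero; suc; toℕ; fromℕ<; punchOut)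
open import Data.Fin.Patterns using (0F; 1F; 2F; 3F; 4F)
open import Data.Fin.Permutation using (Permutation′; permutation; _⟨$⟩ʳ_; _⟨$⟩ˡ_; inverseʳ; inverseˡ; flip)
import Data.Fin.Properties as Fin
open import Data.Fin.Subset using (Subset; inside; outside; _∈_; _∉_; _⊆_; ∣_∣; ⁅_⁆; Nonempty) renaming (⊥ to empty; ⊤ to full)
import Data.Fin.Subset as Subset
open import Data.Fin.Subset.Properties
  using (_∈?_; _⊆?_; anySubset?; nonempty?; ⊆-antisym; p⊆q⇒∣p∣≤∣q∣; ∣⁅x⁆∣≡1; ∣⊥∣≡0; ∣⊤∣≡n; x∈⁅x⁆; x∈⁅y⁆⇒x≡y; x∈p∪q⁻; x∈p∪q⁺; ∈⊤; ∉⊥)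
open import Data.Vec using (_∷_; []; lookup; tabulate; tail; here; there; _[_]≔_)
open import Data.Vec.Properties using ([]=⇒lookup; lookup⇒[]=; lookup∘tabulate; lookup∘updateAt; lookup∘updateAt′)
open import Data.List using (List; []; _∷_; _++_; length; map; filter; replicate)
open import Data.List.Properties using (map-++; map-replicate; length-++; length-replicate; length-map; filter-++)
open import Data.List.Relation.Unary.All using (All; []; _∷_)
import Data.List.Relation.Unary.All as All
import Data.List.Relation.Unary.All.Properties as All
open import Data.List.Relation.Unary.Any using (Any; here; there)
open import Data.Product using (_×_; _,_; ∃; Σ; proj₁; proj₂)
open import Data.Sum using (_⊎_; inj₁; inj₂; map₂)
open import Data.Empty using (⊥; ⊥-elim)
open import Function using (_∘_)
open import Function.Bundles using (_⇔_; mk⇔; Equivalence)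
open import Relation.Binary.Definitions using (tri<; tri≈; tri>)
open import Relation.Binary.PropositionalEquality renaming (sym to ≡-sym)
open import Relation.Nullary using (Dec; yes; no; ¬_; does)
open import Relation.Nullary.Decidable using (_×-dec_; _→-dec_; ¬?; dec-true; dec-false; from-yes)

-- The induction compares stable-set counts with the number `turánStar k x y` and carries the
-- inequality alone; the equality case is rebuilt afterwards from equality in Turán's bound for the
-- pieces. Everything happens inside vertex subsets `W` of one fixed graph. Cut vertices form a
-- separate case because the bound for connected graphs applies to `W ⊖ v` only if that set is still
-- connected. At a cut vertex `c` the obstacle is that `c` may lie in every maximum stable set of
-- the part that keeps it, so that the stability numbers of the two parts need not add up; this is
-- why the component must be chosen with care. The numerical optimum has a tie: two cliques of
-- orders `s` and `p` joined by an edge have index `s * p + s + p`, symmetric in both, so either end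
-- of the edge may serve as the centre. The tie is carried through the optimisation as an extra
-- alternative and is resolved in the graph by exchanging the two ends.

*-≤-≡ : ∀ {a b c d} → a ≤ b → c ≤ d → 0 < b → 0 < d → a * c ≡ b * d → a ≡ b × c ≡ d
*-≤-≡ {a} {b} {c} {d} a≤b c≤d 0<b 0<d eq with m≤n⇒m<n∨m≡n a≤b
... | inj₁ a<b = ⊥-elim (<-irrefl eq (≤-<-trans (*-monoʳ-≤ a c≤d) (*-monoˡ-< d {{>-nonZero 0<d}} a<b)))
... | inj₂ refl = refl , *-cancelˡ-≡ c d a {{>-nonZero 0<b}} eq

+-≤-≡ : ∀ {a b c d} → a ≤ b → c ≤ d → a + c ≡ b + d → a ≡ b × c ≡ d
+-≤-≡ {a} {b} {c} {d} a≤b c≤d eq with m≤n⇒m<n∨m≡n a≤b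
... | inj₁ a<b = ⊥-elim (<-irrefl eq (+-mono-<-≤ a<b c≤d))
... | inj₂ refl = refl , +-cancelˡ-≡ a c d eq

0<* : ∀ {a b} → 0 < a → 0 < b → 0 < a * b
0<* {suc a} {suc b} _ _ = s≤s z≤n

0<^ : ∀ k e → 0 < suc k ^ e
0<^ k e = m^n>0 (suc k) e

≤-via : ∀ {a b} c → b ≡ a + c → a ≤ b
≤-via {a} c eq = subst (a ≤_) (≡-sym eq) (m≤m+n a c)

<-via : ∀ {a b} c → b ≡ a + suc c → a < b
<-via {a} c eq = subst (a <_) (≡-sym eq) (m<m+n a (s≤s z≤n))

-- Products of integers with a prescribed sum and number of factors.

balanced : ℕ → ℕ → ℕ → ℕ
balanced k x y = suc k ^ x * k ^ y

balancedList : ℕ → ℕ → ℕ → List ℕ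
balancedList k x y = replicate x (suc k) ++ replicate y k

Sandwich : ℕ → ℕ → Set
Sandwich k p = p ≡ k ⊎ p ≡ suc k

-- Bernoulli's inequality `1 + e/k ≤ (1 + 1/k)^e` with denominators cleared, which also makes sense
-- for `k = 0`.
above-tangent : ∀ k e → (k + e) * k ^ e ≤ suc k ^ e * k
above-tangent k zero = ≤-reflexive (lem k)
  where lem : ∀ k → (k + 0) * 1 ≡ 1 * k
        lem = solve-∀
above-tangent k (suc e) = begin
  (k + suc e) * (k * k ^ e)         ≤⟨ ≤-via (e * k ^ e) (lem k e (k ^ e)) ⟩
  suc k * ((k + e) * k ^ e)         ≤⟨ *-monoʳ-≤ (suc k) (above-tangent k e) ⟩
  suc k * (suc k ^ e * k)           ≡⟨ ≡-sym (*-assoc (suc k) (suc k ^ e) k) ⟩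
  suc k ^ suc e * k                 ∎
  where open ≤-Reasoning
        lem : ∀ k e z → suc k * ((k + e) * z) ≡ (k + suc e) * (k * z) + e * z
        lem = solve-∀

-- The inductive step loses `suc e * k ^ suc e`, which is positive once the exponent is at least
-- two. The exponents 0 and 1 are the points `k` and `k + 1` where the line is met.
above-tangent-strict : ∀ j e → let k = suc j in (k + suc (suc e)) * k ^ (suc (suc e)) < suc k ^ (suc (suc e)) * k
above-tangent-strict j e = begin-strict
  (k + suc (suc e)) * (k * k ^ suc e) <⟨ m<m+n _ (0<* {suc e} (s≤s z≤n) (0<^ j (suc e))) ⟩
  (k + suc (suc e)) * (k * k ^ suc e) + suc e * k ^ suc e ≡⟨ ≡-sym (lem k (suc e) (k ^ suc e)) ⟩
  suc k * ((k + suc e) * k ^ suc e)   ≤⟨ *-monoʳ-≤ (suc k) (above-tangent k (suc e)) ⟩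
  suc k * (suc k ^ suc e * k)         ≡⟨ ≡-sym (*-assoc (suc k) (suc k ^ suc e) k) ⟩
  suc k ^ suc (suc e) * k             ∎
  where open ≤-Reasoning
        k = suc j
        lem : ∀ k e z → suc k * ((k + e) * z) ≡ (k + suc e) * (k * z) + e * z
        lem = solve-∀

-- The ratio `k / p` telescopes into `e` factors `(p + i + 1) / (p + i)`, each at least
-- `(k + 1) / k` because `p + i ≤ k`. In `go` the number `k` stays fixed while `p` climbs up to it.
below-tangent : ∀ p e → p * suc (p + e) ^ e ≤ (p + e) ^ e * (p + e)
below-tangent p e = go p e refl
  where
  k = p + e
  open ≤-Reasoning
  lem : ∀ p f z → (suc p + f) * (suc p * z) ≡ p * (suc (suc p + f) * z) + suc f * z
  lem = solve-∀
  go : ∀ p f → p + f ≡ k → p * suc k ^ f ≤ k ^ f * k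
  go p zero eq = ≤-reflexive (trans (*-identityʳ p) (trans (trans (≡-sym (+-identityʳ p)) eq) (≡-sym (+-identityʳ k))))
  go p (suc f) eq = begin
    p * (suc k * suc k ^ f)     ≤⟨ ≤-via (suc f * suc k ^ f) (subst (λ k → ∀ z → k * (suc p * z) ≡ p * (suc k * z) + suc f * z) eq′ (lem p f) (suc k ^ f)) ⟩
    k * (suc p * suc k ^ f)     ≤⟨ *-monoʳ-≤ k (go (suc p) f eq′) ⟩
    k * (k ^ f * k)             ≡⟨ ≡-sym (*-assoc k (k ^ f) k) ⟩
    k ^ suc f * k               ∎
    where
    eq′ : suc p + f ≡ k
    eq′ = trans (≡-sym (+-suc p f)) eq

below-tangent-strict : ∀ p e → p * suc (p + suc e) ^ suc e < (p + suc e) ^ suc e * (p + suc e)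
below-tangent-strict p e = begin-strict
  p * (suc k * suc k ^ e)                   <⟨ m<m+n _ (0<* {suc e} (s≤s z≤n) (0<^ k e)) ⟩
  p * (suc k * suc k ^ e) + suc e * suc k ^ e ≡⟨ ≡-sym (lem p e (suc k ^ e)) ⟩
  k * (suc p * suc k ^ e)                   ≤⟨ *-monoʳ-≤ k (subst (λ k → suc p * suc k ^ e ≤ k ^ e * k) (≡-sym (+-suc p e)) (below-tangent (suc p) e)) ⟩
  k * (k ^ e * k)                           ≡⟨ ≡-sym (*-assoc k (k ^ e) k) ⟩
  k ^ suc e * k                             ∎
  where open ≤-Reasoning
        k = p + suc e
        lem : ∀ p f z → (p + suc f) * (suc p * z) ≡ p * (suc (p + suc f) * z) + suc f * z
        lem = solve-∀

-- At integers p, the function p ↦ log p lies below the chord through k and k + 1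
-- continued to a line, and meets it only at k and k + 1.
tangent : ∀ j p → let k = suc j in
  p * suc k ^ (k ∸ p) * k ^ (p ∸ k) ≤ suc k ^ (p ∸ k) * k ^ (k ∸ p) * k ×
  (p * suc k ^ (k ∸ p) * k ^ (p ∸ k) ≡ suc k ^ (p ∸ k) * k ^ (k ∸ p) * k → Sandwich k p)
tangent j p with ≤-total (suc j) p
... | inj₁ k≤p with m≤n⇒∃[o]m+o≡n k≤p
... | e , refl rewrite m+n∸m≡n j e | m≤n⇒m∸n≡0 (m≤m+n j e) =
  subst₂ _≤_ (≡-sym (l₁ (k + e) (k ^ e))) (≡-sym (l₁ (suc k ^ e) k)) (above-tangent k e) , eqcase e
  where
  k = suc j
  l₁ : ∀ a b → a * 1 * b ≡ a * b
  l₁ = solve-∀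
  eqcase : ∀ e → (k + e) * 1 * k ^ e ≡ suc k ^ e * 1 * k → Sandwich k (k + e)
  eqcase zero _ = inj₁ (+-identityʳ k)
  eqcase (suc zero) _ = inj₂ (+-comm k 1)
  eqcase (suc (suc e)) eq = ⊥-elim (<-irrefl
    (trans (≡-sym (l₁ (k + suc (suc e)) (k ^ suc (suc e)))) (trans eq (l₁ (suc k ^ suc (suc e)) k)))
    (above-tangent-strict j e))
tangent j p | inj₂ p≤k with m≤n⇒∃[o]m+o≡n p≤k
... | e , eq rewrite ≡-sym eq | m+n∸m≡n p e | m≤n⇒m∸n≡0 (m≤m+n p e) =
  subst₂ _≤_ (≡-sym (l₁ e)) (≡-sym (l₂ e)) (below-tangent p e) , eqcase e
  where
  l₁ : ∀ e → p * suc (p + e) ^ e * 1 ≡ p * suc (p + e) ^ e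
  l₁ e = *-identityʳ _
  l₂ : ∀ e → 1 * (p + e) ^ e * (p + e) ≡ (p + e) ^ e * (p + e)
  l₂ e = cong (_* (p + e)) (*-identityˡ ((p + e) ^ e))
  eqcase : ∀ e → p * suc (p + e) ^ e * 1 ≡ 1 * (p + e) ^ e * (p + e) → Sandwich (p + e) p
  eqcase zero _ = inj₁ (≡-sym (+-identityʳ p))
  eqcase (suc e) eq = ⊥-elim (<-irrefl (trans (≡-sym (l₁ (suc e))) (trans eq (l₂ (suc e)))) (below-tangent-strict p e))

-- `excess` and `deficit` collect the positive and the negative parts of the deviations from `k`;
-- keeping them apart leaves all exponents natural numbers.
excess : ℕ → List ℕ → ℕ
excess k l = sum (map (_∸ k) l)

deficit : ℕ → List ℕ → ℕ
deficit k l = sum (map (k ∸_) l)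

sum-excess-deficit : ∀ k l → sum l + deficit k l ≡ k * length l + excess k l
sum-excess-deficit k [] = trans (≡-sym (*-zeroʳ k)) (≡-sym (+-identityʳ _))
sum-excess-deficit k (p ∷ l) = begin
  p + sum l + (k ∸ p + deficit k l)     ≡⟨ l₁ p (sum l) (k ∸ p) (deficit k l) ⟩
  p + (k ∸ p) + (sum l + deficit k l)   ≡⟨ cong₂ _+_ (trans (m+[n∸m]≡m⊔n p k) (trans (⊔-comm p k) (≡-sym (m+[n∸m]≡m⊔n k p)))) (sum-excess-deficit k l) ⟩
  k + (p ∸ k) + (k * length l + excess k l) ≡⟨ l₂ k (p ∸ k) (length l) (excess k l) ⟩
  k * suc (length l) + (p ∸ k + excess k l) ∎
  where
  open ≡-Reasoning
  m+[n∸m]≡m⊔n : ∀ m n → m + (n ∸ m) ≡ m ⊔ n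
  m+[n∸m]≡m⊔n m n = ≡-sym (m⊔n≡m+n∸m m n)
    where
    m⊔n≡m+n∸m : ∀ m n → m ⊔ n ≡ m + (n ∸ m)
    m⊔n≡m+n∸m zero n = refl
    m⊔n≡m+n∸m (suc m) zero = ≡-sym (+-identityʳ _)
    m⊔n≡m+n∸m (suc m) (suc n) = cong suc (m⊔n≡m+n∸m m n)
  l₁ : ∀ a b c d → a + b + (c + d) ≡ a + c + (b + d)
  l₁ = solve-∀
  l₂ : ∀ a b c d → a + b + (a * c + d) ≡ a * suc c + (b + d)
  l₂ = solve-∀

-- Multiplying `tangent` over the list adds the exponents, so only the total excess and deficit
-- remain. All factors being positive, equality of the products forces equality in each factor.
product-tangent : ∀ j l → let k = suc j in
  product l * suc k ^ deficit k l * k ^ excess k l ≤ suc k ^ excess k l * k ^ deficit k l * k ^ length l ×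
  (product l * suc k ^ deficit k l * k ^ excess k l ≡ suc k ^ excess k l * k ^ deficit k l * k ^ length l → All (Sandwich k) l)
product-tangent j [] = ≤-refl , λ _ → []
product-tangent j (p ∷ l) =
  subst₂ _≤_ (≡-sym lhs) (≡-sym rhs) (*-mono-≤ (proj₁ (tangent j p)) (proj₁ (product-tangent j l))) ,
  λ eq → let (e₁ , e₂) = *-≤-≡ (proj₁ (tangent j p)) (proj₁ (product-tangent j l))
                 (0<* (0<* (0<^ k (p ∸ k)) (0<^ j (k ∸ p))) (s≤s z≤n))
                 (0<* (0<* (0<^ k (excess k l)) (0<^ j (deficit k l))) (0<^ j (length l)))
                 (trans (≡-sym lhs) (trans eq rhs))
         in proj₂ (tangent j p) e₁ ∷ proj₂ (product-tangent j l) e₂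
  where
  k = suc j
  lem₁ : ∀ p P a b c d → p * P * (a * b) * (c * d) ≡ p * a * c * (P * b * d)
  lem₁ = solve-∀
  lem₂ : ∀ k K a b c d → a * b * (c * d) * (k * K) ≡ a * c * k * (b * d * K)
  lem₂ = solve-∀
  lhs : p * product l * suc k ^ (k ∸ p + deficit k l) * k ^ (p ∸ k + excess k l)
      ≡ p * suc k ^ (k ∸ p) * k ^ (p ∸ k) * (product l * suc k ^ deficit k l * k ^ excess k l)
  lhs rewrite ^-distribˡ-+-* (suc k) (k ∸ p) (deficit k l) | ^-distribˡ-+-* k (p ∸ k) (excess k l) =
    lem₁ p (product l) (suc k ^ (k ∸ p)) (suc k ^ deficit k l) (k ^ (p ∸ k)) (k ^ excess k l)
  rhs : suc k ^ (p ∸ k + excess k l) * k ^ (k ∸ p + deficit k l) * (k * k ^ length l)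
      ≡ suc k ^ (p ∸ k) * k ^ (k ∸ p) * k * (suc k ^ excess k l * k ^ deficit k l * k ^ length l)
  rhs rewrite ^-distribˡ-+-* (suc k) (p ∸ k) (excess k l) | ^-distribˡ-+-* k (k ∸ p) (deficit k l) =
    lem₂ k (k ^ length l) (suc k ^ (p ∸ k)) (suc k ^ excess k l) (k ^ (k ∸ p)) (k ^ deficit k l)

-- With the sum fixed, the excess is the deficit plus exactly `x` (`E≡`), so both sides of
-- `product-tangent` carry the common positive factor `M`, and cancelling it leaves
-- `balanced k x y`.
product-balanced : ∀ j x y l → let k = suc j in length l ≡ x + y → sum l ≡ k * (x + y) + x →
  product l ≤ balanced k x y × (product l ≡ balanced k x y → All (Sandwich k) l)
product-balanced j x y l len total =
  *-cancelʳ-≤ (product l) (balanced k x y) M (subst₂ _≤_ lhs rhs (proj₁ (product-tangent j l))) ,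
  λ eq → proj₂ (product-tangent j l) (trans lhs (trans (cong (_* M) eq) (≡-sym rhs)))
  where
  k = suc j
  D = deficit k l
  E≡ : excess k l ≡ x + D
  E≡ = +-cancelˡ-≡ (k * (x + y)) _ _ (begin
    k * (x + y) + excess k l  ≡⟨ cong (λ r → k * r + excess k l) (≡-sym len) ⟩
    k * length l + excess k l ≡⟨ ≡-sym (sum-excess-deficit k l) ⟩
    sum l + D                 ≡⟨ cong (_+ D) total ⟩
    k * (x + y) + x + D       ≡⟨ +-assoc (k * (x + y)) x D ⟩
    k * (x + y) + (x + D)     ∎)
    where open ≡-Reasoning
  M = suc k ^ D * (k ^ x * k ^ D)
  instance
    M≢0 : NonZero M
    M≢0 = >-nonZero (0<* (0<^ k D) (0<* (0<^ j x) (0<^ j D)))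
  lhs : product l * suc k ^ D * k ^ excess k l ≡ product l * M
  lhs rewrite E≡ | ^-distribˡ-+-* k x D = *-assoc (product l) (suc k ^ D) (k ^ x * k ^ D)
  lem : ∀ a b c d e → a * b * c * (d * e) ≡ a * e * (b * (d * c))
  lem = solve-∀
  rhs : suc k ^ excess k l * k ^ D * k ^ length l ≡ balanced k x y * M
  rhs rewrite E≡ | len | ^-distribˡ-+-* k x y | ^-distribˡ-+-* (suc k) x D =
    lem (suc k ^ x) (suc k ^ D) (k ^ D) (k ^ x) (k ^ y)

product-replicate : ∀ m k → product (replicate m k) ≡ k ^ m
product-replicate zero k = refl
product-replicate (suc m) k = cong (k *_) (product-replicate m k)

sum-replicate : ∀ m k → sum (replicate m k) ≡ m * k
sum-replicate zero k = refl
sum-replicate (suc m) k = cong (k +_) (sum-replicate m k)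

product-balancedList : ∀ k x y → product (balancedList k x y) ≡ balanced k x y
product-balancedList k x y = trans (product-++ (replicate x (suc k)) (replicate y k))
  (cong₂ _*_ (product-replicate x (suc k)) (product-replicate y k))

sum-balancedList : ∀ k x y → sum (balancedList k x y) ≡ k * (x + y) + x
sum-balancedList k x y = trans (sum-++ (replicate x (suc k)) (replicate y k))
  (trans (cong₂ _+_ (sum-replicate x (suc k)) (sum-replicate y k)) (lem k x y))
  where lem : ∀ k x y → x * suc k + y * k ≡ k * (x + y) + x
        lem = solve-∀

length-balancedList : ∀ k x y → length (balancedList k x y) ≡ x + y
length-balancedList k x y = trans (length-++ (replicate x (suc k))) (cong₂ _+_ (length-replicate x) (length-replicate y))

map-suc-balancedList : ∀ k x y → map suc (balancedList k x y) ≡ balancedList (suc k) x y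
map-suc-balancedList k x y = trans (map-++ suc (replicate x (suc k)) (replicate y k))
  (cong₂ _++_ (map-replicate suc x (suc k)) (map-replicate suc y k))

product-suc-balancedList : ∀ k x y → product (map suc (balancedList k x y)) ≡ balanced (suc k) x y
product-suc-balancedList k x y = trans (cong product (map-suc-balancedList k x y)) (product-balancedList (suc k) x y)

0<product-suc : ∀ l → 0 < product (map suc l)
0<product-suc [] = s≤s z≤n
0<product-suc (p ∷ l) = 0<* {suc p} (s≤s z≤n) (0<product-suc l)

product≤product-suc : ∀ l → product l ≤ product (map suc l)
product≤product-suc [] = ≤-refl
product≤product-suc (p ∷ l) = *-mono-≤ (n≤1+n p) (product≤product-suc l)

product<product-suc : ∀ l → 1 ≤ length l → product l < product (map suc l)
product<product-suc (p ∷ l) _ = ≤-<-trans (*-monoʳ-≤ p (product≤product-suc l))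
  (*-monoˡ-< (product (map suc l)) {{>-nonZero (0<product-suc l)}} (n<1+n p))

0<balanced-suc : ∀ k x y → 0 < balanced (suc k) x y
0<balanced-suc k x y = 0<* (0<^ (suc k) x) (0<^ k y)

balanced≤balanced-suc : ∀ k x y → balanced k x y ≤ balanced (suc k) x y
balanced≤balanced-suc k x y = subst₂ _≤_ (product-balancedList k x y) (product-suc-balancedList k x y)
  (product≤product-suc (balancedList k x y))

balanced<balanced-suc : ∀ k x y → 1 ≤ x + y → balanced k x y < balanced (suc k) x y
balanced<balanced-suc k x y 1≤ = subst₂ _<_ (product-balancedList k x y) (product-suc-balancedList k x y)
  (product<product-suc (balancedList k x y) (subst (1 ≤_) (≡-sym (length-balancedList k x y)) 1≤))

-- A family of `y` equal parts `k + 1` can be read with quotient `k + 1` or with quotient `k`. This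
-- double reading lets inductions that run out of larger parts continue with another quotient.
balanced-shift : ∀ k y → balanced (suc k) 0 y ≡ balanced k y 0
balanced-shift k y = trans (+-identityʳ _) (≡-sym (*-identityʳ _))

sum-map-suc : ∀ l → sum (map suc l) ≡ length l + sum l
sum-map-suc [] = refl
sum-map-suc (p ∷ l) = cong suc (trans (cong (p +_) (sum-map-suc l)) (lem p (length l) (sum l)))
  where lem : ∀ a b c → a + (b + c) ≡ b + (a + c)
        lem = solve-∀

product-suc-balanced : ∀ k x y l → length l ≡ x + y → sum l ≡ k * (x + y) + x →
  product (map suc l) ≤ balanced (suc k) x y × (product (map suc l) ≡ balanced (suc k) x y → All (Sandwich k) l)
product-suc-balanced k x y l len total
  with product-balanced k x y (map suc l) (trans (length-map suc l) len)
         (trans (sum-map-suc l) (trans (cong₂ _+_ len total) (≡-sym (+-assoc (x + y) (k * (x + y)) x))))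
... | le , eq = le , λ e → All.map back (All.map⁻ (eq e))
  where back : ∀ {p} → Sandwich (suc k) (suc p) → Sandwich k p
        back (inj₁ e) = inj₁ (suc-injective e)
        back (inj₂ e) = inj₂ (suc-injective e)

-- Stars: a central clique with one edge to each of its leaf cliques.

-- The number of stable sets of disjoint cliques of orders s and l whose first
-- clique has a vertex joined to one vertex of each other clique.
star : ℕ → List ℕ → ℕ
star s l = s * product (map suc l) + product l

-- With x leaves of order k + 1 and y leaves of order k.
starBalanced : ℕ → ℕ → ℕ → ℕ → ℕ
starBalanced s k x y = s * balanced (suc k) x y + balanced k x y

-- The order n = k α + x + 1 of the Turán-connected graph with α = x + y + 1 cliques,
-- whose centre and x leaves have order k + 1 and whose y other leaves have order k;
-- turánStar k x y is its Fibonacci index.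
starOrder : ℕ → ℕ → ℕ → ℕ
starOrder k x y = k * suc (x + y) + suc x

turánStar : ℕ → ℕ → ℕ → ℕ
turánStar k x y = starBalanced (suc k) k x y

-- The leaves are already balanced and the centre has arbitrary order `s`; vertices remain to be
-- exchanged between the two. The last alternative records the tie for a single leaf of order `p`:
-- `s * (p + 1) + p` is symmetric in `s` and `p`.
Optimal : ℕ → ℕ → ℕ → ℕ → Set
Optimal s κ ξ η = ∃ λ k → ∃ λ x → ∃ λ y → x + y ≡ ξ + η × s + (κ * (ξ + η) + ξ) ≡ starOrder k x y ×
  starBalanced s κ ξ η ≤ turánStar k x y ×
  (starBalanced s κ ξ η ≡ turánStar k x y → s ≡ suc k ⊎ (ξ + η ≡ 1 × s < κ * (ξ + η) + ξ))

optimal-done : ∀ κ ξ η → Optimal (suc κ) κ ξ η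
optimal-done κ ξ η = κ , ξ , η , refl , lem κ (ξ + η) ξ , ≤-refl , λ _ → inj₁ refl
  where lem : ∀ k r x → suc k + (k * r + x) ≡ k * suc r + suc x
        lem = solve-∀

optimal-resp : ∀ {s κ ξ η κ′ ξ′ η′} → ξ + η ≡ ξ′ + η′ → κ * (ξ + η) + ξ ≡ κ′ * (ξ′ + η′) + ξ′ →
  starBalanced s κ ξ η ≡ starBalanced s κ′ ξ′ η′ → Optimal s κ ξ η → Optimal s κ′ ξ′ η′
optimal-resp {s} r total value (k , x , y , r≡ , total≡ , le , eq) =
  k , x , y , trans r≡ r , trans (cong (s +_) (≡-sym total)) total≡ , subst (_≤ turánStar k x y) value le ,
  λ e → map₂ (λ (one , lt) → trans (≡-sym r) one , subst (s <_) total lt) (eq (trans value e))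

starBalanced-shift : ∀ s κ ξ → starBalanced s (suc κ) 0 ξ ≡ starBalanced s κ ξ 0 × suc κ * ξ + 0 ≡ κ * (ξ + 0) + ξ
starBalanced-shift s κ ξ = cong₂ (λ a b → s * a + b) (balanced-shift (suc κ) ξ) (balanced-shift κ ξ) , lem κ ξ
  where
  lem : ∀ κ ξ → suc κ * ξ + 0 ≡ κ * (ξ + 0) + ξ
  lem = solve-∀

-- One vertex moves from a leaf of order `κ + 1` to a centre of order `s ≤ κ`. The gain is
-- `suc e * balanced (suc κ) ξ η` minus `balanced κ ξ η`, where the balanced products run over the
-- other leaves; it can vanish only if there is no other leaf.
raise-value : ∀ s e ξ η → let κ = s + e in
  starBalanced s κ (suc ξ) η ≤ starBalanced (suc s) κ ξ (suc η) ×
  (starBalanced s κ (suc ξ) η ≡ starBalanced (suc s) κ ξ (suc η) → suc ξ + η ≡ 1)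
raise-value s e ξ η =
  +-cancelʳ-≤ R _ _ (subst (_≤ right + R) left≡ (+-monoʳ-≤ right R≤)) ,
  λ eq → single (+-cancelˡ-≡ right _ _ (trans left≡ (cong (_+ R) eq)))
  where
  κ = s + e
  P = suc (suc κ) ^ ξ
  Q = suc κ ^ η
  P′ = suc κ ^ ξ
  Q′ = κ ^ η
  R = suc e * (P * Q)
  left = starBalanced s κ (suc ξ) η
  right = starBalanced (suc s) κ ξ (suc η)
  lem : ∀ s e P Q P′ Q′ → suc s * (P * (suc (s + e) * Q)) + P′ * ((s + e) * Q′) + P′ * Q′
     ≡ (s * (suc (suc (s + e)) * P * Q) + suc (s + e) * P′ * Q′) + suc e * (P * Q)
  lem = solve-∀
  left≡ : right + P′ * Q′ ≡ left + R
  left≡ = lem s e P Q P′ Q′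
  R≤ : P′ * Q′ ≤ R
  R≤ = ≤-trans (balanced≤balanced-suc κ ξ η) (m≤m+n (P * Q) (e * (P * Q)))
  single : P′ * Q′ ≡ R → suc ξ + η ≡ 1
  single eq with ξ + η in r≡
  ... | zero = refl
  ... | suc r = ⊥-elim (<-irrefl eq (<-≤-trans (balanced<balanced-suc κ ξ η (subst (1 ≤_) (≡-sym r≡) (s≤s z≤n))) (m≤m+n (P * Q) (e * (P * Q)))))

-- The centre is fed one vertex at a time until its order is `suc κ`. When no leaf of order `suc κ`
-- is left, all leaves have order `κ` and are reread with quotient `κ - 1`.
raise : ∀ s κ ξ η → 1 ≤ s → s ≤ suc κ → Optimal s κ ξ η
raise s κ ξ η 1≤s s≤ with m≤n⇒m<n∨m≡n s≤
... | inj₂ refl = optimal-done κ ξ η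
raise s zero zero η (s≤s _) s≤ | inj₁ (s≤s ())
raise s (suc κ) zero η 1≤s s≤ | inj₁ (s≤s s≤κ) =
  let (value , total) = starBalanced-shift s κ η in
  optimal-resp {s} {κ} {η} {0} {suc κ} {0} {η} (+-identityʳ η) (≡-sym total) (≡-sym value) (raise s κ η 0 1≤s s≤κ)
raise s κ (suc ξ) η 1≤s s≤ | inj₁ (s≤s s≤κ) with raise (suc s) κ ξ (suc η) (s≤s z≤n) (s≤s s≤κ) | m≤n⇒∃[o]m+o≡n s≤κ
... | k , x , y , r≡ , total , le , eq | e , refl =
  k , x , y , trans r≡ (+-suc ξ η) , trans (lem s (s + e) ξ η) total ,
  ≤-trans (proj₁ (raise-value s e ξ η)) le ,
  λ e≡ → inj₂ (let one = proj₂ (raise-value s e ξ η) (≤-antisym (proj₁ (raise-value s e ξ η)) (subst (starBalanced (suc s) (s + e) ξ (suc η) ≤_) (≡-sym e≡) le))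
               in one , subst (s <_) (≡-sym (cong (λ r → (s + e) * r + suc ξ) one)) (<-via (e + ξ) (lem₂ s e ξ)))
  where
  lem : ∀ s κ ξ η → s + (κ * (suc ξ + η) + suc ξ) ≡ suc s + (κ * (ξ + suc η) + ξ)
  lem = solve-∀
  lem₂ : ∀ s e ξ → (s + e) * 1 + suc ξ ≡ s + suc (e + ξ)
  lem₂ = solve-∀

-- One vertex moves from a centre of order `κ + 2 + g` to a leaf of order `κ`. The gain contains
-- `P′ * Q′`, positive because `κ` is, so this move never ties.
lower-value : ∀ g j ξ η → let κ = suc j in
  starBalanced (suc (suc κ) + g) κ ξ (suc η) < starBalanced (suc κ + g) κ (suc ξ) η
lower-value g j ξ η = begin-strict
  left                       <⟨ m<m+n left (≤-trans (0<* {P′} (0<^ (suc j) ξ) (0<^ j η)) (m≤n+m (P′ * Q′) (g * (P * Q)))) ⟩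
  left + (g * (P * Q) + P′ * Q′) ≡⟨ ≡-sym (lem g κ P Q P′ Q′) ⟩
  starBalanced (suc κ + g) κ (suc ξ) η ∎
  where
  open ≤-Reasoning
  κ = suc j
  left = starBalanced (suc (suc κ) + g) κ ξ (suc η)
  P = suc (suc κ) ^ ξ
  Q = suc κ ^ η
  P′ = suc κ ^ ξ
  Q′ = κ ^ η
  lem : ∀ g κ P Q P′ Q′ → (suc κ + g) * (suc (suc κ) * P * Q) + suc κ * P′ * Q′
    ≡ ((suc (suc κ) + g) * (P * (suc κ * Q)) + P′ * (κ * Q′)) + (g * (P * Q) + P′ * Q′)
  lem = solve-∀

-- The mirror image of `raise`. Both moving a vertex and rereading equal leaves with the next
-- quotient use up one unit of the surplus `g`, so the recursion is on `g`.
lower : ∀ g j ξ η → let κ = suc j in Optimal (suc (suc κ) + g) κ ξ η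
lower-step : ∀ g j ξ η → let κ = suc j in Optimal (suc κ + g) κ (suc ξ) η → Optimal (suc (suc κ) + g) κ ξ (suc η)
lower-step g j ξ η (k , x , y , r≡ , total , le , eq) =
  k , x , y , trans r≡ (≡-sym (+-suc ξ η)) , trans (lem (suc j) g ξ η) total ,
  <⇒≤ lt , λ e → ⊥-elim (<-irrefl e lt)
  where
  lt = <-≤-trans (lower-value g j ξ η) le
  lem : ∀ κ g ξ η → suc (suc κ) + g + (κ * (ξ + suc η) + ξ) ≡ suc κ + g + (κ * (suc ξ + η) + suc ξ)
  lem = solve-∀
lower g j ξ zero =
  let (value , total) = starBalanced-shift (suc (suc (suc j)) + g) (suc j) ξ in
  optimal-resp {κ = suc (suc j)} {0} {ξ} {suc j} {ξ} {0} (≡-sym (+-identityʳ ξ)) total value (shifted g)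
  where
  shifted : ∀ g → Optimal (suc (suc (suc j)) + g) (suc (suc j)) 0 ξ
  shifted zero = subst (λ s → Optimal s (suc (suc j)) 0 ξ) (≡-sym (+-identityʳ _)) (optimal-done (suc (suc j)) 0 ξ)
  shifted (suc g) = subst (λ s → Optimal s (suc (suc j)) 0 ξ) (≡-sym (+-suc (suc (suc (suc j))) g)) (lower g (suc j) 0 ξ)
lower zero j ξ (suc η) = lower-step zero j ξ η
  (subst (λ s → Optimal s (suc j) (suc ξ) η) (≡-sym (+-identityʳ (suc (suc j)))) (optimal-done (suc j) (suc ξ) η))
lower (suc g) j ξ (suc η) = lower-step (suc g) j ξ η
  (subst (λ s → Optimal s (suc j) (suc ξ) η) (≡-sym (+-suc (suc (suc j)) g)) (lower g j (suc ξ) η))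

optimal : ∀ s j ξ η → 1 ≤ s → Optimal s (suc j) ξ η
optimal s j ξ η 1≤s with s ≤? suc (suc j)
... | yes s≤ = raise s (suc j) ξ η 1≤s s≤
... | no s≰ with m≤n⇒∃[o]m+o≡n (≰⇒> s≰)
... | g , refl = lower g j ξ η

-- Euclidean parameters `k`, `x`, `y` of an order.

quotient-unique : ∀ r k k′ x x′ → x ≤ r → x′ ≤ r → k * suc r + x ≡ k′ * suc r + x′ → k ≡ k′ × x ≡ x′
quotient-unique r zero zero x x′ _ _ eq = refl , eq
quotient-unique r zero (suc k′) x x′ x≤r _ eq = ⊥-elim (<⇒≱ (s≤s x≤r)
  (subst (suc r ≤_) (≡-sym (trans eq (+-assoc (suc r) (k′ * suc r) x′))) (m≤m+n (suc r) _)))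
quotient-unique r (suc k) zero x x′ _ x′≤r eq = ⊥-elim (<⇒≱ (s≤s x′≤r)
  (subst (suc r ≤_) (trans (≡-sym (+-assoc (suc r) (k * suc r) x)) eq) (m≤m+n (suc r) _)))
quotient-unique r (suc k) (suc k′) x x′ x≤r x′≤r eq
  with quotient-unique r k k′ x x′ x≤r x′≤r (+-cancelˡ-≡ (suc r) _ _
         (trans (≡-sym (+-assoc (suc r) (k * suc r) x)) (trans eq (+-assoc (suc r) (k′ * suc r) x′))))
... | refl , refl = refl , refl

starOrder-unique : ∀ {k x y k′ x′ y′} → x + y ≡ x′ + y′ → starOrder k x y ≡ starOrder k′ x′ y′ → k ≡ k′ × x ≡ x′ × y ≡ y′
starOrder-unique {k} {x} {y} {k′} {x′} {y′} r≡ eq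
  with quotient-unique (x + y) k k′ x x′ (m≤m+n x y) (subst (x′ ≤_) (≡-sym r≡) (m≤m+n x′ y′))
         (suc-injective (trans (≡-sym (+-suc _ x)) (trans eq (trans (cong (λ r → k′ * suc r + suc x′) (≡-sym r≡)) (+-suc _ x′)))))
... | refl , refl = refl , refl , +-cancelˡ-≡ x _ _ r≡

starParameters : ∀ m r → 1 ≤ m → ∃ λ k → ∃ λ x → ∃ λ y → x + y ≡ r × m ≡ starOrder k x y
starParameters (suc m) r _ with m % suc r | m%n<n m (suc r) | m≡m%n+[m/n]*n m (suc r)
... | x | s≤s x≤r | eq = m / suc r , x , r ∸ x , m+[n∸m]≡n x≤r ,
  trans (cong suc (trans eq (+-comm x _))) (trans (≡-sym (+-suc _ x)) (cong (λ l → m / suc r * suc l + suc x) (≡-sym (m+[n∸m]≡n x≤r))))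

-- The best star of given order and number of cliques.

length≤sum : ∀ {l} → All (1 ≤_) l → length l ≤ sum l
length≤sum [] = z≤n
length≤sum (p ∷ ps) = +-mono-≤ p (length≤sum ps)

-- Covers quotient 0, which occurs in the second product of `star`: positive parts with sum `x`
-- number at most `x`, so `y = 0`, and the family is reread with quotient 1.
product-balanced′ : ∀ k x y l → All (1 ≤_) l → length l ≡ x + y → sum l ≡ k * (x + y) + x → product l ≤ balanced k x y
product-balanced′ (suc j) x y l _ len total = proj₁ (product-balanced j x y l len total)
product-balanced′ zero x y l pos len total with y
... | suc y = ⊥-elim (<⇒≱ (m<m+n x (s≤s z≤n)) (subst₂ _≤_ len total (length≤sum pos)))
... | zero = subst (product l ≤_) val (proj₁ (product-balanced 0 0 x l (trans len (+-identityʳ x))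
    (trans total (trans (≡-sym (+-identityʳ x)) (cong (_+ 0) (≡-sym (*-identityˡ x)))))))
  where
  val : balanced 1 0 x ≡ balanced 0 x 0
  val = balanced-shift 0 x

-- If `s = k + 1`, balanced leaves maximise both products of `star` at once. Otherwise the leaves
-- are first balanced around their own quotient, `optimal` then adjusts the centre, and uniqueness
-- of the Euclidean parameters identifies its result with the given `k`, `x`, `y`.
star-max : ∀ s l k x y → 1 ≤ s → All (1 ≤_) l → length l ≡ x + y → s + sum l ≡ starOrder k x y →
  star s l ≤ turánStar k x y ×
  (star s l ≡ turánStar k x y → (s ≡ suc k × All (Sandwich k) l) ⊎ (∃ λ p → l ≡ p ∷ [] × s < p))
star-max s l k x y 1≤s pos len total with s ≟ suc k
... | yes refl = +-mono-≤ (*-monoʳ-≤ (suc k) (proj₁ P)) Q ,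
  λ eq → inj₁ (refl , proj₂ P (*-cancelˡ-≡ _ _ (suc k) (proj₁ (+-≤-≡ (*-monoʳ-≤ (suc k) (proj₁ P)) Q eq))))
  where
  lem : ∀ k r x → k * suc r + suc x ≡ suc k + (k * r + x)
  lem = solve-∀
  total′ : sum l ≡ k * (x + y) + x
  total′ = +-cancelˡ-≡ (suc k) _ _ (trans total (lem k (x + y) x))
  P = product-suc-balanced k x y l len total′
  Q = product-balanced′ k x y l pos len total′
star-max s [] k x y 1≤s pos len total | no s≢ = ⊥-elim (s≢ (trans (≡-sym (+-identityʳ s)) (trans total (lem k x y (≡-sym len)))))
  where lem : ∀ k x y → x + y ≡ 0 → starOrder k x y ≡ suc k
        lem k zero zero _ = trans (+-comm (k * 1) 1) (cong suc (*-identityʳ k))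
star-max s l@(p₀ ∷ l₀) k x y 1≤s pos len total | no s≢
  with sum l / suc (length l₀) in κ≡ | sum l % suc (length l₀) | m%n<n (sum l) (suc (length l₀)) | m≡m%n+[m/n]*n (sum l) (suc (length l₀))
... | zero | ξ | _ | _ = ⊥-elim (<-irrefl (≡-sym κ≡) (m≥n⇒m/n>0 {sum l} {suc (length l₀)} (length≤sum pos)))
... | suc j | ξ | s≤s ξ≤ | eqd with optimal s j ξ (suc (length l₀) ∸ ξ) 1≤s
... | k′ , x′ , y′ , r≡ , total″ , le , eq
  with starOrder-unique {k} {x} {y} {k′} {x′} {y′} (trans (≡-sym len) (trans (≡-sym (m+[n∸m]≡n (≤-trans ξ≤ (n≤1+n _)))) (≡-sym r≡)))
         (trans (≡-sym total) (trans (cong (s +_) sumη) total″))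
  where
  r = suc (length l₀)
  sumη : sum l ≡ suc j * (ξ + (r ∸ ξ)) + ξ
  sumη = trans eqd (trans (+-comm ξ _) (cong (λ z → suc j * z + ξ) (≡-sym (m+[n∸m]≡n (≤-trans ξ≤ (n≤1+n _))))))
... | refl , refl , refl = ≤-trans le₁ le , λ e →
    exceptional (eq (≤-antisym le (subst (_≤ starBalanced s (suc j) ξ η) e le₁)))
  where
  r = suc (length l₀)
  η = r ∸ ξ
  rη : ξ + η ≡ r
  rη = m+[n∸m]≡n (≤-trans ξ≤ (n≤1+n _))
  sumη : sum l ≡ suc j * (ξ + η) + ξ
  sumη = trans eqd (trans (+-comm ξ _) (cong (λ z → suc j * z + ξ) (≡-sym rη)))
  le₁ : star s l ≤ starBalanced s (suc j) ξ η
  le₁ = +-mono-≤ (*-monoʳ-≤ s (proj₁ (product-suc-balanced (suc j) ξ η l (≡-sym rη) sumη)))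
                 (proj₁ (product-balanced j ξ η l (≡-sym rη) sumη))
  exceptional : s ≡ suc k ⊎ (ξ + η ≡ 1 × s < suc j * (ξ + η) + ξ) → (s ≡ suc k × All (Sandwich k) l) ⊎ (∃ λ p → l ≡ p ∷ [] × s < p)
  exceptional (inj₁ e) = ⊥-elim (s≢ e)
  exceptional (inj₂ (one , lt)) = inj₂ (single l₀ (suc-injective (trans (≡-sym rη) one)) (subst (s <_) (≡-sym sumη) lt))
    where
    single : ∀ l₀ → length l₀ ≡ 0 → s < sum (p₀ ∷ l₀) → ∃ λ p → p₀ ∷ l₀ ≡ p ∷ [] × s < p
    single [] _ lt = p₀ , refl , subst (s <_) (+-identityʳ p₀) lt

balancedList-positive : ∀ k x y → suc (x + y) ≤ starOrder k x y → All (1 ≤_) (balancedList k x y)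
balancedList-positive (suc k) x y _ = All.++⁺ (All.replicate⁺ x (s≤s z≤n)) (All.replicate⁺ y (s≤s z≤n))
balancedList-positive zero x zero _ = All.++⁺ (All.replicate⁺ x (s≤s z≤n)) []
balancedList-positive zero x (suc y) (s≤s le) = ⊥-elim (<⇒≱ (m<m+n x (s≤s z≤n)) le)

starOrder-split : ∀ k x y → suc k + sum (balancedList k x y) ≡ starOrder k x y
starOrder-split k x y = trans (cong (suc k +_) (sum-balancedList k x y)) (lem k (x + y) x)
  where lem : ∀ k r x → suc k + (k * r + x) ≡ k * suc r + suc x
        lem = solve-∀

-- One vertex of the centre is split off as a new leaf of order one. This does not decrease the
-- index, and `star-max` bounds the resulting star by the Turán star with one more leaf; `d` counts
-- the leaves still to be gained.
turánStar-mono : ∀ d k x y k′ x′ y′ → x + y + d ≡ x′ + y′ → starOrder k x y ≡ starOrder k′ x′ y′ →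
  suc (x′ + y′) ≤ starOrder k′ x′ y′ → turánStar k x y ≤ turánStar k′ x′ y′
turánStar-mono zero k x y k′ x′ y′ r≡ m≡ r≤ with starOrder-unique {k} {x} {y} {k′} {x′} {y′} (trans (≡-sym (+-identityʳ _)) r≡) m≡
... | refl , refl , refl = ≤-refl
turánStar-mono (suc d) zero x y k′ x′ y′ r≡ m≡ r≤ =
  ⊥-elim (<⇒≱ (s≤s (s≤s (≤-trans (m≤m+n x y) (m≤m+n (x + y) d)))) (subst₂ _≤_ (cong suc (trans (≡-sym r≡) (+-suc (x + y) d))) (≡-sym m≡) r≤))
turánStar-mono (suc d) (suc j) x y k′ x′ y′ r≡ m≡ r≤
  with starParameters (starOrder k′ x′ y′) (suc (x + y)) (≤-trans (s≤s z≤n) r≤)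
... | k″ , x″ , y″ , r″≡ , m″≡ = begin
  turánStar k x y                     ≤⟨ ≤-via (j * P) (lem j P (balanced k x y)) ⟩
  k * (2 * P) + 1 * balanced k x y    ≡⟨ ≡-sym (cong₂ (λ a b → k * (2 * a) + 1 * b) (product-suc-balancedList k x y) (product-balancedList k x y)) ⟩
  star k (1 ∷ balancedList k x y)     ≤⟨ proj₁ (star-max k (1 ∷ balancedList k x y) k″ x″ y″ (s≤s z≤n)
                                           (s≤s z≤n ∷ balancedList-positive k x y (≤-via (j * suc (x + y) + suc x) (+-assoc (suc (x + y)) _ _)))
                                           (trans (cong suc (length-balancedList k x y)) (≡-sym r″≡))
                                           (trans (+-suc k (sum (balancedList k x y))) (trans (starOrder-split k x y) (trans m≡ m″≡)))) ⟩
  turánStar k″ x″ y″                  ≤⟨ turánStar-mono d k″ x″ y″ k′ x′ y′ (trans (cong (_+ d) r″≡) (trans (≡-sym (+-suc (x + y) d)) r≡)) (≡-sym m″≡) r≤ ⟩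
  turánStar k′ x′ y′                  ∎
  where
  open ≤-Reasoning
  k = suc j
  P = balanced (suc k) x y
  lem : ∀ j P Q → suc j * (2 * P) + 1 * Q ≡ suc (suc j) * P + Q + j * P
  lem = solve-∀

-- Two stars joined at their centres.

rearrangement : ∀ {a b c d} → a ≤ b → c ≤ d → a * d + b * c ≤ a * c + b * d ×
  (a < b → c < d → a * d + b * c < a * c + b * d)
rearrangement {a} {b} {c} {d} a≤b c≤d with m≤n⇒∃[o]m+o≡n a≤b | m≤n⇒∃[o]m+o≡n c≤d
... | e , refl | f , refl = ≤-via (e * f) (lem a e c f) , strict e f (lem a e c f)
  where
  lem : ∀ a e c f → a * c + (a + e) * (c + f) ≡ a * (c + f) + (a + e) * c + e * f
  lem = solve-∀
  strict : ∀ e f → a * c + (a + e) * (c + f) ≡ a * (c + f) + (a + e) * c + e * f →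
    a < a + e → c < c + f → a * (c + f) + (a + e) * c < a * c + (a + e) * (c + f)
  strict zero f _ lt _ = ⊥-elim (<-irrefl (≡-sym (+-identityʳ a)) lt)
  strict (suc e) zero _ _ lt = ⊥-elim (<-irrefl (≡-sym (+-identityʳ c)) lt)
  strict (suc e) (suc f) eq _ _ = <-via (f + e * suc f) eq

-- The index of two Turán stars with an edge between their centres: the first term counts the stable
-- sets without the second centre, the second term those with it.
doubleStar : (k₁ x₁ y₁ k₂ x₂ y₂ : ℕ) → ℕ
doubleStar k₁ x₁ y₁ k₂ x₂ y₂ = turánStar k₁ x₁ y₁ * (suc k₂ * balanced (suc k₂) x₂ y₂)
  + suc k₁ * balanced (suc k₁) x₁ y₁ * balanced k₂ x₂ y₂

module _ (k₁ x₁ y₁ k₂ x₂ y₂ k x y : ℕ)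
  (r≡ : suc (x + y) ≡ suc (x₁ + y₁) + suc (x₂ + y₂))
  (m≡ : starOrder k x y ≡ starOrder k₁ x₁ y₁ + starOrder k₂ x₂ y₂)
  (r₁≤ : suc (x₁ + y₁) ≤ starOrder k₁ x₁ y₁) (r₂≤ : suc (x₂ + y₂) ≤ starOrder k₂ x₂ y₂) where
  private
    s = suc k₁
    t = suc k₂
    S = balanced (suc k₁) x₁ y₁
    S′ = balanced k₁ x₁ y₁
    T = balanced (suc k₂) x₂ y₂
    T′ = balanced k₂ x₂ y₂
    l₁ = balancedList k₁ x₁ y₁
    l₂ = balancedList k₂ x₂ y₂

    Bounds : Set
    Bounds = doubleStar k₁ x₁ y₁ k₂ x₂ y₂ ≤ turánStar k x y ×
      (1 ≤ x₁ + y₁ → 1 ≤ x₂ + y₂ → doubleStar k₁ x₁ y₁ k₂ x₂ y₂ < turánStar k x y)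

    prods : ∀ p → product (map suc (p ∷ l₁ ++ l₂)) ≡ suc p * (S * T) × product (p ∷ l₁ ++ l₂) ≡ p * (S′ * T′)
    prods p =
      cong (suc p *_) (trans (cong product (map-++ suc l₁ l₂)) (trans (product-++ (map suc l₁) (map suc l₂))
        (cong₂ _*_ (product-suc-balancedList k₁ x₁ y₁) (product-suc-balancedList k₂ x₂ y₂)))) ,
      cong (p *_) (trans (product-++ l₁ l₂) (cong₂ _*_ (product-balancedList k₁ x₁ y₁) (product-balancedList k₂ x₂ y₂)))

    star≤ : ∀ p q → 1 ≤ p → 1 ≤ q → p + q ≡ s + t → p * (suc q * (S * T)) + q * (S′ * T′) ≤ turánStar k x y
    star≤ p q 1≤p 1≤q pq≡ = subst (_≤ turánStar k x y) (cong₂ (λ a b → p * a + b) (proj₁ (prods q)) (proj₂ (prods q)))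
      (proj₁ (star-max p (q ∷ l₁ ++ l₂) k x y 1≤p
        (1≤q ∷ All.++⁺ (balancedList-positive k₁ x₁ y₁ r₁≤) (balancedList-positive k₂ x₂ y₂ r₂≤))
        (suc-injective (trans (cong (2 +_) (trans (length-++ l₁) (cong₂ _+_ (length-balancedList k₁ x₁ y₁) (length-balancedList k₂ x₂ y₂))))
           (trans (≡-sym (cong suc (+-suc (x₁ + y₁) (x₂ + y₂)))) (≡-sym r≡))))
        (trans (cong (λ z → p + (q + z)) (sum-++ l₁ l₂))
          (trans (≡-sym (+-assoc p q _)) (trans (cong (_+ (sum l₁ + sum l₂)) pq≡)
            (trans (lem s t (sum l₁) (sum l₂)) (trans (cong₂ _+_ (starOrder-split k₁ x₁ y₁) (starOrder-split k₂ x₂ y₂)) (≡-sym m≡))))))))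
      where lem : ∀ a b c d → a + b + (c + d) ≡ a + c + (b + d)
            lem = solve-∀

    via : ∀ {a b c d} r → a ≤ b → c ≤ d → (1 ≤ x₁ + y₁ → 1 ≤ x₂ + y₂ → a < b × c < d) →
      doubleStar k₁ x₁ y₁ k₂ x₂ y₂ ≡ r + (a * d + b * c) → r + (a * c + b * d) ≤ turánStar k x y → Bounds
    via r a≤b c≤d strict eq le =
      subst (_≤ turánStar k x y) (≡-sym eq) (≤-trans (+-monoʳ-≤ r (proj₁ (rearrangement a≤b c≤d))) le) ,
      λ 1≤₁ 1≤₂ → let (a<b , c<d) = strict 1≤₁ 1≤₂ in
        subst (_< turánStar k x y) (≡-sym eq) (<-≤-trans (+-monoʳ-< r (proj₂ (rearrangement a≤b c≤d) a<b c<d)) le)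

  -- Merging the two stars: all cliques other than the larger centre become its leaves.
  doubleStar-max : doubleStar k₁ x₁ y₁ k₂ x₂ y₂ ≤ turánStar k x y ×
    (1 ≤ x₁ + y₁ → 1 ≤ x₂ + y₂ → doubleStar k₁ x₁ y₁ k₂ x₂ y₂ < turánStar k x y)
  doubleStar-max with ≤-total s t
  ... | inj₁ s≤t = via {S′} {S} {s * T′} {t * T} (s * (t * (S * T)))
    (balanced≤balanced-suc k₁ x₁ y₁) (*-mono-≤ s≤t (balanced≤balanced-suc k₂ x₂ y₂))
    (λ 1≤₁ 1≤₂ → balanced<balanced-suc k₁ x₁ y₁ 1≤₁ ,
      <-≤-trans (*-monoʳ-< s (balanced<balanced-suc k₂ x₂ y₂ 1≤₂)) (*-monoˡ-≤ T s≤t))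
    (lem₁ s t S S′ T T′)
    (subst (_≤ turánStar k x y) (lem₂ s t S S′ T T′) (star≤ t s (s≤s z≤n) (s≤s z≤n) (+-comm t s)))
    where
    lem₁ : ∀ s t S S′ T T′ → (s * S + S′) * (t * T) + s * S * T′ ≡ s * (t * (S * T)) + (S′ * (t * T) + S * (s * T′))
    lem₁ = solve-∀
    lem₂ : ∀ s t S S′ T T′ → t * (suc s * (S * T)) + s * (S′ * T′) ≡ s * (t * (S * T)) + (S′ * (s * T′) + S * (t * T))
    lem₂ = solve-∀
  ... | inj₂ t≤s = via {T′} {T} {t * S′} {s * S} (s * (t * (S * T)))
    (balanced≤balanced-suc k₂ x₂ y₂) (*-mono-≤ t≤s (balanced≤balanced-suc k₁ x₁ y₁))
    (λ 1≤₁ 1≤₂ → balanced<balanced-suc k₂ x₂ y₂ 1≤₂ ,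
      <-≤-trans (*-monoʳ-< t (balanced<balanced-suc k₁ x₁ y₁ 1≤₁)) (*-monoˡ-≤ S t≤s))
    (lem₁ s t S S′ T T′)
    (subst (_≤ turánStar k x y) (lem₂ s t S S′ T T′) (star≤ s t (s≤s z≤n) (s≤s z≤n) refl))
    where
    lem₁ : ∀ s t S S′ T T′ → (s * S + S′) * (t * T) + s * S * T′ ≡ s * (t * (S * T)) + (T′ * (s * S) + T * (t * S′))
    lem₁ = solve-∀
    lem₂ : ∀ s t S S′ T T′ → s * (suc t * (S * T)) + t * (S′ * T′) ≡ s * (t * (S * T)) + (T′ * (t * S′) + T * (s * S))
    lem₂ = solve-∀

-- Subsets of the vertex set.

bool-cases : ∀ b → b ≡ true ⊎ b ≡ false
bool-cases true = inj₁ refl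
bool-cases false = inj₂ refl

true≢false : ∀ {b} {A : Set} → b ≡ true → b ≡ false → A
true≢false refl ()

∧⁻ : ∀ {a b} → a ∧ b ≡ true → a ≡ true × b ≡ true
∧⁻ {true} {true} _ = refl , refl

not-true⁻ : ∀ {b} → not b ≡ true → b ≡ false
not-true⁻ {false} _ = refl

does⁻ : ∀ {A : Set} (d : Dec A) → does d ≡ true → A
does⁻ (yes a) _ = a

does⁻-false : ∀ {A : Set} (d : Dec A) → does d ≡ false → ¬ A
does⁻-false (no ¬a) _ = ¬a

isMember : ∀ {n} → Subset n → Fin n → Bool
isMember U x = does (x ∈? U)

isEqual : ∀ {n} → Fin n → Fin n → Bool
isEqual v x = does (v Fin.≟ x)

⊆-ext : ∀ {n} {p q : Subset n} → (∀ {x} → x ∈ p → x ∈ q) → (∀ {x} → x ∈ q → x ∈ p) → p ≡ q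
⊆-ext f g = ⊆-antisym f g

infixl 7 _∩ᵖ_ _∖_ _⊖_
infixl 6 _∪_

opaque
  _∩ᵖ_ : ∀ {n} → Subset n → (Fin n → Bool) → Subset n
  W ∩ᵖ P = tabulate λ x → lookup W x ∧ P x

  _∖_ : ∀ {n} → Subset n → Subset n → Subset n
  W ∖ U = W ∩ᵖ (not ∘ isMember U)

  _⊖_ : ∀ {n} → Subset n → Fin n → Subset n
  W ⊖ v = W ∩ᵖ (not ∘ isEqual v)

  _∪_ : ∀ {n} → Subset n → Subset n → Subset n
  _∪_ = Subset._∪_

  ∖-def : ∀ {n} (W U : Subset n) → W ∖ U ≡ W ∩ᵖ (not ∘ isMember U)
  ∖-def W U = refl

  ⊖-def : ∀ {n} (W : Subset n) v → W ⊖ v ≡ W ∩ᵖ (not ∘ isEqual v)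
  ⊖-def W v = refl

  ∣∩ᵖ∣-split : ∀ {n} (W : Subset n) P → ∣ W ∩ᵖ P ∣ + ∣ W ∩ᵖ (not ∘ P) ∣ ≡ ∣ W ∣
  ∣∩ᵖ∣-split [] P = refl
  ∣∩ᵖ∣-split (outside ∷ W) P = ∣∩ᵖ∣-split W (P ∘ suc)
  ∣∩ᵖ∣-split (inside ∷ W) P with P zero
  ... | true = cong suc (∣∩ᵖ∣-split W (P ∘ suc))
  ... | false = trans (+-suc ∣ W ∩ᵖ (P ∘ suc) ∣ _) (cong suc (∣∩ᵖ∣-split W (P ∘ suc)))

module _ {n : ℕ} where

  opaque
    unfolding _∩ᵖ_ _∖_ _⊖_ _∪_

    ∈∩ᵖ⁺ : ∀ {W : Subset n} {P x} → x ∈ W → P x ≡ true → x ∈ W ∩ᵖ P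
    ∈∩ᵖ⁺ {W} {P} {x} x∈W Px = lookup⇒[]= x _ (trans (lookup∘tabulate _ x) (cong₂ _∧_ ([]=⇒lookup x∈W) Px))

    ∈∩ᵖ⁻ : ∀ {W : Subset n} {P x} → x ∈ W ∩ᵖ P → x ∈ W × P x ≡ true
    ∈∩ᵖ⁻ {W} {P} {x} x∈ with ∧⁻ (trans (≡-sym (lookup∘tabulate (λ x → lookup W x ∧ P x) x)) ([]=⇒lookup x∈))
    ... | a , b = lookup⇒[]= x W a , b

    ∈∖⁺ : ∀ {W U : Subset n} {x} → x ∈ W → x ∉ U → x ∈ W ∖ U
    ∈∖⁺ {U = U} {x} x∈W x∉U = ∈∩ᵖ⁺ x∈W (cong not (dec-false (x ∈? U) x∉U))

    ∈∖⁻ : ∀ {W U : Subset n} {x} → x ∈ W ∖ U → x ∈ W × x ∉ U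
    ∈∖⁻ {W} {U} {x} x∈ with ∈∩ᵖ⁻ {W} {not ∘ isMember U} x∈
    ... | a , b = a , does⁻-false (x ∈? U) (not-true⁻ b)

    ∈⊖⁺ : ∀ {W : Subset n} {v x} → x ∈ W → v ≢ x → x ∈ W ⊖ v
    ∈⊖⁺ {v = v} {x} x∈W v≢x = ∈∩ᵖ⁺ x∈W (cong not (dec-false (v Fin.≟ x) v≢x))

    ∈⊖⁻ : ∀ {W : Subset n} {v x} → x ∈ W ⊖ v → x ∈ W × v ≢ x
    ∈⊖⁻ {W} {v} {x} x∈ with ∈∩ᵖ⁻ {W} {not ∘ isEqual v} x∈
    ... | a , b = a , does⁻-false (v Fin.≟ x) (not-true⁻ b)

    ∪ˡ : ∀ {p q : Subset n} {x} → x ∈ p → x ∈ p ∪ q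
    ∪ˡ {p} {q} x∈ = x∈p∪q⁺ {p = p} {q} (inj₁ x∈)

    ∪ʳ : ∀ {p q : Subset n} {x} → x ∈ q → x ∈ p ∪ q
    ∪ʳ {p} {q} x∈ = x∈p∪q⁺ {p = p} {q} (inj₂ x∈)

    ∪⁻ : ∀ {p q : Subset n} {x} → x ∈ p ∪ q → x ∈ p ⊎ x ∈ q
    ∪⁻ {p} {q} = x∈p∪q⁻ p q

  ∣⊖∣ : ∀ {W : Subset n} {v} → v ∈ W → suc ∣ W ⊖ v ∣ ≡ ∣ W ∣
  ∣⊖∣ {W} {v} v∈W = trans (cong₂ _+_ (≡-sym single) (cong ∣_∣ (⊖-def W v))) (∣∩ᵖ∣-split W (isEqual v))
    where
    single : ∣ W ∩ᵖ isEqual v ∣ ≡ 1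
    single = trans (cong ∣_∣ (⊆-ext {p = W ∩ᵖ isEqual v} {⁅ v ⁆}
      (λ x∈ → subst (_∈ ⁅ v ⁆) (does⁻ (v Fin.≟ _) (proj₂ (∈∩ᵖ⁻ {W = W} x∈))) (x∈⁅x⁆ v))
      (λ x∈ → subst (_∈ W ∩ᵖ isEqual v) (≡-sym (x∈⁅y⁆⇒x≡y v x∈)) (∈∩ᵖ⁺ v∈W (dec-true (v Fin.≟ v) refl))))) (∣⁅x⁆∣≡1 v)

  ∣∖∣ : ∀ {W U : Subset n} → U ⊆ W → ∣ U ∣ + ∣ W ∖ U ∣ ≡ ∣ W ∣
  ∣∖∣ {W} {U} U⊆W = trans (cong₂ (λ p q → ∣ p ∣ + ∣ q ∣)
    (⊆-ext (λ x∈ → ∈∩ᵖ⁺ (U⊆W x∈) (dec-true (_ ∈? U) x∈)) (λ x∈ → does⁻ (_ ∈? U) (proj₂ (∈∩ᵖ⁻ x∈)))) (∖-def W U))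
    (∣∩ᵖ∣-split W (isMember U))

  ∣∣-mono : ∀ {p q : Subset n} → (∀ {x} → x ∈ p → x ∈ q) → ∣ p ∣ ≤ ∣ q ∣
  ∣∣-mono f = p⊆q⇒∣p∣≤∣q∣ f

  0<∣∣ : ∀ {p : Subset n} {x} → x ∈ p → 0 < ∣ p ∣
  0<∣∣ {p} x∈ = subst (0 <_) (∣⊖∣ x∈) (s≤s z≤n)

  nonempty-or-empty : ∀ (p : Subset n) → Nonempty p ⊎ (∀ {x} → x ∉ p)
  nonempty-or-empty p with nonempty? p
  ... | yes ne = inj₁ ne
  ... | no ¬ne = inj₂ (λ x∈ → ¬ne (_ , x∈))

  ∣∣≡0 : ∀ {p : Subset n} → (∀ {x} → x ∉ p) → ∣ p ∣ ≡ 0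
  ∣∣≡0 {p} empty with ∣ p ∣ in eq
  ... | zero = refl
  ... | suc m = ⊥-elim (absurd p empty eq)
    where
    absurd : ∀ {n m} (p : Subset n) → (∀ {x} → x ∉ p) → ∣ p ∣ ≢ suc m
    absurd (inside ∷ p) e _ = e here
    absurd (outside ∷ p) e eq = absurd p (λ x∈ → e (there x∈)) eq

  0<∣∣⁻ : ∀ {p : Subset n} → 0 < ∣ p ∣ → Nonempty p
  0<∣∣⁻ {p} lt with nonempty-or-empty p
  ... | inj₁ ne = ne
  ... | inj₂ e = ⊥-elim (<-irrefl (≡-sym (∣∣≡0 e)) lt)

  ⊆-card-≡ : ∀ {p q : Subset n} → (∀ {x} → x ∈ p → x ∈ q) → ∣ q ∣ ≤ ∣ p ∣ → ∀ {x} → x ∈ q → x ∈ p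
  ⊆-card-≡ {p} {q} p⊆q le {x} x∈q with x ∈? p
  ... | yes x∈p = x∈p
  ... | no x∉p = ⊥-elim (<⇒≱ (≤-<-trans (∣∣-mono {p} {q ⊖ x} λ y∈p → ∈⊖⁺ (p⊆q y∈p) (λ { refl → x∉p y∈p }))
      (subst (∣ q ⊖ x ∣ <_) (∣⊖∣ x∈q) ≤-refl)) le)

  ∣∪∣ : ∀ {p q : Subset n} → (∀ {x} → x ∈ p → x ∉ q) → ∣ p ∪ q ∣ ≡ ∣ p ∣ + ∣ q ∣
  ∣∪∣ {p} {q} disj = trans (≡-sym (∣∖∣ {p ∪ q} {p} ∪ˡ)) (cong (∣ p ∣ +_) (cong ∣_∣ (⊆-ext
    (λ x∈ → right (∪⁻ (proj₁ (∈∖⁻ x∈))) (proj₂ (∈∖⁻ {W = p ∪ q} x∈)))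
    (λ x∈q → ∈∖⁺ (∪ʳ x∈q) (λ x∈p → disj x∈p x∈q)))))
    where
    right : ∀ {x} → x ∈ p ⊎ x ∈ q → x ∉ p → x ∈ q
    right (inj₁ a) b = ⊥-elim (b a)
    right (inj₂ a) _ = a

  insert : Fin n → Subset n → Subset n
  insert v p = ⁅ v ⁆ ∪ p

  ∈insert : ∀ {v p} → v ∈ insert v p
  ∈insert {v} = ∪ˡ (x∈⁅x⁆ v)

  insert⁻ : ∀ {v p x} → x ∈ insert v p → x ≡ v ⊎ x ∈ p
  insert⁻ {v} {p} x∈ with ∪⁻ {p = ⁅ v ⁆} {p} x∈
  ... | inj₁ e = inj₁ (x∈⁅y⁆⇒x≡y v e)
  ... | inj₂ e = inj₂ e

  ∣insert∣ : ∀ {v p} → v ∉ p → ∣ insert v p ∣ ≡ suc ∣ p ∣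
  ∣insert∣ {v} {p} v∉ = trans (∣∪∣ {p = ⁅ v ⁆} {p} (λ x∈ → subst (_∉ p) (≡-sym (x∈⁅y⁆⇒x≡y v x∈)) v∉)) (cong (_+ ∣ p ∣) (∣⁅x⁆∣≡1 v))

  ∣∣≤1⇒≡ : ∀ {p : Subset n} {x y} → ∣ p ∣ ≤ 1 → x ∈ p → y ∈ p → x ≡ y
  ∣∣≤1⇒≡ {p} {x} {y} le x∈ y∈ with x Fin.≟ y
  ... | yes e = e
  ... | no x≢y = ⊥-elim (<⇒≱ (s≤s (0<∣∣ (∈⊖⁺ y∈ x≢y))) (subst (_≤ 1) (≡-sym (∣⊖∣ x∈)) le))

bool-ext : ∀ {a b} → (a ≡ true → b ≡ true) → (b ≡ true → a ≡ true) → a ≡ b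
bool-ext {true} {b} f g = ≡-sym (f refl)
bool-ext {false} {true} f g = g refl
bool-ext {false} {false} f g = refl

-- Counting subsets.

count : ∀ {n} → (Subset n → Bool) → ℕ
count {zero} P = if P [] then 1 else 0
count {suc n} P = count (P ∘ (false ∷_)) + count (P ∘ (true ∷_))

count-cong : ∀ {n} {P Q : Subset n → Bool} → (∀ S → P S ≡ Q S) → count P ≡ count Q
count-cong {zero} h = cong (if_then 1 else 0) (h [])
count-cong {suc n} h = cong₂ _+_ (count-cong (h ∘ (false ∷_))) (count-cong (h ∘ (true ∷_)))

count-mono : ∀ {n} {P Q : Subset n → Bool} → (∀ S → P S ≡ true → Q S ≡ true) → count P ≤ count Q
count-mono {zero} {P} {Q} h with P [] | Q [] | h []
... | true | true | _ = ≤-refl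
... | true | false | f with () ← f refl
... | false | _ | _ = z≤n
count-mono {suc n} h = +-mono-≤ (count-mono (h ∘ (false ∷_))) (count-mono (h ∘ (true ∷_)))

count-none : ∀ n → count {n} (λ _ → false) ≡ 0
count-none zero = refl
count-none (suc n) = cong₂ _+_ (count-none n) (count-none n)

count-empty : ∀ {n} {P : Subset n → Bool} → P empty ≡ true → (∀ S → P S ≡ true → S ≡ empty) → count P ≡ 1
count-empty {zero} Pe _ rewrite Pe = refl
count-empty {suc n} {P} Pe only = cong₂ _+_ (count-empty Pe λ S PS → cong tail (only (false ∷ S) PS))
  (trans (count-cong {P = P ∘ (true ∷_)} {λ _ → false} λ S → bool-ext (λ PS → absurd (only (true ∷ S) PS)) λ ()) (count-none n))
  where
  absurd : ∀ {n} {S S′ : Subset n} {A : Set} → true ∷ S ≡ false ∷ S′ → A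
  absurd ()

-- Subsets containing `v` are counted through their bijection with the subsets omitting `v`, so both
-- terms range over the latter.
count-split : ∀ {n} (P : Subset n → Bool) v →
  count P ≡ count (λ S → not (lookup S v) ∧ P S) + count (λ S → not (lookup S v) ∧ P (S [ v ]≔ true))
count-split {suc n} P zero = begin
  count (P ∘ (false ∷_)) + count (P ∘ (true ∷_))
    ≡⟨ cong₂ _+_ (≡-sym (trans (cong (count (P ∘ (false ∷_)) +_) (count-none n)) (+-identityʳ _)))
                 (≡-sym (trans (cong (count (P ∘ (true ∷_)) +_) (count-none n)) (+-identityʳ _))) ⟩
  count (P ∘ (false ∷_)) + count {n} (λ _ → false) + (count (P ∘ (true ∷_)) + count {n} (λ _ → false)) ∎
  where open ≡-Reasoning
count-split {suc n} P (suc v) =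
  trans (cong₂ _+_ (count-split (P ∘ (false ∷_)) v) (count-split (P ∘ (true ∷_)) v))
    (interchange (without false) (with-v false) (without true) (with-v true))
  where
  without with-v : Bool → ℕ
  without b = count λ S → not (lookup S v) ∧ P (b ∷ S)
  with-v b = count λ S → not (lookup S v) ∧ P (b ∷ S [ v ]≔ true)
  interchange : ∀ a b c d → a + b + (c + d) ≡ a + c + (b + d)
  interchange = solve-∀

length-filter-map : ∀ {A B : Set} {P : B → Set} (P? : ∀ b → Dec (P b)) (f : A → B) xs →
  length (filter P? (map f xs)) ≡ length (filter (P? ∘ f) xs)
length-filter-map P? f [] = refl
length-filter-map P? f (x ∷ xs) with does (P? (f x))
... | true = cong suc (length-filter-map P? f xs)
... | false = length-filter-map P? f xs

length-filter-allSubsets : ∀ n {P : Subset n → Set} (P? : ∀ S → Dec (P S)) → length (filter P? (allSubsets n)) ≡ count (does ∘ P?)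
length-filter-allSubsets zero P? with does (P? [])
... | true = refl
... | false = refl
length-filter-allSubsets (suc n) P? = begin
  length (filter P? (map (false ∷_) (allSubsets n) ++ map (true ∷_) (allSubsets n)))
    ≡⟨ cong length (filter-++ P? (map (false ∷_) (allSubsets n)) _) ⟩
  length (filter P? (map (false ∷_) (allSubsets n)) ++ filter P? (map (true ∷_) (allSubsets n)))
    ≡⟨ length-++ (filter P? (map (false ∷_) (allSubsets n))) ⟩
  length (filter P? (map (false ∷_) (allSubsets n))) + length (filter P? (map (true ∷_) (allSubsets n)))
    ≡⟨ cong₂ _+_ (trans (length-filter-map P? (false ∷_) (allSubsets n)) (length-filter-allSubsets n (P? ∘ (false ∷_))))
                 (trans (length-filter-map P? (true ∷_) (allSubsets n)) (length-filter-allSubsets n (P? ∘ (true ∷_)))) ⟩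
  count (does ∘ P? ∘ (false ∷_)) + count (does ∘ P? ∘ (true ∷_)) ∎
  where open ≡-Reasoning

module _ {n : ℕ} where

  ∈-lookup : ∀ {S : Subset n} {x} → x ∈ S → lookup S x ≡ true
  ∈-lookup = []=⇒lookup

  lookup-∈ : ∀ {S : Subset n} {x} → lookup S x ≡ true → x ∈ S
  lookup-∈ {S} {x} = lookup⇒[]= x S

  ∈-update⁺ : ∀ {S : Subset n} {v x} → x ∈ S → x ∈ S [ v ]≔ true
  ∈-update⁺ {S} {v} {x} x∈ with x Fin.≟ v
  ... | yes refl = lookup-∈ (lookup∘updateAt x S)
  ... | no x≢v = lookup-∈ (trans (lookup∘updateAt′ x v x≢v S) (∈-lookup x∈))

  ∈-update : ∀ {S : Subset n} {v} → v ∈ S [ v ]≔ true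
  ∈-update {S} {v} = lookup-∈ (lookup∘updateAt v S)

  ∈-update⁻ : ∀ {S : Subset n} {v x} → x ∈ S [ v ]≔ true → v ≢ x → x ∈ S
  ∈-update⁻ {S} {v} {x} x∈ v≢x = lookup-∈ (trans (≡-sym (lookup∘updateAt′ x v (v≢x ∘ ≡-sym) S)) (∈-lookup x∈))

-- Stable sets inside a vertex set.

module Stable {n : ℕ} (G : Graph n) where

  infix 4 _~_ _≁_

  _~_ : Fin n → Fin n → Set
  u ~ v = adj G u v ≡ true

  _≁_ : Fin n → Fin n → Set
  u ≁ v = adj G u v ≡ false

  ~-sym : ∀ {u v} → u ~ v → v ~ u
  ~-sym {u} {v} e = trans (sym G v u) e

  ≁-sym : ∀ {u v} → u ≁ v → v ≁ u
  ≁-sym {u} {v} e = trans (sym G v u) e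

  ~-or-≁ : ∀ u v → u ~ v ⊎ u ≁ v
  ~-or-≁ u v = bool-cases (adj G u v)

  ~⇒≢ : ∀ {u v} → u ~ v → u ≢ v
  ~⇒≢ {u} e refl = true≢false e (irrefl G u)

  infixl 7 _⊝_

  opaque
    -- The graph minus the closed neighbourhood `N[v]`; `v` is removed separately because `adj` is
    -- irreflexive.
    _⊝_ : Subset n → Fin n → Subset n
    W ⊝ v = W ⊖ v ∩ᵖ (not ∘ adj G v)

    ⊝-def : ∀ W v → W ⊝ v ≡ W ⊖ v ∩ᵖ (not ∘ adj G v)
    ⊝-def W v = refl

    ∈⊝⁺ : ∀ {W v x} → x ∈ W → v ≢ x → v ≁ x → x ∈ W ⊝ v
    ∈⊝⁺ x∈W v≢x v≁x = ∈∩ᵖ⁺ (∈⊖⁺ x∈W v≢x) (cong not v≁x)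

    ∈⊝⁻ : ∀ {W v x} → x ∈ W ⊝ v → x ∈ W × v ≢ x × v ≁ x
    ∈⊝⁻ x∈ with ∈∩ᵖ⁻ x∈
    ... | a , b with ∈⊖⁻ a
    ... | c , d = c , d , not-true⁻ b

  neighbours : Subset n → Fin n → Subset n
  neighbours W v = W ∩ᵖ adj G v

  deg : Subset n → Fin n → ℕ
  deg W v = ∣ neighbours W v ∣

  ∣⊝∣ : ∀ {W v} → v ∈ W → ∣ W ⊝ v ∣ + suc (deg W v) ≡ ∣ W ∣
  ∣⊝∣ {W} {v} v∈ = begin
    ∣ W ⊝ v ∣ + suc (deg W v)
      ≡⟨ trans (+-suc _ _) (cong suc (+-comm ∣ W ⊝ v ∣ (deg W v))) ⟩
    suc (deg W v + ∣ W ⊝ v ∣)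
      ≡⟨ cong suc (cong₂ (λ p q → ∣ p ∣ + ∣ q ∣)
           (⊆-ext (λ x∈ → ∈∩ᵖ⁺ (∈⊖⁺ (proj₁ (∈∩ᵖ⁻ x∈)) (~⇒≢ (proj₂ (∈∩ᵖ⁻ x∈)))) (proj₂ (∈∩ᵖ⁻ x∈)))
                  (λ x∈ → ∈∩ᵖ⁺ (proj₁ (∈⊖⁻ (proj₁ (∈∩ᵖ⁻ x∈)))) (proj₂ (∈∩ᵖ⁻ x∈)))) (⊝-def W v)) ⟩
    suc (∣ W ⊖ v ∩ᵖ adj G v ∣ + ∣ W ⊖ v ∩ᵖ (not ∘ adj G v) ∣)
      ≡⟨ cong suc (∣∩ᵖ∣-split (W ⊖ v) (adj G v)) ⟩
    suc ∣ W ⊖ v ∣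
      ≡⟨ ∣⊖∣ v∈ ⟩
    ∣ W ∣ ∎
    where open ≡-Reasoning

  stableIn : Subset n → Subset n → Bool
  stableIn W S = does (S ⊆? W) ∧ does (isStable? G S)

  stableIn⁻ : ∀ {W S} → stableIn W S ≡ true → (∀ {x} → x ∈ S → x ∈ W) × IsStable G S
  stableIn⁻ {W} {S} e with ∧⁻ e
  ... | a , b = does⁻ (S ⊆? W) a , does⁻ (isStable? G S) b

  stableIn⁺ : ∀ {W S} → (∀ {x} → x ∈ S → x ∈ W) → IsStable G S → stableIn W S ≡ true
  stableIn⁺ {W} {S} a b = cong₂ _∧_ (dec-true (S ⊆? W) a) (dec-true (isStable? G S) b)

  opaque
    -- The index of the subgraph induced by `W`, counted over subsets of the whole vertex set so
    -- that no subgraph has to be reindexed.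
    stableCount : Subset n → ℕ
    stableCount W = count (stableIn W)

    stableCount-full : stableCount full ≡ F G
    stableCount-full = trans (count-cong λ S → cong (_∧ does (isStable? G S)) (dec-true (S ⊆? full) (λ _ → ∈⊤)))
      (≡-sym (length-filter-allSubsets n (isStable? G)))

    stableCount-mono : ∀ {V W} → (∀ {x} → x ∈ V → x ∈ W) → stableCount V ≤ stableCount W
    stableCount-mono {V} {W} V⊆W = count-mono {P = stableIn V} {stableIn W} λ S e → let (a , b) = stableIn⁻ e in stableIn⁺ (λ x∈ → V⊆W (a x∈)) b

    stableCount-empty : ∀ {W} → (∀ {x} → x ∉ W) → stableCount W ≡ 1
    stableCount-empty e = count-empty (stableIn⁺ (λ x∈ → ⊥-elim (∉⊥ x∈)) (λ i j i∈ → ⊥-elim (∉⊥ i∈)))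
      λ S eq → ⊆-ext (λ x∈ → ⊥-elim (e (proj₁ (stableIn⁻ eq) x∈))) (λ x∈ → ⊥-elim (∉⊥ x∈))

    stableCount-split : ∀ {W v} → v ∈ W → stableCount W ≡ stableCount (W ⊖ v) + stableCount (W ⊝ v)
    stableCount-split {W} {v} v∈ = trans (count-split (stableIn W) v) (cong₂ _+_
      (count-cong λ S → bool-ext
        (λ e → let (a , b) = ∧⁻ e ; (c , d) = stableIn⁻ b in
          stableIn⁺ (λ x∈ → ∈⊖⁺ (c x∈) (λ { refl → true≢false (∈-lookup x∈) (not-true⁻ a) })) d)
        (λ e → let (c , d) = stableIn⁻ e in
          cong₂ _∧_ (avoids S (λ v∈S → proj₂ (∈⊖⁻ (c v∈S)) refl)) (stableIn⁺ (λ x∈ → proj₁ (∈⊖⁻ (c x∈))) d)))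
      (count-cong λ S → bool-ext
        (λ e → let (a , b) = ∧⁻ e ; (c , d) = stableIn⁻ b in
          stableIn⁺ (λ {x} x∈ → ∈⊝⁺ (c (∈-update⁺ x∈)) (λ { refl → true≢false (∈-lookup x∈) (not-true⁻ a) })
                                 (d v x ∈-update (∈-update⁺ x∈)))
                    (λ i j i∈ j∈ → d i j (∈-update⁺ i∈) (∈-update⁺ j∈)))
        (λ e → let (c , d) = stableIn⁻ e in
          cong₂ _∧_ (avoids S (λ v∈S → proj₁ (proj₂ (∈⊝⁻ (c v∈S))) refl))
            (stableIn⁺ (λ {x} x∈ → inW S c x x∈) (λ i j → stab S c d i j)))))
      where
      avoids : ∀ S → v ∉ S → not (lookup S v) ≡ true
      avoids S v∉ with bool-cases (lookup S v)
      ... | inj₁ e = ⊥-elim (v∉ (lookup-∈ e))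
      ... | inj₂ e = cong not e
      inW : ∀ S → (∀ {x} → x ∈ S → x ∈ W ⊝ v) → ∀ x → x ∈ S [ v ]≔ true → x ∈ W
      inW S c x x∈ with v Fin.≟ x
      ... | yes refl = v∈
      ... | no v≢x = proj₁ (∈⊝⁻ (c (∈-update⁻ x∈ v≢x)))
      stab : ∀ S → (∀ {x} → x ∈ S → x ∈ W ⊝ v) → IsStable G S → IsStable G (S [ v ]≔ true)
      stab S c d i j i∈ j∈ with v Fin.≟ i | v Fin.≟ j
      ... | yes refl | yes refl = irrefl G i
      ... | yes refl | no v≢j = proj₂ (proj₂ (∈⊝⁻ (c (∈-update⁻ j∈ v≢j))))
      ... | no v≢i | yes refl = ≁-sym (proj₂ (proj₂ (∈⊝⁻ (c (∈-update⁻ i∈ v≢i)))))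
      ... | no v≢i | no v≢j = d i j (∈-update⁻ i∈ v≢i) (∈-update⁻ j∈ v≢j)

  0<stableCount : ∀ W → 0 < stableCount W
  0<stableCount W = subst (_≤ stableCount W) (stableCount-empty ∉⊥) (stableCount-mono (λ x∈ → ⊥-elim (∉⊥ x∈)))

  stableCount-strict : ∀ {V W v} → (∀ {x} → x ∈ V → x ∈ W) → v ∈ W → v ∉ V → stableCount V < stableCount W
  stableCount-strict {V} {W} {v} V⊆W v∈ v∉ = begin-strict
    stableCount V                                     ≤⟨ stableCount-mono (λ x∈ → ∈⊖⁺ (V⊆W x∈) (λ { refl → v∉ x∈ })) ⟩
    stableCount (W ⊖ v)                               <⟨ m<m+n _ (0<stableCount (W ⊝ v)) ⟩
    stableCount (W ⊖ v) + stableCount (W ⊝ v)         ≡⟨ ≡-sym (stableCount-split v∈) ⟩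
    stableCount W                                     ∎
    where open ≤-Reasoning

  Separated : Subset n → Subset n → Set
  Separated A B = ∀ {x y} → x ∈ A → y ∈ B → x ≁ y

  Disjoint : Subset n → Subset n → Set
  Disjoint A B = ∀ {x} → x ∈ A → x ∉ B

  -- Both sides obey the same deletion recursion in `A`, since removing `v` or `N[v]` for a vertex
  -- `v` of `A` leaves `B` untouched.
  stableCount-∪ : ∀ {A B} → Disjoint A B → Separated A B → stableCount (A ∪ B) ≡ stableCount A * stableCount B
  stableCount-∪ {A} {B} disj sep = go ∣ A ∣ A ≤-refl disj sep
    where
    go : ∀ m A → ∣ A ∣ ≤ m → Disjoint A B → Separated A B → stableCount (A ∪ B) ≡ stableCount A * stableCount B
    go m A le disj sep with nonempty-or-empty A
    ... | inj₂ e = begin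
      stableCount (A ∪ B)            ≡⟨ cong stableCount (⊆-ext (λ x∈ → right (∪⁻ x∈)) ∪ʳ) ⟩
      stableCount B                  ≡⟨ ≡-sym (*-identityˡ _) ⟩
      1 * stableCount B              ≡⟨ cong (_* stableCount B) (≡-sym (stableCount-empty e)) ⟩
      stableCount A * stableCount B  ∎
      where
      open ≡-Reasoning
      right : ∀ {x} → x ∈ A ⊎ x ∈ B → x ∈ B
      right (inj₁ a) = ⊥-elim (e a)
      right (inj₂ b) = b
    go zero A le disj sep | inj₁ (v , v∈) = ⊥-elim (<⇒≱ (0<∣∣ v∈) le)
    go (suc m) A le disj sep | inj₁ (v , v∈) = begin
      stableCount (A ∪ B)
        ≡⟨ stableCount-split (∪ˡ v∈) ⟩
      stableCount ((A ∪ B) ⊖ v) + stableCount ((A ∪ B) ⊝ v)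
        ≡⟨ cong₂ (λ p q → stableCount p + stableCount q)
             (⊆-ext (λ x∈ → left⊖ (∪⁻ (proj₁ (∈⊖⁻ x∈))) (proj₂ (∈⊖⁻ x∈))) (λ x∈ → right⊖ (∪⁻ x∈)))
             (⊆-ext (λ x∈ → left⊝ (∪⁻ (proj₁ (∈⊝⁻ x∈))) (proj₂ (∈⊝⁻ x∈))) (λ x∈ → right⊝ (∪⁻ x∈))) ⟩
      stableCount (A ⊖ v ∪ B) + stableCount (A ⊝ v ∪ B)
        ≡⟨ cong₂ _+_
             (go m (A ⊖ v) (≤-pred (subst (_≤ suc m) (≡-sym (∣⊖∣ v∈)) le)) (λ x∈ → disj (proj₁ (∈⊖⁻ x∈))) (λ x∈ → sep (proj₁ (∈⊖⁻ x∈))))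
             (go m (A ⊝ v) (≤-pred (≤-trans (≤-trans (s≤s (m≤m+n _ (deg A v))) (≤-reflexive (trans (≡-sym (+-suc _ (deg A v))) (∣⊝∣ v∈)))) le))
               (λ x∈ → disj (proj₁ (∈⊝⁻ x∈))) (λ x∈ → sep (proj₁ (∈⊝⁻ x∈)))) ⟩
      stableCount (A ⊖ v) * stableCount B + stableCount (A ⊝ v) * stableCount B
        ≡⟨ ≡-sym (*-distribʳ-+ (stableCount B) (stableCount (A ⊖ v)) _) ⟩
      (stableCount (A ⊖ v) + stableCount (A ⊝ v)) * stableCount B
        ≡⟨ cong (_* stableCount B) (≡-sym (stableCount-split v∈)) ⟩
      stableCount A * stableCount B ∎
      where
      open ≡-Reasoning
      left⊖ : ∀ {x} → x ∈ A ⊎ x ∈ B → v ≢ x → x ∈ A ⊖ v ∪ B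
      left⊖ (inj₁ a) ne = ∪ˡ (∈⊖⁺ a ne)
      left⊖ (inj₂ b) _ = ∪ʳ b
      right⊖ : ∀ {x} → x ∈ A ⊖ v ⊎ x ∈ B → x ∈ (A ∪ B) ⊖ v
      right⊖ (inj₁ a) = ∈⊖⁺ (∪ˡ (proj₁ (∈⊖⁻ a))) (proj₂ (∈⊖⁻ a))
      right⊖ (inj₂ b) = ∈⊖⁺ (∪ʳ b) (λ { refl → disj v∈ b })
      left⊝ : ∀ {x} → x ∈ A ⊎ x ∈ B → v ≢ x × v ≁ x → x ∈ A ⊝ v ∪ B
      left⊝ (inj₁ a) (p , q) = ∪ˡ (∈⊝⁺ a p q)
      left⊝ (inj₂ b) _ = ∪ʳ b
      right⊝ : ∀ {x} → x ∈ A ⊝ v ⊎ x ∈ B → x ∈ (A ∪ B) ⊝ v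
      right⊝ (inj₁ a) = ∈⊝⁺ (∪ˡ (proj₁ (∈⊝⁻ a))) (proj₁ (proj₂ (∈⊝⁻ a))) (proj₂ (proj₂ (∈⊝⁻ a)))
      right⊝ (inj₂ b) = ∈⊝⁺ (∪ʳ b) (λ { refl → disj v∈ b }) (sep v∈ b)

  Clique : Subset n → Set
  Clique Q = ∀ {x y} → x ∈ Q → y ∈ Q → x ≢ y → x ~ y

  stableCount-clique : ∀ {Q} → Clique Q → stableCount Q ≡ suc ∣ Q ∣
  stableCount-clique {Q} = go ∣ Q ∣ Q refl
    where
    go : ∀ m Q → ∣ Q ∣ ≡ m → Clique Q → stableCount Q ≡ suc ∣ Q ∣
    go m Q eq cl with nonempty-or-empty Q
    ... | inj₂ e = trans (stableCount-empty e) (cong suc (≡-sym (∣∣≡0 e)))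
    go zero Q eq cl | inj₁ (v , v∈) = ⊥-elim (<-irrefl (≡-sym eq) (0<∣∣ v∈))
    go (suc m) Q eq cl | inj₁ (v , v∈) = begin
      stableCount Q                               ≡⟨ stableCount-split v∈ ⟩
      stableCount (Q ⊖ v) + stableCount (Q ⊝ v)   ≡⟨ cong₂ _+_
        (go m (Q ⊖ v) (suc-injective (trans (∣⊖∣ v∈) eq)) (λ x∈ y∈ → cl (proj₁ (∈⊖⁻ x∈)) (proj₁ (∈⊖⁻ y∈))))
        (stableCount-empty λ x∈ → let (a , b , c) = ∈⊝⁻ x∈ in true≢false (cl v∈ a b) c) ⟩
      suc ∣ Q ⊖ v ∣ + 1                           ≡⟨ trans (+-comm _ 1) (cong suc (∣⊖∣ v∈)) ⟩
      suc ∣ Q ∣                                   ∎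
      where open ≡-Reasoning

-- Adjacency in the Turán-connected graph, and invariance under isomorphism.

≡ᵇ-true : ∀ {a b} → a ≡ b → (a ≡ᵇ b) ≡ true
≡ᵇ-true {a} refl = ≡ᵇ-refl a

≡ᵇ-true⁻ : ∀ {a b} → (a ≡ᵇ b) ≡ true → a ≡ b
≡ᵇ-true⁻ {a} {b} e = ≡ᵇ⇒≡ a b (Equivalence.from T-≡ e)

<ᵇ-true : ∀ {a b} → a < b → (a <ᵇ b) ≡ true
<ᵇ-true lt = Equivalence.to T-≡ (<⇒<ᵇ lt)

<ᵇ-true⁻ : ∀ {a b} → (a <ᵇ b) ≡ true → a < b
<ᵇ-true⁻ {a} {b} e = <ᵇ⇒< a b (Equivalence.from T-≡ e)

∨-true⁻ : ∀ {a b} → a ∨ b ≡ true → a ≡ true ⊎ b ≡ true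
∨-true⁻ {true} _ = inj₁ refl
∨-true⁻ {false} e = inj₂ e

∨-trueʳ : ∀ {a b} → b ≡ true → a ∨ b ≡ true
∨-trueʳ {a} refl = ∨-zeroʳ a

∨-trueˡ : ∀ {a b} → a ≡ true → a ∨ b ≡ true
∨-trueˡ refl = refl

TC-adj⁺ : ∀ {m r} (i j : Fin m) → toℕ i ≢ toℕ j →
  toℕ i % suc r ≡ toℕ j % suc r ⊎ (toℕ i ≡ 0 × toℕ j < suc r) ⊎ (toℕ j ≡ 0 × toℕ i < suc r) → adj (TC m (suc r)) i j ≡ true
TC-adj⁺ {m} {r} i j ne why = cong₂ _∧_ (unequal (bool-cases (toℕ i ≡ᵇ toℕ j))) (reason why)
  where
  unequal : (toℕ i ≡ᵇ toℕ j) ≡ true ⊎ (toℕ i ≡ᵇ toℕ j) ≡ false → not (toℕ i ≡ᵇ toℕ j) ≡ true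
  unequal (inj₁ e) = ⊥-elim (ne (≡ᵇ-true⁻ e))
  unequal (inj₂ e) = cong not e
  R : Fin m → Fin m → Bool
  R i j = ((toℕ i % suc r) ≡ᵇ (toℕ j % suc r)) ∨ ((toℕ i ≡ᵇ 0) ∧ (toℕ j <ᵇ suc r))
  reason : toℕ i % suc r ≡ toℕ j % suc r ⊎ (toℕ i ≡ 0 × toℕ j < suc r) ⊎ (toℕ j ≡ 0 × toℕ i < suc r) → R i j ∨ R j i ≡ true
  reason (inj₁ e) = ∨-trueˡ {R i j} (∨-trueˡ (≡ᵇ-true e))
  reason (inj₂ (inj₁ (e , lt))) = ∨-trueˡ {R i j} (∨-trueʳ {(toℕ i % suc r) ≡ᵇ (toℕ j % suc r)} (cong₂ _∧_ (≡ᵇ-true e) (<ᵇ-true lt)))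
  reason (inj₂ (inj₂ (e , lt))) = ∨-trueʳ {R i j} (∨-trueʳ {(toℕ j % suc r) ≡ᵇ (toℕ i % suc r)} (cong₂ _∧_ (≡ᵇ-true e) (<ᵇ-true lt)))

TC-adj⁻ : ∀ {m r} (i j : Fin m) → adj (TC m (suc r)) i j ≡ true → toℕ i ≢ toℕ j ×
  (toℕ i % suc r ≡ toℕ j % suc r ⊎ (toℕ i ≡ 0 × toℕ j < suc r) ⊎ (toℕ j ≡ 0 × toℕ i < suc r))
TC-adj⁻ {m} {r} i j e with ∧⁻ {not (toℕ i ≡ᵇ toℕ j)} e
... | a , b = (λ eq → true≢false (≡ᵇ-true eq) (not-true⁻ a)) , reason (∨-true⁻ b)
  where
  R : Fin m → Fin m → Bool
  R i j = ((toℕ i % suc r) ≡ᵇ (toℕ j % suc r)) ∨ ((toℕ i ≡ᵇ 0) ∧ (toℕ j <ᵇ suc r))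
  half : ∀ i j → R i j ≡ true → toℕ i % suc r ≡ toℕ j % suc r ⊎ (toℕ i ≡ 0 × toℕ j < suc r)
  half i j e with ∨-true⁻ {(toℕ i % suc r) ≡ᵇ (toℕ j % suc r)} e
  ... | inj₁ p = inj₁ (≡ᵇ-true⁻ p)
  ... | inj₂ p with ∧⁻ {toℕ i ≡ᵇ 0} p
  ... | q , s = inj₂ (≡ᵇ-true⁻ q , <ᵇ-true⁻ s)
  reason : R i j ≡ true ⊎ R j i ≡ true → toℕ i % suc r ≡ toℕ j % suc r ⊎ (toℕ i ≡ 0 × toℕ j < suc r) ⊎ (toℕ j ≡ 0 × toℕ i < suc r)
  reason (inj₁ p) with half i j p
  ... | inj₁ q = inj₁ q
  ... | inj₂ q = inj₂ (inj₁ q)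
  reason (inj₂ p) with half j i p
  ... | inj₁ q = inj₁ (≡-sym q)
  ... | inj₂ q = inj₂ (inj₂ q)

injective⇒surjective : ∀ {n} (f : Fin n → Fin n) → (∀ {i j} → f i ≡ f j → i ≡ j) → ∀ y → ∃ λ x → f x ≡ y
injective⇒surjective {suc n} f inj y with Fin.any? (λ x → f x Fin.≟ y)
... | yes p = p
... | no ¬p = ⊥-elim (<⇒≱ ≤-refl (Fin.injective⇒≤ {f = λ x → punchOut (avoids x)}
    (λ {i} {j} e → inj (Fin.punchOut-injective (avoids i) (avoids j) e))))
  where
  avoids : ∀ x → y ≢ f x
  avoids x e = ¬p (x , ≡-sym e)

injective⇒permutation : ∀ {n} (f : Fin n → Fin n) → (∀ {i j} → f i ≡ f j → i ≡ j) → ∃ λ (σ : Permutation′ n) → ∀ i → σ ⟨$⟩ʳ i ≡ f i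
injective⇒permutation f inj = permutation f (λ y → proj₁ (sur y)) (λ y → proj₂ (sur y)) (λ x → inj (proj₂ (sur (f x)))) , λ _ → refl
  where sur = injective⇒surjective f inj

≅-from-injection : ∀ {n} {G H : Graph n} (f : Fin n → Fin n) → (∀ {i j} → f i ≡ f j → i ≡ j) →
  (∀ i j → adj G i j ≡ adj H (f i) (f j)) → G ≅ H
≅-from-injection {H = H} f inj e with injective⇒permutation f inj
... | σ , σ≡ = σ , λ i j → trans (e i j) (≡-sym (cong₂ (adj H) (σ≡ i) (σ≡ j)))

≅-from-injection⁻ : ∀ {n} {G H : Graph n} (f : Fin n → Fin n) → (∀ {i j} → f i ≡ f j → i ≡ j) →
  (∀ i j → adj G (f i) (f j) ≡ adj H i j) → G ≅ H
≅-from-injection⁻ {G = G} {H} f inj e with injective⇒permutation f inj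
... | σ , σ≡ = flip σ , λ i j → trans (cong₂ (adj G) (back i) (back j)) (e _ _)
  where
  back : ∀ i → i ≡ f (σ ⟨$⟩ˡ i)
  back i = trans (≡-sym (inverseʳ σ)) (σ≡ _)

module _ {n} {G H : Graph n} (iso : G ≅ H) where
  private
    σ = proj₁ iso
    σ-adj = proj₂ iso

    module A = Stable G
    module B = Stable H

    image : Subset n → Subset n
    image W = full ∩ᵖ λ j → isMember W (σ ⟨$⟩ˡ j)

    ∈image⁻ : ∀ {W j} → j ∈ image W → σ ⟨$⟩ˡ j ∈ W
    ∈image⁻ {W} j∈ = does⁻ (_ ∈? W) (proj₂ (∈∩ᵖ⁻ j∈))

    ∈image⁺ : ∀ {W j} → σ ⟨$⟩ˡ j ∈ W → j ∈ image W
    ∈image⁺ {W} j∈ = ∈∩ᵖ⁺ ∈⊤ (dec-true (_ ∈? W) j∈)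

    preimage-≢ : ∀ {v j} → v ≢ σ ⟨$⟩ˡ j → σ ⟨$⟩ʳ v ≢ j
    preimage-≢ ne refl = ne (≡-sym (inverseˡ σ))

    preimage-≢⁻ : ∀ {v j} → σ ⟨$⟩ʳ v ≢ j → v ≢ σ ⟨$⟩ˡ j
    preimage-≢⁻ ne refl = ne (inverseʳ σ)

    preimage-adj : ∀ v j → adj G v (σ ⟨$⟩ˡ j) ≡ adj H (σ ⟨$⟩ʳ v) j
    preimage-adj v j = trans (σ-adj v (σ ⟨$⟩ˡ j)) (cong (adj H (σ ⟨$⟩ʳ v)) (inverseʳ σ))

  -- Taking images commutes with `⊖` and `⊝`, so both counts obey the same deletion recursion; this
  -- replaces a permutation of the list of all subsets.
  ≅-stableCount : ∀ W → A.stableCount W ≡ B.stableCount (image W)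
  ≅-stableCount W = go ∣ W ∣ W ≤-refl
    where
    go : ∀ m W → ∣ W ∣ ≤ m → A.stableCount W ≡ B.stableCount (image W)
    go m W le with nonempty-or-empty W
    ... | inj₂ e = trans (A.stableCount-empty e) (≡-sym (B.stableCount-empty λ j∈ → e (∈image⁻ j∈)))
    go zero W le | inj₁ (v , v∈) = ⊥-elim (<⇒≱ (0<∣∣ v∈) le)
    go (suc m) W le | inj₁ (v , v∈) = trans (A.stableCount-split v∈) (trans (cong₂ _+_
        (trans (go m (W ⊖ v) (≤-pred (≤-trans (≤-reflexive (∣⊖∣ v∈)) le))) (cong B.stableCount image-⊖))
        (trans (go m (W A.⊝ v) (≤-pred (≤-trans (≤-trans (s≤s (m≤m+n _ (A.deg W v))) (≤-reflexive (trans (≡-sym (+-suc _ _)) (A.∣⊝∣ v∈)))) le)))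
          (cong B.stableCount image-⊝)))
      (≡-sym (B.stableCount-split (∈image⁺ {W} (subst (_∈ W) (≡-sym (inverseˡ σ)) v∈)))))
      where
      image-⊖ : image (W ⊖ v) ≡ image W ⊖ (σ ⟨$⟩ʳ v)
      image-⊖ = ⊆-ext (λ j∈ → let (a , b) = ∈⊖⁻ (∈image⁻ j∈) in ∈⊖⁺ (∈image⁺ a) (preimage-≢ b))
                      (λ j∈ → let (a , b) = ∈⊖⁻ j∈ in ∈image⁺ (∈⊖⁺ (∈image⁻ a) (preimage-≢⁻ b)))
      image-⊝ : image (W A.⊝ v) ≡ image W B.⊝ (σ ⟨$⟩ʳ v)
      image-⊝ = ⊆-ext (λ {j} j∈ → let (a , b , c) = A.∈⊝⁻ (∈image⁻ j∈) in B.∈⊝⁺ (∈image⁺ a) (preimage-≢ b) (trans (≡-sym (preimage-adj v j)) c))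
                      (λ {j} j∈ → let (a , b , c) = B.∈⊝⁻ j∈ in ∈image⁺ (A.∈⊝⁺ (∈image⁻ a) (preimage-≢⁻ b) (trans (preimage-adj v j) c)))

  ≅-F : F G ≡ F H
  ≅-F = trans (≡-sym A.stableCount-full) (trans (≅-stableCount full) (trans (cong B.stableCount (⊆-ext (λ _ → ∈⊤) (λ _ → ∈image⁺ ∈⊤))) B.stableCount-full))

-- A lower bound for the index of the Turán-connected graph.

productBelow : ℕ → (ℕ → ℕ) → ℕ
productBelow zero c = 1
productBelow (suc a) c = suc (c a) * productBelow a c

-- The profile of class orders in `TC` once the centre or its closed neighbourhood is gone: the
-- class of the centre, then `x` longer classes, then the shorter ones.
piecewise : (h s t x : ℕ) → ℕ → ℕ
piecewise h s t x zero = h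
piecewise h s t x (suc i) = if i <ᵇ x then s else t

productBelow-first : ∀ h s t x x′ → x′ ≤ x → productBelow (suc x′) (piecewise h s t x) ≡ suc h * suc s ^ x′
productBelow-first h s t x zero _ = refl
productBelow-first h s t x (suc x′) x′<x rewrite <ᵇ-true x′<x =
  trans (cong (suc s *_) (productBelow-first h s t x x′ (<⇒≤ x′<x))) (lem (suc s) (suc h) (suc s ^ x′))
  where lem : ∀ a b c → a * (b * c) ≡ b * (a * c)
        lem = solve-∀

productBelow-piecewise : ∀ h s t x y → productBelow (suc (x + y)) (piecewise h s t x) ≡ suc h * (suc s ^ x * suc t ^ y)
productBelow-piecewise h s t x zero rewrite +-identityʳ x =
  trans (productBelow-first h s t x x ≤-refl) (cong (suc h *_) (≡-sym (*-identityʳ (suc s ^ x))))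
productBelow-piecewise h s t x (suc y) rewrite +-suc x y = trans (cong₂ (λ a b → suc a * b) last (productBelow-piecewise h s t x y))
  (lem (suc t) (suc h) (suc s ^ x) (suc t ^ y))
  where
  lem : ∀ a b c d → a * (b * (c * d)) ≡ b * (c * (a * d))
  lem = solve-∀
  last : (if x + y <ᵇ x then s else t) ≡ t
  last with bool-cases (x + y <ᵇ x)
  ... | inj₁ e = ⊥-elim (<⇒≱ (<ᵇ-true⁻ e) (m≤m+n x y))
  ... | inj₂ e rewrite e = refl

card≥ : ∀ {n} c (S : Subset n) (g : ℕ → ℕ) → (∀ {i j} → g i ≡ g j → i ≡ j) → (∀ i → i < c → ∃ λ v → v ∈ S × toℕ v ≡ g i) → c ≤ ∣ S ∣
card≥ zero S g inj hit = z≤n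
card≥ (suc c) S g inj hit with hit c ≤-refl
... | v , v∈ , v≡ = ≤-trans (s≤s (card≥ c (S ⊖ v) g inj λ i i<c → let (w , w∈ , w≡) = hit i (≤-trans i<c (n≤1+n c)) in
      w , ∈⊖⁺ w∈ (λ { refl → <-irrefl (inj (trans (≡-sym w≡) v≡)) i<c }) , w≡))
    (≤-reflexive (∣⊖∣ v∈))

module _ {n} (G : Graph n) where
  open Stable G

  order<stableCount : ∀ W → suc ∣ W ∣ ≤ stableCount W
  order<stableCount W = go ∣ W ∣ W refl
    where
    go : ∀ m W → ∣ W ∣ ≡ m → suc ∣ W ∣ ≤ stableCount W
    go m W eq with nonempty-or-empty W
    ... | inj₂ e = ≤-reflexive (trans (cong suc (∣∣≡0 e)) (≡-sym (stableCount-empty e)))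
    go zero W eq | inj₁ (v , v∈) = ⊥-elim (<-irrefl (≡-sym eq) (0<∣∣ v∈))
    go (suc m) W eq | inj₁ (v , v∈) = begin
      suc ∣ W ∣                                 ≡⟨ trans (cong suc (≡-sym (∣⊖∣ v∈))) (+-comm 1 _) ⟩
      suc ∣ W ⊖ v ∣ + 1                         ≤⟨ +-mono-≤ (go m (W ⊖ v) (suc-injective (trans (∣⊖∣ v∈) eq))) (0<stableCount (W ⊝ v)) ⟩
      stableCount (W ⊖ v) + stableCount (W ⊝ v) ≡⟨ ≡-sym (stableCount-split v∈) ⟩
      stableCount W                             ∎
      where open ≤-Reasoning

  -- The empty set and the singletons already give a class of `c j` vertices at least `c j + 1`
  -- stable sets, and classes without edges between them multiply. Lower bounds on the class orders
  -- therefore suffice.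
  productBelow≤stableCount : ∀ a (class : Fin n → ℕ) (c : ℕ → ℕ) U → (∀ {v w} → v ∈ U → w ∈ U → class v ≢ class w → v ≁ w) →
    (∀ j → j < a → c j ≤ ∣ U ∩ᵖ (λ z → class z ≡ᵇ j) ∣) → productBelow a c ≤ stableCount U
  productBelow≤stableCount zero class c U _ _ = 0<stableCount U
  productBelow≤stableCount (suc a) class c U apart large = begin
    suc (c a) * productBelow a c     ≤⟨ *-mono-≤ (≤-trans (s≤s (large a ≤-refl)) (order<stableCount Q))
                                         (productBelow≤stableCount a class c U′ (λ v∈ w∈ → apart (proj₁ (∈∩ᵖ⁻ v∈)) (proj₁ (∈∩ᵖ⁻ w∈))) large′) ⟩
    stableCount Q * stableCount U′   ≡⟨ ≡-sym (stableCount-∪ (λ a b → true≢false (proj₂ (∈∩ᵖ⁻ a)) (not-true⁻ (proj₂ (∈∩ᵖ⁻ b))))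
                                         (λ {v} {w} a b → apart (proj₁ (∈∩ᵖ⁻ a)) (proj₁ (∈∩ᵖ⁻ b))
                                            (λ e → true≢false (≡ᵇ-true (trans (≡-sym e) (≡ᵇ-true⁻ (proj₂ (∈∩ᵖ⁻ a))))) (not-true⁻ (proj₂ (∈∩ᵖ⁻ b)))))) ⟩
    stableCount (Q ∪ U′)             ≤⟨ stableCount-mono (λ z∈ → back (∪⁻ z∈)) ⟩
    stableCount U                    ∎
    where
    open ≤-Reasoning
    Q = U ∩ᵖ (λ z → class z ≡ᵇ a)
    U′ = U ∩ᵖ (not ∘ λ z → class z ≡ᵇ a)
    back : ∀ {z} → z ∈ Q ⊎ z ∈ U′ → z ∈ U
    back (inj₁ z∈) = proj₁ (∈∩ᵖ⁻ z∈)
    back (inj₂ z∈) = proj₁ (∈∩ᵖ⁻ z∈)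
    large′ : ∀ j → j < a → c j ≤ ∣ U′ ∩ᵖ (λ z → class z ≡ᵇ j) ∣
    large′ j j<a = ≤-trans (large j (≤-trans j<a (n≤1+n a))) (∣∣-mono λ {z} z∈ → let (p , q) = ∈∩ᵖ⁻ z∈ in
      ∈∩ᵖ⁺ (∈∩ᵖ⁺ p (differs z (≡ᵇ-true⁻ q))) q)
      where
      differs : ∀ z → class z ≡ j → not (class z ≡ᵇ a) ≡ true
      differs z e with bool-cases (class z ≡ᵇ a)
      ... | inj₁ t = ⊥-elim (<-irrefl (trans (≡-sym e) (≡ᵇ-true⁻ t)) j<a)
      ... | inj₂ f = cong not f

module _ (j x y : ℕ) where
  private
    k = suc j
    r = x + y
    m = starOrder k x y

  open Stable (TC m (suc r))

  private
    class : Fin m → ℕ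
    class v = toℕ v % suc r

    0<m : 0 < m
    0<m = ≤-trans (s≤s z≤n) (m≤n+m (suc x) (k * suc r))

    centre : Fin m
    centre = fromℕ< 0<m

    toℕ-centre : toℕ centre ≡ 0
    toℕ-centre = Fin.toℕ-fromℕ< 0<m

    class-vertex : ∀ {v : Fin m} {i l} → toℕ v ≡ i + l * suc r → i ≤ r → class v ≡ i
    class-vertex {i = i} {l} e i≤ = trans (cong (_% suc r) e) (trans ([m+kn]%n≡m%n i l (suc r)) (m<n⇒m%n≡m (s≤s i≤)))

    nonzero : ∀ {v : Fin m} {w} → toℕ v ≡ suc w → centre ≢ v
    nonzero e refl with () ← trans (≡-sym toℕ-centre) e

    apart : ∀ {v w} → v ∈ full ⊖ centre → w ∈ full ⊖ centre → class v ≢ class w → v ≁ w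
    apart {v} {w} v∈ w∈ ne with ~-or-≁ v w
    ... | inj₂ e = e
    ... | inj₁ e with TC-adj⁻ {m} {r} v w e
    ... | _ , inj₁ c = ⊥-elim (ne c)
    ... | _ , inj₂ (inj₁ (z , _)) = ⊥-elim (proj₂ (∈⊖⁻ v∈) (Fin.toℕ-injective (trans toℕ-centre (≡-sym z))))
    ... | _ , inj₂ (inj₂ (z , _)) = ⊥-elim (proj₂ (∈⊖⁻ w∈) (Fin.toℕ-injective (trans toℕ-centre (≡-sym z))))

    g-injective : ∀ i o {l l′} → i + (o + l) * suc r ≡ i + (o + l′) * suc r → l ≡ l′
    g-injective i o {l} {l′} e = +-cancelˡ-≡ o l l′ (*-cancelʳ-≡ (o + l) (o + l′) (suc r) (+-cancelˡ-≡ i _ _ e))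

    low< : ∀ {i l} → i ≤ r → l < k → i + l * suc r < m
    low< {i} {l} i≤ l< = ≤-trans (+-monoˡ-≤ (l * suc r) (s≤s i≤)) (≤-trans (*-monoˡ-≤ (suc r) l<) (m≤m+n (k * suc r) (suc x)))

    high< : ∀ {i l} → i ≤ x → l ≤ k → i + l * suc r < m
    high< {i} {l} i≤ l≤ = subst (i + l * suc r <_) (+-comm (suc x) (k * suc r)) (+-mono-<-≤ (s≤s i≤) (*-monoˡ-≤ (suc r) l≤))

    -- In class i the vertices are i + l (r + 1); those with l ≥ o are counted.
    members : ∀ {U} i o c → i ≤ r → (∀ l → l < c → i + (o + l) * suc r < m) →
      (∀ {v : Fin m} l → toℕ v ≡ i + (o + l) * suc r → v ∈ U) → c ≤ ∣ U ∩ᵖ (λ z → class z ≡ᵇ i) ∣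
    members {U} i o c i≤ lt in-U = card≥ c _ (λ l → i + (o + l) * suc r) (g-injective i o) λ l l<c →
      fromℕ< (lt l l<c) , ∈∩ᵖ⁺ (in-U l (Fin.toℕ-fromℕ< (lt l l<c))) (≡ᵇ-true (class-vertex {l = o + l} (Fin.toℕ-fromℕ< (lt l l<c)) i≤)) ,
      Fin.toℕ-fromℕ< (lt l l<c)

    large⊖ : ∀ i → i < suc r → piecewise k (suc k) k x i ≤ ∣ (full ⊖ centre) ∩ᵖ (λ z → class z ≡ᵇ i) ∣
    large⊖ zero _ = members 0 1 k z≤n (λ l l<k → high< z≤n l<k) (λ l e → ∈⊖⁺ ∈⊤ (nonzero e))
    large⊖ (suc i) (s≤s i<) with bool-cases (i <ᵇ x)
    ... | inj₁ e rewrite e = members (suc i) 0 (suc k) i< (λ l l< → high< (<ᵇ-true⁻ e) (≤-pred l<)) (λ l e → ∈⊖⁺ ∈⊤ (nonzero e))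
    ... | inj₂ e rewrite e = members (suc i) 0 k i< (λ l l< → low< i< l<) (λ l e → ∈⊖⁺ ∈⊤ (nonzero e))

    far : ∀ {v : Fin m} i l → suc i ≤ r → toℕ v ≡ suc i + suc l * suc r → v ∈ full ⊝ centre
    far {v} i l i< e = ∈⊝⁺ ∈⊤ (nonzero e) (not-adjacent (~-or-≁ centre v))
      where
      not-adjacent : centre ~ v ⊎ centre ≁ v → centre ≁ v
      not-adjacent (inj₂ f) = f
      not-adjacent (inj₁ t) with TC-adj⁻ {m} {r} centre v t
      ... | _ , inj₁ c with () ← trans (≡-sym (class-vertex {l = suc l} e i<)) (trans (≡-sym c) (cong (_% suc r) toℕ-centre))
      ... | _ , inj₂ (inj₁ (_ , lt)) = ⊥-elim (<⇒≱ lt (≤-trans (≤-trans (m≤m+n (suc r) (l * suc r)) (m≤n+m (suc l * suc r) (suc i))) (≤-reflexive (≡-sym e))))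
      ... | _ , inj₂ (inj₂ (z , _)) with () ← trans (≡-sym z) e

    large⊝ : ∀ i → i < suc r → piecewise 0 k j x i ≤ ∣ (full ⊝ centre) ∩ᵖ (λ z → class z ≡ᵇ i) ∣
    large⊝ zero _ = z≤n
    large⊝ (suc i) (s≤s i<) with bool-cases (i <ᵇ x)
    ... | inj₁ e rewrite e = members (suc i) 1 k i< (λ l l< → high< (<ᵇ-true⁻ e) l<) (λ l e → far i l i< e)
    ... | inj₂ e rewrite e = members (suc i) 1 j i< (λ l l< → low< i< (s≤s l<)) (λ l e → far i l i< e)

  -- Vertex 0 is split off: without it the classes are separated, and its closed neighbourhood takes
  -- away class 0 and the first vertex of every other class. The inequality closes the chain
  -- `F G ≤ turánStar k x y ≤ F (TC m (suc r))`, where equality of the two ends forces equality on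
  -- the left.
  turánStar≤TC : turánStar k x y ≤ F (TC m (suc r))
  turánStar≤TC = begin
    turánStar k x y
      ≡⟨ cong₂ _+_ (≡-sym (productBelow-piecewise k (suc k) k x y)) (≡-sym (trans (productBelow-piecewise 0 k j x y) (*-identityˡ (suc k ^ x * k ^ y)))) ⟩
    productBelow (suc r) (piecewise k (suc k) k x) + productBelow (suc r) (piecewise 0 k j x)
      ≤⟨ +-mono-≤ (productBelow≤stableCount (TC m (suc r)) (suc r) class _ (full ⊖ centre) apart large⊖)
                  (productBelow≤stableCount (TC m (suc r)) (suc r) class _ (full ⊝ centre)
                     (λ v∈ w∈ → apart (⊝⊆⊖ v∈) (⊝⊆⊖ w∈)) large⊝) ⟩
    stableCount (full ⊖ centre) + stableCount (full ⊝ centre)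
      ≡⟨ ≡-sym (stableCount-split ∈⊤) ⟩
    stableCount full
      ≡⟨ stableCount-full ⟩
    F (TC m (suc r)) ∎
    where
    open ≤-Reasoning
    ⊝⊆⊖ : ∀ {v} → v ∈ full ⊝ centre → v ∈ full ⊖ centre
    ⊝⊆⊖ v∈ = let (a , b , _) = ∈⊝⁻ v∈ in ∈⊖⁺ a b

-- Stability bounds and Turán's inequality.

module _ {n} (G : Graph n) where
  open Stable G

  StabilityAtMost : Subset n → ℕ → Set
  StabilityAtMost W a = ∀ S → (∀ {x} → x ∈ S → x ∈ W) → IsStable G S → ∣ S ∣ ≤ a

  stabilityAtMost-mono : ∀ {V W a} → (∀ {x} → x ∈ V → x ∈ W) → StabilityAtMost W a → StabilityAtMost V a
  stabilityAtMost-mono V⊆W sl S S⊆V = sl S (λ x∈ → V⊆W (S⊆V x∈))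

  insert-stable : ∀ {v S} → (∀ {x} → x ∈ S → v ≁ x) → IsStable G S → IsStable G (insert v S)
  insert-stable {v} far st i j i∈ j∈ with insert⁻ i∈ | insert⁻ j∈
  ... | inj₁ refl | inj₁ refl = irrefl G i
  ... | inj₁ refl | inj₂ j∈S = far j∈S
  ... | inj₂ i∈S | inj₁ refl = ≁-sym (far i∈S)
  ... | inj₂ i∈S | inj₂ j∈S = st i j i∈S j∈S

  empty-stable : IsStable G empty
  empty-stable i j i∈ = ⊥-elim (∉⊥ i∈)

  stabilityAtMost-insert : ∀ {W a v S} → StabilityAtMost W a → v ∈ W → (∀ {x} → x ∈ S → x ∈ W ⊝ v) → IsStable G S → suc ∣ S ∣ ≤ a
  stabilityAtMost-insert {W} {a} {v} {S} sl v∈ S⊆ st = subst (_≤ a) (∣insert∣ (λ v∈S → proj₁ (proj₂ (∈⊝⁻ (S⊆ v∈S))) refl))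
    (sl (insert v S) (λ x∈ → inW (insert⁻ x∈)) (insert-stable (λ x∈ → proj₂ (proj₂ (∈⊝⁻ (S⊆ x∈)))) st))
    where
    inW : ∀ {x} → x ≡ v ⊎ x ∈ S → x ∈ W
    inW (inj₁ refl) = v∈
    inW (inj₂ x∈) = proj₁ (∈⊝⁻ (S⊆ x∈))

  stabilityAtMost-positive : ∀ {W a v} → StabilityAtMost W a → v ∈ W → 1 ≤ a
  stabilityAtMost-positive {a = a} sl v∈ = subst (λ m → suc m ≤ a) (∣⊥∣≡0 n) (stabilityAtMost-insert {S = empty} sl v∈ (λ x∈ → ⊥-elim (∉⊥ x∈)) empty-stable)

  stabilityAtMost-⊝ : ∀ {W a v} → v ∈ W → StabilityAtMost W (suc a) → StabilityAtMost (W ⊝ v) a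
  stabilityAtMost-⊝ v∈ sl S S⊆ st = ≤-pred (stabilityAtMost-insert sl v∈ S⊆ st)

  deg-mono : ∀ {V W v} → (∀ {x} → x ∈ V → x ∈ W) → deg V v ≤ deg W v
  deg-mono V⊆W = ∣∣-mono λ x∈ → ∈∩ᵖ⁺ (V⊆W (proj₁ (∈∩ᵖ⁻ x∈))) (proj₂ (∈∩ᵖ⁻ x∈))

  -- Repeatedly choosing a vertex of degree below `k` and deleting its closed neighbourhood builds a
  -- stable set. Each choice costs at most `k` vertices, and at most `a` choices are possible.
  greedy : ∀ k a W → (∀ U → (∀ {x} → x ∈ U → x ∈ W) → Nonempty U → ∃ λ x → x ∈ U × deg U x < k) →
    StabilityAtMost W a → ∣ W ∣ ≤ k * a
  greedy k a W low sl with nonempty-or-empty W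
  ... | inj₂ e = subst (_≤ k * a) (≡-sym (∣∣≡0 e)) z≤n
  ... | inj₁ ne with low W (λ x∈ → x∈) ne
  greedy k zero W low sl | inj₁ ne | v , v∈ , _ = ⊥-elim (<⇒≱ (s≤s z≤n) (stabilityAtMost-positive sl v∈))
  greedy k (suc a) W low sl | inj₁ ne | v , v∈ , d< = begin
    ∣ W ∣                          ≡⟨ ≡-sym (∣⊝∣ v∈) ⟩
    ∣ W ⊝ v ∣ + suc (deg W v)      ≤⟨ +-mono-≤ (greedy k a (W ⊝ v) (λ U U⊆ → low U (λ x∈ → proj₁ (∈⊝⁻ (U⊆ x∈)))) (stabilityAtMost-⊝ v∈ sl)) d< ⟩
    k * a + k                      ≡⟨ trans (+-comm (k * a) k) (≡-sym (*-suc k a)) ⟩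
    k * suc a                      ∎
    where open ≤-Reasoning

  high-degree : ∀ k a W → StabilityAtMost W a → k * a < ∣ W ∣ → ∃ λ v → v ∈ W × k ≤ deg W v
  high-degree k a W sl lt with Fin.any? (λ v → (v ∈? W) ×-dec (k ≤? deg W v))
  ... | yes p = p
  ... | no ¬p = ⊥-elim (<⇒≱ lt (greedy k a W (λ U U⊆ (v , v∈) → v , v∈ ,
    ≤-<-trans (deg-mono U⊆) (≰⇒> λ k≤ → ¬p (v , U⊆ v∈ , k≤))) sl))

  turánOrder : ℕ → ℕ → ℕ → ℕ
  turánOrder k x y = k * (x + y) + x

  ∣⊝∣≤ : ∀ {W v k m} → v ∈ W → ∣ W ∣ ≤ suc k + m → k ≤ deg W v → ∣ W ⊝ v ∣ ≤ m
  ∣⊝∣≤ {W} {v} {k} {m} v∈ le k≤ = +-cancelˡ-≤ (suc k) _ _ (begin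
    suc k + ∣ W ⊝ v ∣         ≡⟨ +-comm (suc k) _ ⟩
    ∣ W ⊝ v ∣ + suc k         ≤⟨ +-monoʳ-≤ _ (s≤s k≤) ⟩
    ∣ W ⊝ v ∣ + suc (deg W v) ≡⟨ ∣⊝∣ v∈ ⟩
    ∣ W ∣                     ≤⟨ le ⟩
    suc k + m                 ∎)
    where open ≤-Reasoning

  turánOrder-suc : ∀ k x y → turánOrder k (suc x) y ≡ suc k + turánOrder k x y
  turánOrder-suc = lem
    where lem : ∀ k x y → k * (suc x + y) + suc x ≡ suc k + (k * (x + y) + x)
          lem = solve-∀

  turánOrder-pred : ∀ k x y → turánOrder k (suc x) y ≡ suc (turánOrder k x (suc y))
  turánOrder-pred = lem
    where lem : ∀ k x y → k * (suc x + y) + suc x ≡ suc (k * (x + suc y) + x)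
          lem = solve-∀

  turánOrder-shift : ∀ k y → turánOrder (suc k) 0 y ≡ turánOrder k y 0
  turánOrder-shift = lem
    where lem : ∀ k y → suc k * (0 + y) + 0 ≡ k * (y + 0) + y
          lem = solve-∀

  balanced-suc : ∀ k x y → balanced (suc k) (suc x) y ≡ balanced (suc k) x (suc y) + balanced (suc k) x y
  balanced-suc k x y = lem k (suc (suc k) ^ x) (suc k ^ y)
    where
    lem : ∀ k a b → suc (suc k) * a * b ≡ a * (suc k * b) + a * b
    lem = solve-∀

  balanced-mono-suc : ∀ k x y → balanced (suc k) x (suc y) < balanced (suc k) (suc x) y
  balanced-mono-suc k x y = subst (balanced (suc k) x (suc y) <_) (≡-sym (balanced-suc k x y)) (m<m+n _ (0<balanced-suc k x y))

  record TuránStep (k x y : ℕ) (W : Subset n) : Set where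
    field
      v : Fin n
      v∈ : v ∈ W
      k≤ : k ≤ deg W v
      size : ∣ W ∣ ≡ turánOrder k (suc x) y
      ⊖-size : ∣ W ⊖ v ∣ ≤ turánOrder k x (suc y)
      ⊖-stab : StabilityAtMost (W ⊖ v) (x + suc y)
      ⊝-size : ∣ W ⊝ v ∣ ≤ turánOrder k x y
      ⊝-stab : StabilityAtMost (W ⊝ v) (x + y)

  -- If the order is not attained, one part of size `k + 1` can be shortened to `k`. If it is, it
  -- exceeds `k` times the stability bound, so a vertex of degree at least `k` exists.
  turán-step : ∀ k x y W → ∣ W ∣ ≤ turánOrder k (suc x) y → StabilityAtMost W (suc x + y) →
    ∣ W ∣ ≤ turánOrder k x (suc y) ⊎ TuránStep k x y W
  turán-step k x y W le sl with m≤n⇒m<n∨m≡n le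
  ... | inj₁ lt = inj₁ (≤-pred (subst (∣ W ∣ <_) (turánOrder-pred k x y) lt))
  ... | inj₂ eq with high-degree k (suc x + y) W sl (subst (k * (suc x + y) <_) (≡-sym eq) (m<m+n _ (s≤s z≤n)))
  ... | v , v∈ , k≤ = inj₂ record
    { v = v ; v∈ = v∈ ; k≤ = k≤ ; size = eq
    ; ⊖-size = ≤-reflexive (suc-injective (trans (∣⊖∣ v∈) (trans eq (turánOrder-pred k x y))))
    ; ⊖-stab = subst (StabilityAtMost (W ⊖ v)) (≡-sym (+-suc x y)) (stabilityAtMost-mono (λ x∈ → proj₁ (∈⊖⁻ x∈)) sl)
    ; ⊝-size = ∣⊝∣≤ v∈ (≤-reflexive (trans eq (turánOrder-suc k x y))) k≤
    ; ⊝-stab = stabilityAtMost-⊝ v∈ sl }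

  -- Deleting `v` shortens one part of size `k + 1` and deleting `N[v]` removes it, matching
  -- `balanced-suc`, that is, `k + 2 = (k + 1) + 1`. When no larger part is left, the equal parts
  -- are reread with the preceding quotient.
  turán : ∀ k x y W → ∣ W ∣ ≤ turánOrder k x y → StabilityAtMost W (x + y) → stableCount W ≤ balanced (suc k) x y
  turán zero zero y W le sl = ≤-trans (≤-reflexive (stableCount-empty λ x∈ → <⇒≱ (0<∣∣ x∈) le)) (0<balanced-suc 0 0 y)
  turán (suc k) zero y W le sl = subst (stableCount W ≤_) (≡-sym (balanced-shift (suc k) y))
    (turán k y zero W (subst (∣ W ∣ ≤_) (turánOrder-shift k y) le) (subst (StabilityAtMost W) (≡-sym (+-identityʳ y)) sl))
  turán k (suc x) y W le sl with turán-step k x y W le sl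
  ... | inj₁ le′ = ≤-trans (turán k x (suc y) W le′ (subst (StabilityAtMost W) (≡-sym (+-suc x y)) sl)) (<⇒≤ (balanced-mono-suc k x y))
  ... | inj₂ st = subst₂ _≤_ (≡-sym (stableCount-split v∈)) (≡-sym (balanced-suc k x y))
      (+-mono-≤ (turán k x (suc y) (W ⊖ v) ⊖-size ⊖-stab) (turán k x y (W ⊝ v) ⊝-size ⊝-stab))
    where open TuránStep st

  -- Unions of cliques and equality in Turán's inequality.

  -- Disjoint unions of cliques, characterised by the absence of an induced path on three vertices;
  -- in this form the property passes to subsets at once.
  Cluster : Subset n → Set
  Cluster U = ∀ {x y z} → x ∈ U → y ∈ U → z ∈ U → x ~ y → y ~ z → x ≢ z → x ~ z

  cluster-mono : ∀ {V W} → (∀ {x} → x ∈ V → x ∈ W) → Cluster W → Cluster V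
  cluster-mono V⊆W cl x∈ y∈ z∈ = cl (V⊆W x∈) (V⊆W y∈) (V⊆W z∈)

  Isolated : Subset n → Subset n → Set
  Isolated U Q = (∀ {x} → x ∈ Q → x ∈ U) × Nonempty Q × Clique Q × Separated Q (U ∖ Q)

  isolated-mono : ∀ {U V Q Q′} → V ≡ U ∖ Q′ → Separated Q′ (U ∖ Q′) → Isolated V Q → Isolated U Q
  isolated-mono {U} {V} {Q} {Q′} refl sep′ (Q⊆ , ne , cl , sep) =
    (λ x∈ → proj₁ (∈∖⁻ (Q⊆ x∈))) , ne , cl , λ x∈ y∈ → away x∈ y∈
    where
    away : ∀ {x y} → x ∈ Q → y ∈ U ∖ Q → x ≁ y
    away {x} {y} x∈ y∈ with y ∈? Q′
    ... | yes y∈Q′ = ≁-sym (sep′ y∈Q′ (Q⊆ x∈))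
    ... | no y∉Q′ = sep x∈ (∈∖⁺ (∈∖⁺ (proj₁ (∈∖⁻ y∈)) y∉Q′) (proj₂ (∈∖⁻ y∈)))

  -- The decreasing order later places the cliques of order `k + 1` in the first classes, where `TC`
  -- has them.
  data CliquePartition : Subset n → List (Subset n) → Set where
    none : ∀ {U} → (∀ {x} → x ∉ U) → CliquePartition U []
    some : ∀ {U Q Qs} → Isolated U Q → All (λ Q′ → ∣ Q′ ∣ ≤ ∣ Q ∣) Qs → CliquePartition (U ∖ Q) Qs → CliquePartition U (Q ∷ Qs)

  orders : List (Subset n) → List ℕ
  orders = map ∣_∣

  ∖-∪ : ∀ {U Q : Subset n} → (∀ {x} → x ∈ Q → x ∈ U) → Q ∪ (U ∖ Q) ≡ U
  ∖-∪ {U} {Q} Q⊆ = ⊆-ext (λ x∈ → to (∪⁻ x∈)) from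
    where
    to : ∀ {x} → x ∈ Q ⊎ x ∈ U ∖ Q → x ∈ U
    to (inj₁ x∈) = Q⊆ x∈
    to (inj₂ x∈) = proj₁ (∈∖⁻ x∈)
    from : ∀ {x} → x ∈ U → x ∈ Q ∪ (U ∖ Q)
    from {x} x∈ with x ∈? Q
    ... | yes x∈Q = ∪ˡ x∈Q
    ... | no x∉Q = ∪ʳ (∈∖⁺ x∈ x∉Q)

  stableCount-∖ : ∀ {U Q} → (∀ {x} → x ∈ Q → x ∈ U) → Separated Q (U ∖ Q) → stableCount U ≡ stableCount Q * stableCount (U ∖ Q)
  stableCount-∖ Q⊆ sep = trans (cong stableCount (≡-sym (∖-∪ Q⊆))) (stableCount-∪ (λ x∈ y∈ → proj₂ (∈∖⁻ y∈) x∈) sep)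

  stableCount-partition : ∀ {U Qs} → CliquePartition U Qs → stableCount U ≡ product (map suc (orders Qs))
  stableCount-partition (none e) = stableCount-empty e
  stableCount-partition (some (Q⊆ , ne , cl , sep) _ p) =
    trans (stableCount-∖ Q⊆ sep) (cong₂ _*_ (stableCount-clique cl) (stableCount-partition p))

  sum-partition : ∀ {U Qs} → CliquePartition U Qs → sum (orders Qs) ≡ ∣ U ∣
  sum-partition (none e) = ≡-sym (∣∣≡0 e)
  sum-partition (some (Q⊆ , _) _ p) = trans (cong (_ +_) (sum-partition p)) (∣∖∣ Q⊆)

  partition-isolated : ∀ {U Qs} → CliquePartition U Qs → All (Isolated U) Qs
  partition-isolated (none e) = []
  partition-isolated (some iso@(_ , _ , _ , sep) _ p) = iso ∷ All.map (isolated-mono refl sep) (partition-isolated p)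

  -- A vertex outside the neighbourhood of `v` is picked from each clique; this can fail only at a
  -- clique that `v` sees entirely.
  transversal : ∀ {U Qs} v → CliquePartition U Qs → Any (λ Q → ∀ {x} → x ∈ Q → v ~ x) Qs ⊎
    (∃ λ S → (∀ {x} → x ∈ S → x ∈ U) × (∀ {x} → x ∈ S → v ≁ x) × IsStable G S × ∣ S ∣ ≡ length Qs)
  transversal v (none e) = inj₂ (empty , (λ x∈ → ⊥-elim (∉⊥ x∈)) , (λ x∈ → ⊥-elim (∉⊥ x∈)) , empty-stable , ∣⊥∣≡0 n)
  transversal {U} {Q ∷ Qs} v (some (Q⊆ , _ , _ , sep) _ p) with nonempty-or-empty (Q ∩ᵖ (not ∘ adj G v))
  ... | inj₂ e = inj₁ (here λ {x} x∈ → seen x∈ (~-or-≁ v x))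
    where
    seen : ∀ {x} → x ∈ Q → v ~ x ⊎ v ≁ x → v ~ x
    seen x∈ (inj₁ a) = a
    seen x∈ (inj₂ b) = ⊥-elim (e (∈∩ᵖ⁺ x∈ (cong not b)))
  ... | inj₁ (x , x∈) with ∈∩ᵖ⁻ x∈ | transversal v p
  ... | _ | inj₁ any = inj₁ (there any)
  ... | x∈Q , far | inj₂ (S , S⊆ , v≁S , st , size) = inj₂ (insert x S , (λ y∈ → in-U (insert⁻ y∈)) , (λ y∈ → away (insert⁻ y∈)) ,
      insert-stable (λ y∈ → sep x∈Q (S⊆ y∈)) st , trans (∣insert∣ λ x∈S → proj₂ (∈∖⁻ (S⊆ x∈S)) x∈Q) (cong suc size))
    where
    in-U : ∀ {y} → y ≡ x ⊎ y ∈ S → y ∈ U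
    in-U (inj₁ refl) = Q⊆ x∈Q
    in-U (inj₂ y∈) = proj₁ (∈∖⁻ (S⊆ y∈))
    away : ∀ {y} → y ≡ x ⊎ y ∈ S → v ≁ y
    away (inj₁ refl) = not-true⁻ far
    away (inj₂ y∈) = v≁S y∈

  maximum : ∀ (U : Subset n) (f : Fin n → ℕ) → Nonempty U → ∃ λ v → v ∈ U × (∀ {w} → w ∈ U → f w ≤ f v)
  maximum U f (u , u∈) = go ∣ U ∣ U u ≤-refl u∈
    where
    go : ∀ m U u → ∣ U ∣ ≤ m → u ∈ U → ∃ λ v → v ∈ U × (∀ {w} → w ∈ U → f w ≤ f v)
    go zero U u le u∈ = ⊥-elim (<⇒≱ (0<∣∣ u∈) le)
    go (suc m) U u le u∈ with Fin.any? (λ w → (w ∈? U) ×-dec (suc (f u) ≤? f w))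
    ... | no ¬p = u , u∈ , λ {w} w∈ → ≮⇒≥ λ lt → ¬p (w , w∈ , lt)
    ... | yes (w , w∈ , lt) with go m (U ⊖ u) w (≤-pred (subst (_≤ suc m) (≡-sym (∣⊖∣ u∈)) le)) (∈⊖⁺ w∈ (λ { refl → <-irrefl refl lt }))
    ... | v , v∈ , max = v , proj₁ (∈⊖⁻ v∈) , λ {z} z∈ → all z z∈
      where
      all : ∀ z → z ∈ U → f z ≤ f v
      all z z∈ with u Fin.≟ z
      ... | yes refl = ≤-trans (<⇒≤ lt) (max (∈⊖⁺ w∈ (λ { refl → <-irrefl refl lt })))
      ... | no u≢z = max (∈⊖⁺ z∈ u≢z)

  closedNeighbourhood : Subset n → Fin n → Subset n
  closedNeighbourhood U v = U ∖ (U ⊝ v)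

  ∈closed⁻ : ∀ {U v x} → x ∈ closedNeighbourhood U v → x ∈ U × (v ≡ x ⊎ v ~ x)
  ∈closed⁻ {U} {v} {x} x∈ with ∈∖⁻ x∈ | v Fin.≟ x | ~-or-≁ v x
  ... | x∈U , _ | yes e | _ = x∈U , inj₁ e
  ... | x∈U , _ | no _ | inj₁ e = x∈U , inj₂ e
  ... | x∈U , x∉ | no v≢x | inj₂ v≁x = ⊥-elim (x∉ (∈⊝⁺ x∈U v≢x v≁x))

  ∈closed⁺ : ∀ {U v x} → x ∈ U → v ≡ x ⊎ v ~ x → x ∈ closedNeighbourhood U v
  ∈closed⁺ x∈ (inj₁ e) = ∈∖⁺ x∈ λ x∈⊝ → proj₁ (proj₂ (∈⊝⁻ x∈⊝)) e
  ∈closed⁺ x∈ (inj₂ e) = ∈∖⁺ x∈ λ x∈⊝ → true≢false e (proj₂ (proj₂ (∈⊝⁻ x∈⊝)))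

  ∣closed∣ : ∀ {U v} → v ∈ U → ∣ closedNeighbourhood U v ∣ ≡ suc (deg U v)
  ∣closed∣ {U} {v} v∈ = +-cancelˡ-≡ ∣ U ⊝ v ∣ _ _ (trans (∣∖∣ λ x∈ → proj₁ (∈⊝⁻ x∈)) (≡-sym (∣⊝∣ v∈)))

  closed-isolated : ∀ {U v} → Cluster U → v ∈ U → Isolated U (closedNeighbourhood U v)
  closed-isolated {U} {v} cl v∈ = (λ x∈ → proj₁ (∈closed⁻ x∈)) , (v , ∈closed⁺ v∈ (inj₁ refl)) ,
    (λ x∈ y∈ → adjacent (∈closed⁻ x∈) (∈closed⁻ y∈)) , λ x∈ y∈ → apart (∈closed⁻ x∈) (∈∖⁻ y∈)
    where
    adjacent : ∀ {x y} → x ∈ U × (v ≡ x ⊎ v ~ x) → y ∈ U × (v ≡ y ⊎ v ~ y) → x ≢ y → x ~ y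
    adjacent (x∈ , inj₁ refl) (y∈ , inj₁ refl) ne = ⊥-elim (ne refl)
    adjacent (x∈ , inj₁ refl) (y∈ , inj₂ e) ne = e
    adjacent (x∈ , inj₂ e) (y∈ , inj₁ refl) ne = ~-sym e
    adjacent (x∈ , inj₂ e) (y∈ , inj₂ f) ne = cl x∈ v∈ y∈ (~-sym e) f ne
    apart : ∀ {x y} → x ∈ U × (v ≡ x ⊎ v ~ x) → y ∈ U × y ∉ closedNeighbourhood U v → x ≁ y
    apart {x} {y} (x∈ , e) (y∈ , y∉) with ~-or-≁ x y | e
    ... | inj₂ x≁y | _ = x≁y
    ... | inj₁ x~y | inj₁ refl = ⊥-elim (y∉ (∈closed⁺ y∈ (inj₂ x~y)))
    ... | inj₁ x~y | inj₂ v~x with v Fin.≟ y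
    ... | yes e = ⊥-elim (y∉ (∈closed⁺ y∈ (inj₁ e)))
    ... | no v≢y = ⊥-elim (y∉ (∈closed⁺ y∈ (inj₂ (cl v∈ x∈ y∈ v~x x~y v≢y))))

  clique-order : ∀ {U Q v} → (∀ {x} → x ∈ Q → x ∈ U) → Clique Q → v ∈ Q → ∣ Q ∣ ≤ suc (deg U v)
  clique-order {U} {Q} {v} Q⊆ cl v∈ = subst (∣ Q ∣ ≤_) (∣closed∣ (Q⊆ v∈)) (∣∣-mono λ {x} x∈ → ∈closed⁺ (Q⊆ x∈) (near x x∈))
    where
    near : ∀ x → x ∈ Q → v ≡ x ⊎ v ~ x
    near x x∈ with v Fin.≟ x
    ... | yes e = inj₁ e
    ... | no ne = inj₂ (cl v∈ x∈ ne)

  -- In a cluster closed neighbourhoods are cliques, and a vertex of maximum degree has the largest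
  -- one; removing these first yields the decreasing order.
  cluster-partition : ∀ {U} → Cluster U → ∃ (CliquePartition U)
  cluster-partition {U} cl = go ∣ U ∣ U ≤-refl cl
    where
    go : ∀ m U → ∣ U ∣ ≤ m → Cluster U → ∃ (CliquePartition U)
    go m U le cl with nonempty-or-empty U
    ... | inj₂ e = [] , none e
    go zero U le cl | inj₁ (u , u∈) = ⊥-elim (<⇒≱ (0<∣∣ u∈) le)
    go (suc m) U le cl | inj₁ ne with maximum U (deg U) ne
    ... | v , v∈ , max with go m (U ∖ Q) smaller (cluster-mono (λ x∈ → proj₁ (∈∖⁻ x∈)) cl)
      where
      Q = closedNeighbourhood U v
      smaller : ∣ U ∖ Q ∣ ≤ m
      smaller = ≤-pred (≤-trans (m<n+m ∣ U ∖ Q ∣ (subst (0 <_) (≡-sym (∣closed∣ v∈)) (s≤s z≤n)))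
                  (≤-trans (≤-reflexive (∣∖∣ (λ x∈ → proj₁ (∈closed⁻ x∈)))) le))
    ... | Qs , p = _ , some (closed-isolated cl v∈) (All.map bound (partition-isolated p)) p
      where
      bound : ∀ {Q′} → Isolated (U ∖ closedNeighbourhood U v) Q′ → ∣ Q′ ∣ ≤ ∣ closedNeighbourhood U v ∣
      bound (Q′⊆ , (w , w∈) , cl′ , _) = ≤-trans (clique-order (λ x∈ → proj₁ (∈∖⁻ (Q′⊆ x∈))) cl′ w∈)
        (≤-trans (s≤s (max (proj₁ (∈∖⁻ (Q′⊆ w∈))))) (≤-reflexive (≡-sym (∣closed∣ v∈))))

  partition-stable : ∀ {U Qs} → CliquePartition U Qs → ∃ λ S → (∀ {x} → x ∈ S → x ∈ U) × IsStable G S × ∣ S ∣ ≡ length Qs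
  partition-stable (none e) = empty , (λ x∈ → ⊥-elim (∉⊥ x∈)) , empty-stable , ∣⊥∣≡0 n
  partition-stable {U} {Q ∷ Qs} (some (Q⊆ , (x , x∈Q) , _ , sep) _ p) with partition-stable p
  ... | S , S⊆ , st , size = insert x S , (λ y∈ → in-U (insert⁻ y∈)) ,
      insert-stable (λ y∈ → sep x∈Q (S⊆ y∈)) st , trans (∣insert∣ λ x∈S → proj₂ (∈∖⁻ (S⊆ x∈S)) x∈Q) (cong suc size)
    where
    in-U : ∀ {y} → y ≡ x ⊎ y ∈ S → y ∈ U
    in-U (inj₁ refl) = Q⊆ x∈Q
    in-U (inj₂ y∈) = proj₁ (∈∖⁻ (S⊆ y∈))

  -- There may be fewer than `x + y` cliques, so the list of orders is padded with zeros, which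
  -- contribute the factor one. Equality makes every entry `suc k` or `suc (suc k)`, so no zero was
  -- added.
  partition-balanced : ∀ k x y {U Qs} → CliquePartition U Qs → StabilityAtMost U (x + y) → ∣ U ∣ ≡ turánOrder (suc k) x y →
    stableCount U ≡ balanced (suc (suc k)) x y → length Qs ≡ x + y × All (λ Q → Sandwich (suc k) ∣ Q ∣) Qs
  partition-balanced k x y {U} {Qs} p sl size eq with partition-stable p
  ... | S , S⊆ , st , len with m≤n⇒∃[o]m+o≡n (subst (_≤ x + y) len (sl S S⊆ st))
  ... | o , o≡ = conclude o o≡ (proj₂ (product-suc-balanced (suc k) x y padded
      (trans (length-++ (orders Qs)) (trans (cong₂ _+_ (length-map ∣_∣ Qs) (length-replicate o)) o≡))
      (trans (sum-++ (orders Qs) _) (trans (cong₂ _+_ (sum-partition p) (trans (sum-replicate o 0) (*-zeroʳ o))) (trans (+-identityʳ _) size))))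
      (trans (cong product (map-++ suc (orders Qs) _)) (trans (product-++ (map suc (orders Qs)) _)
        (trans (cong₂ _*_ (≡-sym (stableCount-partition p)) (ones o)) (trans (*-identityʳ _) eq)))))
    where
    padded = orders Qs ++ replicate o 0
    ones : ∀ o → product (map suc (replicate o 0)) ≡ 1
    ones zero = refl
    ones (suc o) = trans (+-identityʳ _) (ones o)
    conclude : ∀ o → length Qs + o ≡ x + y → All (Sandwich (suc k)) (orders Qs ++ replicate o 0) → length Qs ≡ x + y × All (λ Q → Sandwich (suc k) ∣ Q ∣) Qs
    conclude zero e a = trans (≡-sym (+-identityʳ _)) e , All.map⁻ (All.++⁻ˡ (orders Qs) a)
    conclude (suc o) e a with All.++⁻ʳ (orders Qs) a
    ... | inj₁ () ∷ _
    ... | inj₂ () ∷ _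

  choose-all : ∀ {A : Set} {P Q : A → Set} {xs} → All P xs → Any Q xs → ∃ λ x → P x × Q x
  choose-all (p ∷ _) (here q) = _ , p , q
  choose-all (_ ∷ ps) (there q) = choose-all ps q

  module _ {k x y W} (ts : TuránStep k x y W) (sl : StabilityAtMost W (suc x + y))
    (⊖-size≡ : ∣ W ⊖ TuránStep.v ts ∣ ≡ turánOrder k x (suc y)) (⊖-count : stableCount (W ⊖ TuránStep.v ts) ≡ balanced (suc k) x (suc y))
    (⊖-cluster : Cluster (W ⊖ TuránStep.v ts)) (⊝-size≡ : ∣ W ⊝ TuránStep.v ts ∣ ≡ turánOrder k x y) where

    open TuránStep ts

    private
      deg≡ : deg W v ≡ k
      deg≡ = suc-injective (+-cancelˡ-≡ (turánOrder k x y) _ _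
        (trans (cong (_+ suc (deg W v)) (≡-sym ⊝-size≡)) (trans (∣⊝∣ v∈) (trans size (trans (turánOrder-suc k x y) (+-comm (suc k) _))))))

      NeighboursClique : Set
      NeighboursClique = ∃ λ Q → (∀ {z} → z ∈ W → v ~ z → z ∈ Q) × (∀ {z} → z ∈ Q → v ~ z) × Clique Q × Separated Q ((W ⊖ v) ∖ Q)

      assemble : NeighboursClique → Cluster W
      assemble (Q , N⊆Q , Q⊆N , clQ , sep) {a} {b} {c} a∈ b∈ c∈ a~b b~c a≢c with v Fin.≟ a | v Fin.≟ b | v Fin.≟ c
      ... | yes refl | yes refl | _ = b~c
      ... | yes refl | no v≢b | yes refl = ⊥-elim (a≢c refl)
      ... | no v≢a | yes refl | _ = clQ (N⊆Q a∈ (~-sym a~b)) (N⊆Q c∈ b~c) a≢c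
      ... | no v≢a | no v≢b | no v≢c = ⊖-cluster (∈⊖⁺ a∈ v≢a) (∈⊖⁺ b∈ v≢b) (∈⊖⁺ c∈ v≢c) a~b b~c a≢c
      ... | yes refl | no v≢b | no v≢c with c ∈? Q
      ... | yes c∈Q = Q⊆N c∈Q
      ... | no c∉Q = true≢false b~c (sep (N⊆Q b∈ a~b) (∈∖⁺ (∈⊖⁺ c∈ v≢c) c∉Q))
      assemble (Q , N⊆Q , Q⊆N , clQ , sep) {a} {b} {c} a∈ b∈ c∈ a~b b~c a≢c | no v≢a | no v≢b | yes refl with a ∈? Q
      ... | yes a∈Q = ~-sym (Q⊆N a∈Q)
      ... | no a∉Q = true≢false (~-sym a~b) (sep (N⊆Q b∈ (~-sym b~c)) (∈∖⁺ (∈⊖⁺ a∈ v≢a) a∉Q))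

      large : (Q : Subset n) → Sandwich k ∣ Q ∣ → k ≤ ∣ Q ∣
      large Q (inj₁ e) = ≤-reflexive (≡-sym e)
      large Q (inj₂ e) = ≤-trans (n≤1+n k) (≤-reflexive (≡-sym e))

      -- If `v` missed a vertex of each clique of `W ⊖ v`, a transversal together with `v` would be
      -- too large a stable set. So `v` sees a whole clique; its order is at least `k`, the degree
      -- of `v`, hence it is all of `N(v)`, and adding `v` keeps a cluster. For `k = 0` the vertex
      -- is isolated.
      with-degree : ∀ k′ → k ≡ k′ → Cluster W
      with-degree zero k≡ = assemble (empty , (λ z∈ v~z → ⊥-elim (<⇒≱ (0<∣∣ (∈∩ᵖ⁺ z∈ v~z)) (≤-reflexive (trans deg≡ k≡)))) ,
        (λ z∈ → ⊥-elim (∉⊥ z∈)) , (λ z∈ → ⊥-elim (∉⊥ z∈)) , λ z∈ → ⊥-elim (∉⊥ z∈))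
      with-degree (suc k′) k≡ with cluster-partition ⊖-cluster
      ... | Qs , p with partition-balanced k′ x (suc y) p ⊖-stab (trans ⊖-size≡ (cong (λ k → turánOrder k x (suc y)) k≡))
                          (trans ⊖-count (cong (λ k → balanced (suc k) x (suc y)) k≡)) | transversal v p
      ... | len , sizes | inj₂ (S , S⊆ , v≁S , st , ∣S∣) = ⊥-elim (<⇒≱ (s≤s (≤-reflexive (trans (≡-sym (+-suc x y)) (≡-sym (trans ∣S∣ len)))))
            (stabilityAtMost-insert sl v∈ (λ z∈ → ∈⊝⁺ (proj₁ (∈⊖⁻ (S⊆ z∈))) (proj₂ (∈⊖⁻ (S⊆ z∈))) (v≁S z∈)) st))
      ... | len , sizes | inj₁ any with choose-all (All.zip (sizes , partition-isolated p)) any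
      ... | Q , (sQ , Q⊆ , _ , clQ , sep) , seen = assemble (Q ,
          (λ z∈ v~z → ⊆-card-≡ {p = Q} {neighbours W v} (λ z∈Q → ∈∩ᵖ⁺ (proj₁ (∈⊖⁻ (Q⊆ z∈Q))) (seen z∈Q))
             (subst (_≤ ∣ Q ∣) (≡-sym deg≡) (large Q (subst (λ k → Sandwich k ∣ Q ∣) (≡-sym k≡) sQ))) (∈∩ᵖ⁺ z∈ v~z)) ,
          seen , clQ , sep)

    turán-step-cluster : Cluster W
    turán-step-cluster = with-degree k refl

  turán-equality : ∀ k x y W → ∣ W ∣ ≤ turánOrder k x y → StabilityAtMost W (x + y) → stableCount W ≡ balanced (suc k) x y →
    ∣ W ∣ ≡ turánOrder k x y × Cluster W
  turán-equality zero zero y W le sl eq = ≤-antisym le z≤n , λ x∈ → ⊥-elim (<⇒≱ (0<∣∣ x∈) le)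
  turán-equality (suc k) zero y W le sl eq with turán-equality k y zero W (subst (∣ W ∣ ≤_) (turánOrder-shift k y) le)
      (subst (StabilityAtMost W) (≡-sym (+-identityʳ y)) sl) (trans eq (balanced-shift (suc k) y))
  ... | size , cl = trans size (≡-sym (turánOrder-shift k y)) , cl
  turán-equality k (suc x) y W le sl eq with turán-step k x y W le sl
  ... | inj₁ le′ = ⊥-elim (<-irrefl eq (≤-<-trans (turán k x (suc y) W le′ (subst (StabilityAtMost W) (≡-sym (+-suc x y)) sl)) (balanced-mono-suc k x y)))
  ... | inj₂ ts with +-≤-≡ (turán k x (suc y) (W ⊖ v) ⊖-size ⊖-stab) (turán k x y (W ⊝ v) ⊝-size ⊝-stab)
      (trans (≡-sym (stableCount-split v∈)) (trans eq (balanced-suc k x y)))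
    where open TuránStep ts
  ... | eq⊖ , eq⊝ with turán-equality k x (suc y) _ (TuránStep.⊖-size ts) (TuránStep.⊖-stab ts) eq⊖
                     | turán-equality k x y _ (TuránStep.⊝-size ts) (TuránStep.⊝-stab ts) eq⊝
  ... | size⊖ , cl⊖ | size⊝ , _ = TuránStep.size ts , turán-step-cluster ts sl size⊖ eq⊖ cl⊖ size⊝

  -- Connectivity and stability inside a vertex set.

  -- Connectivity by edges across cuts instead of paths. Its failure is a `Closed` subset, which a
  -- search over all subsets finds.
  Connectedᵂ : Subset n → Set
  Connectedᵂ W = ∀ U → (∀ {x} → x ∈ U → x ∈ W) → Nonempty U → Nonempty (W ∖ U) →
    ∃ λ x → ∃ λ y → x ∈ U × y ∈ W ∖ U × x ~ y

  Closed : Subset n → Subset n → Set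
  Closed W U = (∀ {x} → x ∈ U → x ∈ W) × Nonempty U × Nonempty (W ∖ U) × Separated U (W ∖ U)

  separated-or-edge : ∀ A B → Separated A B ⊎ (∃ λ x → ∃ λ y → x ∈ A × y ∈ B × x ~ y)
  separated-or-edge A B with Fin.any? (λ x → Fin.any? (λ y → (x ∈? A) ×-dec ((y ∈? B) ×-dec (adj G x y Bool.≟ true))))
  ... | yes p = inj₂ p
  ... | no ¬p = inj₁ λ {x} {y} x∈ y∈ → decide x y x∈ y∈ (~-or-≁ x y)
    where
    decide : ∀ x y → x ∈ A → y ∈ B → x ~ y ⊎ x ≁ y → x ≁ y
    decide x y x∈ y∈ (inj₁ e) = ⊥-elim (¬p (x , y , x∈ , y∈ , e))
    decide x y x∈ y∈ (inj₂ e) = e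

  separated? : ∀ A B → Dec (Separated A B)
  separated? A B with separated-or-edge A B
  ... | inj₁ s = yes s
  ... | inj₂ (x , y , x∈ , y∈ , e) = no λ s → true≢false e (s x∈ y∈)

  closed? : ∀ W U → Dec (Closed W U)
  closed? W U = (U ⊆? W) ×-dec (nonempty? U ×-dec (nonempty? (W ∖ U) ×-dec separated? U (W ∖ U)))

  closed-or-connected : ∀ W → ∃ (Closed W) ⊎ Connectedᵂ W
  closed-or-connected W with anySubset? (closed? W)
  ... | yes p = inj₁ p
  ... | no ¬p = inj₂ λ U U⊆ ne ne′ → edge U U⊆ ne ne′ (separated-or-edge U (W ∖ U))
    where
    edge : ∀ U → (∀ {x} → x ∈ U → x ∈ W) → Nonempty U → Nonempty (W ∖ U) →
      Separated U (W ∖ U) ⊎ (∃ λ x → ∃ λ y → x ∈ U × y ∈ W ∖ U × x ~ y) → ∃ λ x → ∃ λ y → x ∈ U × y ∈ W ∖ U × x ~ y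
    edge U U⊆ ne ne′ (inj₁ sep) = ⊥-elim (¬p (U , U⊆ , ne , ne′ , sep))
    edge U U⊆ ne ne′ (inj₂ e) = e

  -- A closed subset of a closed set is again closed in `Y`, so shrinking ends with a connected one.
  component : ∀ {Y U} → Closed Y U → ∃ λ A → Closed Y A × Connectedᵂ A × (∀ {x} → x ∈ A → x ∈ U)
  component {Y} {U} cl = go ∣ U ∣ U ≤-refl cl
    where
    go : ∀ m U → ∣ U ∣ ≤ m → Closed Y U → ∃ λ A → Closed Y A × Connectedᵂ A × (∀ {x} → x ∈ A → x ∈ U)
    go m U le cl with closed-or-connected U
    ... | inj₂ conn = U , cl , conn , λ x∈ → x∈
    go zero U le (_ , (u , u∈) , _) | inj₁ _ = ⊥-elim (<⇒≱ (0<∣∣ u∈) le)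
    go (suc m) U le (U⊆ , _ , _ , sepU) | inj₁ (V , V⊆ , neV , (z , z∈) , sepV)
      with go m V (≤-pred (≤-trans (m<m+n ∣ V ∣ (0<∣∣ z∈)) (≤-trans (≤-reflexive (∣∖∣ V⊆)) le)))
           ((λ x∈ → U⊆ (V⊆ x∈)) , neV , (z , ∈∖⁺ (U⊆ (proj₁ (∈∖⁻ z∈))) (proj₂ (∈∖⁻ z∈))) , λ x∈ y∈ → sep x∈ y∈)
      where
      sep : ∀ {x y} → x ∈ V → y ∈ Y ∖ V → x ≁ y
      sep {x} {y} x∈ y∈ with y ∈? U
      ... | yes y∈U = sepV x∈ (∈∖⁺ y∈U (proj₂ (∈∖⁻ y∈)))
      ... | no y∉U = sepU (V⊆ x∈) (∈∖⁺ (proj₁ (∈∖⁻ y∈)) y∉U)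
    ... | A , clA , conn , A⊆ = A , clA , conn , λ x∈ → V⊆ (A⊆ x∈)

  closed-complement : ∀ {Y A} → Closed Y A → Closed Y (Y ∖ A)
  closed-complement {Y} {A} (A⊆ , (a , a∈) , ne , sep) = (λ x∈ → proj₁ (∈∖⁻ x∈)) , ne ,
    (a , ∈∖⁺ (A⊆ a∈) (λ a∈′ → proj₂ (∈∖⁻ a∈′) a∈)) , λ x∈ y∈ → ≁-sym (sep (back y∈) x∈)
    where
    back : ∀ {y} → y ∈ Y ∖ (Y ∖ A) → y ∈ A
    back {y} y∈ with y ∈? A
    ... | yes y∈A = y∈A
    ... | no y∉A = ⊥-elim (proj₂ (∈∖⁻ y∈) (∈∖⁺ (proj₁ (∈∖⁻ y∈)) y∉A))

  StableSet : Subset n → ℕ → Set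
  StableSet W a = ∃ λ S → (∀ {x} → x ∈ S → x ∈ W) × IsStable G S × ∣ S ∣ ≡ a

  HasStability : Subset n → ℕ → Set
  HasStability W a = StableSet W a × StabilityAtMost W a

  stability-number : ∀ W a → StabilityAtMost W a → ∃ λ b → HasStability W b
  stability-number W a sl with anySubset? (λ S → (S ⊆? W) ×-dec (isStable? G S ×-dec (∣ S ∣ ≟ a)))
  ... | yes (S , S⊆ , st , eq) = a , (S , (λ x∈ → S⊆ x∈) , st , eq) , sl
  stability-number W zero sl | no ¬p = ⊥-elim (¬p (empty , (λ x∈ → ⊥-elim (∉⊥ x∈)) , empty-stable , ∣⊥∣≡0 n))
  stability-number W (suc a) sl | no ¬p = stability-number W a λ S S⊆ st →
    ≤-pred (≤∧≢⇒< (sl S S⊆ st) (λ eq → ¬p (S , (λ x∈ → S⊆ x∈) , st , eq)))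

  stability≤order : ∀ {W a} → HasStability W a → a ≤ ∣ W ∣
  stability≤order ((S , S⊆ , _ , eq) , _) = subst (_≤ _) eq (∣∣-mono S⊆)

  ∪-stable : ∀ {S T} → Separated S T → IsStable G S → IsStable G T → IsStable G (S ∪ T)
  ∪-stable {S} {T} sep stS stT i j i∈ j∈ with ∪⁻ {p = S} i∈ | ∪⁻ {p = S} j∈
  ... | inj₁ a | inj₁ b = stS i j a b
  ... | inj₁ a | inj₂ b = sep a b
  ... | inj₂ a | inj₁ b = ≁-sym (sep b a)
  ... | inj₂ a | inj₂ b = stT i j a b

  ∪-bound : ∀ {W a S T} → StabilityAtMost W a → (∀ {x} → x ∈ S → x ∈ W) → (∀ {x} → x ∈ T → x ∈ W) →
    Disjoint S T → Separated S T → IsStable G S → IsStable G T → ∣ S ∣ + ∣ T ∣ ≤ a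
  ∪-bound {W} {a} {S} {T} sl S⊆ T⊆ disj sep stS stT = subst (_≤ a) (∣∪∣ disj) (sl (S ∪ T) (λ x∈ → inW (∪⁻ x∈)) (∪-stable sep stS stT))
    where
    inW : ∀ {x} → x ∈ S ⊎ x ∈ T → x ∈ W
    inW (inj₁ a) = S⊆ a
    inW (inj₂ b) = T⊆ b

  stability-one-clique : ∀ {Q} → StabilityAtMost Q 1 → Clique Q
  stability-one-clique {Q} sl {x} {y} x∈ y∈ x≢y with ~-or-≁ x y
  ... | inj₁ e = e
  ... | inj₂ e = ⊥-elim (<⇒≱ (s≤s z≤n) (stabilityAtMost-positive (stabilityAtMost-⊝ x∈ sl) (∈⊝⁺ y∈ x≢y e)))

  clique-cluster : ∀ {Q} → Clique Q → Cluster Q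
  clique-cluster cl x∈ y∈ z∈ _ _ x≢z = cl x∈ z∈ x≢z

  cluster-∪ : ∀ {A B} → Cluster A → Cluster B → Separated A B → Cluster (A ∪ B)
  cluster-∪ {A} {B} clA clB sep x∈ y∈ z∈ e f ne with ∪⁻ {p = A} x∈ | ∪⁻ {p = A} y∈ | ∪⁻ {p = A} z∈
  ... | inj₁ a | inj₁ b | inj₁ c = clA a b c e f ne
  ... | inj₂ a | inj₂ b | inj₂ c = clB a b c e f ne
  ... | inj₁ a | inj₂ b | _ = true≢false e (sep a b)
  ... | inj₂ a | inj₁ b | _ = true≢false (~-sym e) (sep b a)
  ... | _ | inj₁ b | inj₂ c = true≢false f (sep b c)
  ... | _ | inj₂ b | inj₁ c = true≢false (~-sym f) (sep c b)

  -- Connected graphs with a cut vertex.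

  module CutVertex {W : Subset n} {c : Fin n} (c∈ : c ∈ W) (conn : Connectedᵂ W) where

    Y : Subset n
    Y = W ⊖ c

    record Side (A : Subset n) : Set where
      field
        closed : Closed Y A
        connected : Connectedᵂ A

      A⊆W : ∀ {x} → x ∈ A → x ∈ W
      A⊆W x∈ = proj₁ (∈⊖⁻ (proj₁ closed x∈))

      c∉A : c ∉ A
      c∉A c∈A = proj₂ (∈⊖⁻ (proj₁ closed c∈A)) refl

      c∈rest : c ∈ W ∖ A
      c∈rest = ∈∖⁺ c∈ c∉A

      separated-rest : ∀ {x y} → x ∈ A → y ∈ W ∖ A → c ≢ y → x ≁ y
      separated-rest x∈ y∈ c≢y = proj₂ (proj₂ (proj₂ closed)) x∈ (∈∖⁺ (∈⊖⁺ (proj₁ (∈∖⁻ y∈)) c≢y) (proj₂ (∈∖⁻ y∈)))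

      attached : ∃ λ u → u ∈ A × c ~ u
      attached with conn A A⊆W (proj₁ (proj₂ closed)) (c , c∈rest)
      ... | x , y , x∈ , y∈ , x~y with c Fin.≟ y
      ... | yes refl = x , x∈ , ~-sym x~y
      ... | no c≢y = true≢false x~y (separated-rest x∈ y∈ c≢y)

      -- `A` meets the rest only through `c`. A cut of `W ∖ A` is extended to `W` by putting `A` on
      -- the side of `c`; the crossing edge then avoids `A`.
      rest-connected : Connectedᵂ (W ∖ A)
      rest-connected U U⊆ ne ne′ with c ∈? U
      ... | no c∉U = grow (conn U (λ x∈ → proj₁ (∈∖⁻ (U⊆ x∈))) ne
                         (c , ∈∖⁺ c∈ c∉U))
        where
        grow : (∃ λ x → ∃ λ y → x ∈ U × y ∈ W ∖ U × x ~ y) → ∃ λ x → ∃ λ y → x ∈ U × y ∈ W ∖ A ∖ U × x ~ y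
        grow (x , y , x∈ , y∈ , x~y) with y ∈? A
        ... | no y∉A = x , y , x∈ , ∈∖⁺ (∈∖⁺ (proj₁ (∈∖⁻ y∈)) y∉A) (proj₂ (∈∖⁻ y∈)) , x~y
        ... | yes y∈A = true≢false (~-sym x~y) (separated-rest y∈A (U⊆ x∈) (λ { refl → c∉U x∈ }))
      ... | yes c∈U = grow (conn V (λ x∈ → proj₁ (∈∖⁻ (proj₁ (∈∖⁻ x∈)))) ne′
                         (c , ∈∖⁺ c∈ (λ c∈V → proj₂ (∈∖⁻ c∈V) c∈U)))
        where
        V = W ∖ A ∖ U
        grow : (∃ λ x → ∃ λ y → x ∈ V × y ∈ W ∖ V × x ~ y) → ∃ λ x → ∃ λ y → x ∈ U × y ∈ W ∖ A ∖ U × x ~ y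
        grow (x , y , x∈ , y∈ , x~y) with y ∈? A | y ∈? U
        ... | yes y∈A | _ = true≢false (~-sym x~y) (separated-rest y∈A (proj₁ (∈∖⁻ x∈)) (λ { refl → proj₂ (∈∖⁻ x∈) c∈U }))
        ... | no y∉A | yes y∈U = y , x , y∈U , x∈ , ~-sym x~y
        ... | no y∉A | no y∉U = ⊥-elim (proj₂ (∈∖⁻ y∈) (∈∖⁺ (∈∖⁺ (proj₁ (∈∖⁻ y∈)) y∉A) y∉U))

    open Side

    AvoidsCut : Subset n → ℕ → Set
    AvoidsCut A α = ∃ λ S → (∀ {x} → x ∈ S → x ∈ A) × IsStable G S × ∣ S ∣ ≡ α × (∀ {x} → x ∈ S → c ≁ x)

    avoidsCut? : ∀ A α → Dec (AvoidsCut A α)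
    avoidsCut? A α with anySubset? (λ S → (S ⊆? A ∩ᵖ (not ∘ adj G c)) ×-dec (isStable? G S ×-dec (∣ S ∣ ≟ α)))
    ... | yes (S , S⊆ , st , eq) = yes (S , (λ x∈ → proj₁ (∈∩ᵖ⁻ (S⊆ x∈))) , st , eq , (λ x∈ → not-true⁻ (proj₂ (∈∩ᵖ⁻ (S⊆ x∈)))))
    ... | no ¬p = no λ (S , S⊆ , st , eq , far) → ¬p (S , (λ x∈ → ∈∩ᵖ⁺ (S⊆ x∈) (cong not (far x∈))) , st , eq)

    Additive : ℕ → Subset n → ℕ → Set
    Additive a A α = ∀ T → (∀ {x} → x ∈ T → x ∈ W ∖ A) → IsStable G T → α + ∣ T ∣ ≤ a

    -- A maximum stable set of `A` without neighbours of `c` can be united with every stable set of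
    -- the rest, even one that contains `c`.
    avoidsCut-additive : ∀ {a A α} → Side A → StabilityAtMost W a → AvoidsCut A α → Additive a A α
    avoidsCut-additive {a} {A} side sl (S , S⊆ , st , refl , far) T T⊆ stT =
      ∪-bound sl (λ x∈ → A⊆W side (S⊆ x∈)) (λ x∈ → proj₁ (∈∖⁻ (T⊆ x∈))) (λ x∈ x∈T → proj₂ (∈∖⁻ (T⊆ x∈T)) (S⊆ x∈)) sep st stT
      where
      sep : Separated S T
      sep {x} {y} x∈ y∈ with c Fin.≟ y
      ... | yes refl = ≁-sym (far x∈)
      ... | no c≢y = separated-rest side (S⊆ x∈) (T⊆ y∈) c≢y

    -- If the cut vertex meets every maximum stable set of C, then it can be traded for a vertex of C.
    avoid-cut : ∀ {A C γ T} → Side A → Side C → (∀ {x} → x ∈ C → x ∉ A) → HasStability C γ → ¬ AvoidsCut C γ →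
      (∀ {x} → x ∈ T → x ∈ W ∖ A) → IsStable G T → ∃ λ R → (∀ {x} → x ∈ R → x ∈ W ∖ A) × c ∉ R × IsStable G R × ∣ T ∣ ≤ ∣ R ∣
    avoid-cut {A} {C} {γ} {T} sideA sideC C∩A ((S , S⊆ , st , S≡) , slC) bad T⊆ stT with c ∈? T
    ... | no c∉T = T , T⊆ , c∉T , stT , ≤-refl
    ... | yes c∈T = S ∪ T₂ , (λ x∈ → in-rest (∪⁻ x∈)) , (λ c∈R → no-c (∪⁻ c∈R)) ,
        ∪-stable sep st (λ i j i∈ j∈ → stT i j (T₂⊆T i∈) (T₂⊆T j∈)) , (begin
          ∣ T ∣                     ≡⟨ ≡-sym (∣∩ᵖ∣-split T (isMember C)) ⟩
          ∣ T₁ ∣ + ∣ T ∩ᵖ (not ∘ isMember C) ∣ ≡⟨ cong (λ p → ∣ T₁ ∣ + ∣ p ∣) (≡-sym (∖-def T C)) ⟩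
          ∣ T₁ ∣ + ∣ T ∖ C ∣        ≡⟨ cong (∣ T₁ ∣ +_) (≡-sym (∣⊖∣ (∈∖⁺ c∈T (c∉A sideC)))) ⟩
          ∣ T₁ ∣ + suc ∣ T₂ ∣       ≡⟨ +-suc _ _ ⟩
          suc ∣ T₁ ∣ + ∣ T₂ ∣       ≤⟨ +-monoˡ-≤ ∣ T₂ ∣ T₁< ⟩
          γ + ∣ T₂ ∣                ≡⟨ cong (_+ ∣ T₂ ∣) (≡-sym S≡) ⟩
          ∣ S ∣ + ∣ T₂ ∣            ≡⟨ ≡-sym (∣∪∣ λ x∈ x∈T₂ → proj₂ (∈∖⁻ (proj₁ (∈⊖⁻ x∈T₂))) (S⊆ x∈)) ⟩
          ∣ S ∪ T₂ ∣                ∎)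
      where
      open ≤-Reasoning
      T₁ = T ∩ᵖ isMember C
      T₂ = T ∖ C ⊖ c
      T₂⊆T : ∀ {x} → x ∈ T₂ → x ∈ T
      T₂⊆T x∈ = proj₁ (∈∖⁻ (proj₁ (∈⊖⁻ x∈)))
      in-rest : ∀ {x} → x ∈ S ⊎ x ∈ T₂ → x ∈ W ∖ A
      in-rest (inj₁ x∈) = ∈∖⁺ (A⊆W sideC (S⊆ x∈)) (C∩A (S⊆ x∈))
      in-rest (inj₂ x∈) = T⊆ (T₂⊆T x∈)
      no-c : c ∈ S ⊎ c ∈ T₂ → ⊥
      no-c (inj₁ c∈) = c∉A sideC (S⊆ c∈)
      no-c (inj₂ c∈) = proj₂ (∈⊖⁻ c∈) refl
      sep : Separated S T₂
      sep x∈ y∈ = separated-rest sideC (S⊆ x∈) (∈∖⁺ (proj₁ (∈∖⁻ (T⊆ (T₂⊆T y∈)))) (proj₂ (∈∖⁻ (proj₁ (∈⊖⁻ y∈))))) (proj₂ (∈⊖⁻ y∈))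
      T₁⊆C : ∀ {x} → x ∈ T₁ → x ∈ C
      T₁⊆C x∈ = does⁻ (_ ∈? C) (proj₂ (∈∩ᵖ⁻ x∈))
      st₁ : IsStable G T₁
      st₁ i j i∈ j∈ = stT i j (proj₁ (∈∩ᵖ⁻ i∈)) (proj₁ (∈∩ᵖ⁻ j∈))
      T₁< : ∣ T₁ ∣ < γ
      T₁< = ≤∧≢⇒< (slC T₁ T₁⊆C st₁) λ eq → bad (T₁ , T₁⊆C , st₁ , eq , λ x∈ → stT _ _ c∈T (proj₁ (∈∩ᵖ⁻ x∈)))

    -- A component with a maximum stable set avoiding the neighbours of `c` is additive. If neither
    -- `A` nor another component `C` has one, `A` is additive all the same: by `avoid-cut`, trading
    -- `c` for a vertex of `C`, stable sets of the rest may be assumed to omit `c`.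
    additive-side : ∀ {a U} → HasStability W a → Closed Y U → ∃ λ A → ∃ λ α → Side A × HasStability A α × Additive a A α
    additive-side {a} (_ , sl) cl with component cl
    ... | A , clA , connA , _ with stability-number A a (stabilityAtMost-mono (λ x∈ → proj₁ (∈⊖⁻ (proj₁ clA x∈))) sl)
    ... | α , hasA@((S , S⊆ , st , S≡) , slA) with avoidsCut? A α
    ... | yes good = A , α , sideA , hasA , avoidsCut-additive sideA sl good
      where sideA = record { closed = clA ; connected = connA }
    ... | no badA with component (closed-complement clA)
    ... | C , clC , connC , C⊆ with stability-number C a (stabilityAtMost-mono (λ x∈ → proj₁ (∈⊖⁻ (proj₁ clC x∈))) sl)
    ... | γ , hasC with avoidsCut? C γ
    ... | yes good = C , γ , sideC , hasC , avoidsCut-additive sideC sl good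
      where sideC = record { closed = clC ; connected = connC }
    ... | no badC = A , α , sideA , hasA , additive
      where
      sideA = record { closed = clA ; connected = connA }
      sideC = record { closed = clC ; connected = connC }
      additive : Additive a A α
      additive T T⊆ stT with avoid-cut sideA sideC (λ x∈ → proj₂ (∈∖⁻ (C⊆ x∈))) hasC badC T⊆ stT
      ... | R , R⊆ , c∉R , stR , T≤R = ≤-trans (+-mono-≤ (≤-reflexive (≡-sym S≡)) T≤R)
        (∪-bound sl (λ x∈ → A⊆W sideA (S⊆ x∈)) (λ x∈ → proj₁ (∈∖⁻ (R⊆ x∈))) (λ x∈ x∈R → proj₂ (∈∖⁻ (R⊆ x∈R)) (S⊆ x∈))
          (λ x∈ y∈ → separated-rest sideA (S⊆ x∈) (R⊆ y∈) (λ { refl → c∉R y∈ })) st stR)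

    rest-stability : ∀ {a A α} → HasStability W a → Side A → HasStability A α → Additive a A α → ∃ λ β → a ≡ α + β × HasStability (W ∖ A) β
    rest-stability {a} {A} {α} ((S , S⊆ , st , S≡) , sl) side (_ , slA) add
      with m≤n⇒∃[o]m+o≡n (≤-trans (m≤m+n α ∣ empty {n} ∣) (add empty (λ x∈ → ⊥-elim (∉⊥ x∈)) empty-stable))
    ... | β , eq = β , ≡-sym eq , (S ∖ A , (λ x∈ → ∈∖⁺ (S⊆ (proj₁ (∈∖⁻ x∈))) (proj₂ (∈∖⁻ x∈))) , st₂ ,
          ≤-antisym (slβ (S ∖ A) (λ x∈ → ∈∖⁺ (S⊆ (proj₁ (∈∖⁻ x∈))) (proj₂ (∈∖⁻ x∈))) st₂)
            (+-cancelˡ-≤ α _ _ (begin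
              α + β                     ≡⟨ trans eq (≡-sym S≡) ⟩
              ∣ S ∣                     ≡⟨ ≡-sym (∣∩ᵖ∣-split S (isMember A)) ⟩
              ∣ S ∩ᵖ isMember A ∣ + ∣ S ∩ᵖ (not ∘ isMember A) ∣ ≡⟨ cong (λ p → ∣ S ∩ᵖ isMember A ∣ + ∣ p ∣) (≡-sym (∖-def S A)) ⟩
              ∣ S ∩ᵖ isMember A ∣ + ∣ S ∖ A ∣ ≤⟨ +-monoˡ-≤ ∣ S ∖ A ∣ (slA (S ∩ᵖ isMember A) (λ x∈ → does⁻ (_ ∈? A) (proj₂ (∈∩ᵖ⁻ x∈)))
                                                  (λ i j i∈ j∈ → st i j (proj₁ (∈∩ᵖ⁻ i∈)) (proj₁ (∈∩ᵖ⁻ j∈)))) ⟩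
              α + ∣ S ∖ A ∣             ∎))) , slβ
      where
      open ≤-Reasoning
      slβ : StabilityAtMost (W ∖ A) β
      slβ T T⊆ stT = +-cancelˡ-≤ α _ _ (subst (α + ∣ T ∣ ≤_) (≡-sym eq) (add T T⊆ stT))
      st₂ : IsStable G (S ∖ A)
      st₂ i j i∈ j∈ = st i j (proj₁ (∈∖⁻ i∈)) (proj₁ (∈∖⁻ j∈))

  starOrder-pred : ∀ k x y → starOrder k x y ≡ suc (turánOrder k x (suc y))
  starOrder-pred k x y = trans (+-suc _ x) (cong (λ r → suc (k * r + x)) (≡-sym (+-suc x y)))

  balanced-sucʳ : ∀ k x y → balanced k x (suc y) ≡ k * balanced k x y
  balanced-sucʳ k x y = lem k (suc k ^ x) (k ^ y)
    where
    lem : ∀ k a b → a * (k * b) ≡ k * (a * b)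
    lem = solve-∀

  -- Here `a`, `a′`, `b`, `b′` are the indices of `A`, `A` minus `N(c)`, `D` minus `c` and `D` minus
  -- `N[c]`, where `D` is the rest. Bounds are given for `b` and `b + b′` but not for `b′`, so the
  -- sum is rewritten as `a′ * (b + b′) + (a - a′) * b`.
  cut-arithmetic : ∀ {P Q R T a a′ b b′} → a ≤ P → a′ < a → a′ ≤ Q → b ≤ R → b + b′ ≤ R + T → 0 < P → 0 < Q → 0 < R → 0 < T →
    a * b + a′ * b′ ≤ P * R + Q * T × (a * b + a′ * b′ ≡ P * R + Q * T → b ≡ R × a′ ≡ Q)
  cut-arithmetic {P} {Q} {R} {T} {a} {a′} {b} {b′} a≤ a′<a a′≤ b≤ bb≤ 0<P 0<Q 0<R 0<T with m≤n⇒∃[o]m+o≡n a′<a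
  ... | e , refl = ≤-trans (≤-reflexive left) (≤-trans first (≤-trans (≤-reflexive mid) second)) , λ eq →
      let second-eq = ≤-antisym second (≤-trans (≤-reflexive (≡-sym eq)) (≤-trans (≤-reflexive left) (≤-trans first (≤-reflexive mid))))
          first-eq = trans (≡-sym left) (trans eq (trans (≡-sym second-eq) (≡-sym mid)))
      in *-cancelˡ-≡ b R (suc e) (proj₂ (+-≤-≡ (*-monoʳ-≤ a′ bb≤) (*-monoʳ-≤ (suc e) b≤) first-eq)) ,
         *-cancelʳ-≡ a′ Q T {{>-nonZero 0<T}} (proj₂ (+-≤-≡ (*-monoˡ-≤ R a≤) (*-monoˡ-≤ T a′≤) second-eq))
    where
    left : suc (a′ + e) * b + a′ * b′ ≡ a′ * (b + b′) + suc e * b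
    left = lem a′ e b b′
      where lem : ∀ a′ e b b′ → suc (a′ + e) * b + a′ * b′ ≡ a′ * (b + b′) + suc e * b
            lem = solve-∀
    first : a′ * (b + b′) + suc e * b ≤ a′ * (R + T) + suc e * R
    first = +-mono-≤ (*-monoʳ-≤ a′ bb≤) (*-monoʳ-≤ (suc e) b≤)
    mid : a′ * (R + T) + suc e * R ≡ suc (a′ + e) * R + a′ * T
    mid = lem a′ e R T
      where lem : ∀ a′ e R T → a′ * (R + T) + suc e * R ≡ suc (a′ + e) * R + a′ * T
            lem = solve-∀
    second : suc (a′ + e) * R + a′ * T ≤ P * R + Q * T
    second = +-mono-≤ (*-monoˡ-≤ R a≤) (*-monoˡ-≤ T a′≤)

  0<balanced : ∀ k x y → suc (x + y) ≤ starOrder k x y → 0 < balanced k x y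
  0<balanced (suc k) x y _ = 0<balanced-suc k x y
  0<balanced zero x zero _ = 0<* (0<^ 0 x) (s≤s z≤n)
  0<balanced zero x (suc y) (s≤s le) = ⊥-elim (<⇒≱ (m<m+n x (s≤s z≤n)) le)

  AlmostCluster : Subset n → Set
  AlmostCluster W = ∃ λ u → u ∈ W × Cluster (W ⊖ u)

  -- The induction hypothesis contains no equality case: equality for `W` is traced back to equality
  -- in Turán's bound for parts of `W`, not to smaller connected extremal graphs.
  BoundedBelow : Subset n → Set
  BoundedBelow W = ∀ k x y V → ∣ V ∣ < ∣ W ∣ → ∣ V ∣ ≡ starOrder k x y → Connectedᵂ V → HasStability V (suc (x + y)) →
    stableCount V ≤ turánStar k x y

  parameters : ∀ {W a v} → v ∈ W → HasStability W a → ∃ λ k → ∃ λ x → ∃ λ y →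
    a ≡ suc (x + y) × ∣ W ∣ ≡ starOrder k x y × suc (x + y) ≤ starOrder k x y
  parameters {W} {zero} v∈ (_ , sl) with () ← stabilityAtMost-positive sl v∈
  parameters {W} {suc r} v∈ has with starParameters ∣ W ∣ r (0<∣∣ v∈)
  ... | k , x , y , refl , size = k , x , y , refl , size , subst (suc r ≤_) size (stability≤order has)

  cut-bound : ∀ {k x y W c U} → c ∈ W → Connectedᵂ W → Closed (W ⊖ c) U → ∣ W ∣ ≡ starOrder k x y → HasStability W (suc (x + y)) →
    BoundedBelow W → stableCount W ≤ turánStar k x y × (stableCount W ≡ turánStar k x y → AlmostCluster W)
  cut-bound {k} {x} {y} {W} {c} {U} c∈ conn clU size has IH with CutVertex.additive-side c∈ conn has clU
  ... | A , α , side , hasA , add with CutVertex.rest-stability c∈ conn has side hasA add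
  ... | β , a≡ , hasD with parameters (proj₁ (proj₂ (CutVertex.Side.attached side))) hasA | parameters (CutVertex.Side.c∈rest side) hasD
  ... | k₁ , x₁ , y₁ , refl , size₁ , r₁≤ | k₂ , x₂ , y₂ , refl , size₂ , r₂≤ =
      ≤-trans (≤-reflexive F≡) (≤-trans (proj₁ bound) (proj₁ merged)) , λ eq → equality
        (≤-antisym (proj₁ bound) (≤-trans (proj₁ merged) (≤-reflexive (trans (≡-sym eq) F≡))))
        (≤-antisym (proj₁ merged) (≤-trans (≤-reflexive (trans (≡-sym eq) F≡)) (proj₁ bound)))
    where
    open CutVertex c∈ conn
    open Side side
    D = W ∖ A
    B = D ⊖ c
    A′ = A ∩ᵖ (not ∘ adj G c)
    B′ = D ⊝ c
    Q = suc k₁ * balanced (suc k₁) x₁ y₁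
    R = suc k₂ * balanced (suc k₂) x₂ y₂
    u = proj₁ attached
    u∈ = proj₁ (proj₂ attached)
    c~u = proj₂ (proj₂ attached)
    ∣A∣+∣D∣ : ∣ A ∣ + ∣ D ∣ ≡ ∣ W ∣
    ∣A∣+∣D∣ = ∣∖∣ A⊆W
    A′⊆ : ∀ {z} → z ∈ A′ → z ∈ A ⊖ u
    A′⊆ z∈ = ∈⊖⁺ (proj₁ (∈∩ᵖ⁻ z∈)) (λ { refl → true≢false c~u (not-true⁻ (proj₂ (∈∩ᵖ⁻ z∈))) })
    ∣A⊖u∣ : ∣ A ⊖ u ∣ ≡ turánOrder k₁ x₁ (suc y₁)
    ∣A⊖u∣ = suc-injective (trans (∣⊖∣ u∈) (trans size₁ (starOrder-pred k₁ x₁ y₁)))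
    ∣A′∣≤ : ∣ A′ ∣ ≤ turánOrder k₁ x₁ (suc y₁)
    ∣A′∣≤ = ≤-trans (∣∣-mono A′⊆) (≤-reflexive ∣A⊖u∣)
    slA′ : StabilityAtMost A′ (x₁ + suc y₁)
    slA′ = subst (StabilityAtMost A′) (≡-sym (+-suc x₁ y₁)) (stabilityAtMost-mono (λ z∈ → proj₁ (∈∩ᵖ⁻ z∈)) (proj₂ hasA))
    ∣B∣≡ : ∣ B ∣ ≡ turánOrder k₂ x₂ (suc y₂)
    ∣B∣≡ = suc-injective (trans (∣⊖∣ c∈rest) (trans size₂ (starOrder-pred k₂ x₂ y₂)))
    slB : StabilityAtMost B (x₂ + suc y₂)
    slB = subst (StabilityAtMost B) (≡-sym (+-suc x₂ y₂)) (stabilityAtMost-mono (λ z∈ → proj₁ (∈⊖⁻ z∈)) (proj₂ hasD))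
    sepAB : Separated A B
    sepAB x∈ y∈ = separated-rest x∈ (proj₁ (∈⊖⁻ y∈)) (proj₂ (∈⊖⁻ y∈))
    W⊖c≡ : W ⊖ c ≡ A ∪ B
    W⊖c≡ = ⊆-ext to (λ z∈ → from (∪⁻ z∈))
      where
      to : ∀ {z} → z ∈ W ⊖ c → z ∈ A ∪ B
      to {z} z∈ with z ∈? A
      ... | yes z∈A = ∪ˡ z∈A
      ... | no z∉A = ∪ʳ (∈⊖⁺ (∈∖⁺ (proj₁ (∈⊖⁻ z∈)) z∉A) (proj₂ (∈⊖⁻ z∈)))
      from : ∀ {z} → z ∈ A ⊎ z ∈ B → z ∈ W ⊖ c
      from (inj₁ z∈) = ∈⊖⁺ (A⊆W z∈) (λ { refl → c∉A z∈ })
      from (inj₂ z∈) = ∈⊖⁺ (proj₁ (∈∖⁻ (proj₁ (∈⊖⁻ z∈)))) (proj₂ (∈⊖⁻ z∈))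
    W⊝c≡ : W ⊝ c ≡ A′ ∪ B′
    W⊝c≡ = ⊆-ext to (λ z∈ → from (∪⁻ z∈))
      where
      to : ∀ {z} → z ∈ W ⊝ c → z ∈ A′ ∪ B′
      to {z} z∈ with z ∈? A | ∈⊝⁻ z∈
      ... | yes z∈A | _ , _ , far = ∪ˡ (∈∩ᵖ⁺ z∈A (cong not far))
      ... | no z∉A | z∈W , ne , far = ∪ʳ (∈⊝⁺ (∈∖⁺ z∈W z∉A) ne far)
      from : ∀ {z} → z ∈ A′ ⊎ z ∈ B′ → z ∈ W ⊝ c
      from (inj₁ z∈) = ∈⊝⁺ (A⊆W (proj₁ (∈∩ᵖ⁻ z∈))) (λ { refl → c∉A (proj₁ (∈∩ᵖ⁻ z∈)) }) (not-true⁻ (proj₂ (∈∩ᵖ⁻ z∈)))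
      from (inj₂ z∈) = ∈⊝⁺ (proj₁ (∈∖⁻ (proj₁ (∈⊝⁻ z∈)))) (proj₁ (proj₂ (∈⊝⁻ z∈))) (proj₂ (proj₂ (∈⊝⁻ z∈)))
    F≡ : stableCount W ≡ stableCount A * stableCount B + stableCount A′ * stableCount B′
    F≡ = trans (stableCount-split c∈) (cong₂ _+_
      (trans (cong stableCount W⊖c≡) (stableCount-∪ (λ z∈ z∈B → proj₂ (∈∖⁻ (proj₁ (∈⊖⁻ z∈B))) z∈) sepAB))
      (trans (cong stableCount W⊝c≡) (stableCount-∪ (λ z∈ z∈B → proj₂ (∈∖⁻ (proj₁ (∈⊝⁻ z∈B))) (proj₁ (∈∩ᵖ⁻ z∈)))
        (λ z∈ w∈ → separated-rest (proj₁ (∈∩ᵖ⁻ z∈)) (proj₁ (∈⊝⁻ w∈)) (proj₁ (proj₂ (∈⊝⁻ w∈)))))))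
    bound : stableCount A * stableCount B + stableCount A′ * stableCount B′ ≤ turánStar k₁ x₁ y₁ * R + Q * balanced k₂ x₂ y₂ ×
      (stableCount A * stableCount B + stableCount A′ * stableCount B′ ≡ turánStar k₁ x₁ y₁ * R + Q * balanced k₂ x₂ y₂ →
        stableCount B ≡ R × stableCount A′ ≡ Q)
    bound = cut-arithmetic
      (IH k₁ x₁ y₁ A (subst (∣ A ∣ <_) ∣A∣+∣D∣ (m<m+n ∣ A ∣ (0<∣∣ c∈rest))) size₁ connected hasA)
      (stableCount-strict (λ z∈ → proj₁ (∈∩ᵖ⁻ z∈)) u∈ (λ u∈A′ → proj₂ (∈⊖⁻ (A′⊆ u∈A′)) refl))
      (subst (stableCount A′ ≤_) (balanced-sucʳ (suc k₁) x₁ y₁) (turán k₁ x₁ (suc y₁) A′ ∣A′∣≤ slA′))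
      (subst (stableCount B ≤_) (balanced-sucʳ (suc k₂) x₂ y₂) (turán k₂ x₂ (suc y₂) B (≤-reflexive ∣B∣≡) slB))
      (subst (_≤ turánStar k₂ x₂ y₂) (stableCount-split c∈rest)
        (IH k₂ x₂ y₂ D (subst (∣ D ∣ <_) ∣A∣+∣D∣ (m<n+m ∣ D ∣ (0<∣∣ u∈))) size₂ rest-connected hasD))
      (≤-trans (0<balanced k₁ x₁ y₁ r₁≤) (m≤n+m _ Q)) (0<* {suc k₁} (s≤s z≤n) (0<balanced-suc k₁ x₁ y₁))
      (0<* {suc k₂} (s≤s z≤n) (0<balanced-suc k₂ x₂ y₂)) (0<balanced k₂ x₂ y₂ r₂≤)
    merged = doubleStar-max k₁ x₁ y₁ k₂ x₂ y₂ k x y a≡ (trans (≡-sym size) (trans (≡-sym ∣A∣+∣D∣) (cong₂ _+_ size₁ size₂))) r₁≤ r₂≤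
    zero-sum : ∀ {r} → ¬ 1 ≤ r → r ≡ 0
    zero-sum {zero} _ = refl
    zero-sum {suc r} ¬pos = ⊥-elim (¬pos (s≤s z≤n))
    B-cluster : stableCount B ≡ R → Cluster B
    B-cluster e = proj₂ (turán-equality k₂ x₂ (suc y₂) B (≤-reflexive ∣B∣≡) slB (trans e (≡-sym (balanced-sucʳ (suc k₂) x₂ y₂))))
    -- Merging is strict unless one of the two stars has no leaves, that is, unless `A` or `D` is a
    -- clique. If `A` is, deleting `c` leaves a cluster. If `D` is, the order of `A′` shows that `u`
    -- is the only neighbour of `c` in `A`, and deleting `u` leaves a cluster.
    equality : stableCount A * stableCount B + stableCount A′ * stableCount B′ ≡ doubleStar k₁ x₁ y₁ k₂ x₂ y₂ →
      doubleStar k₁ x₁ y₁ k₂ x₂ y₂ ≡ turánStar k x y → AlmostCluster W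
    equality e₁ e₂ with 1 ≤? x₁ + y₁ | 1 ≤? x₂ + y₂
    ... | yes p | yes q = ⊥-elim (<-irrefl e₂ (proj₂ merged p q))
    ... | no p | _ = c , c∈ , subst Cluster (≡-sym W⊖c≡) (cluster-∪
          (clique-cluster (stability-one-clique (subst (λ r → StabilityAtMost A (suc r)) (zero-sum p) (proj₂ hasA))))
          (B-cluster (proj₁ (proj₂ bound e₁))) sepAB)
    ... | yes _ | no q = u , A⊆W u∈ , subst Cluster (≡-sym W⊖u≡) (cluster-∪ (proj₂ A′-extremal)
          (clique-cluster (stability-one-clique (subst (λ r → StabilityAtMost D (suc r)) (zero-sum q) (proj₂ hasD)))) sepA′D)
      where
      A′-extremal = turán-equality k₁ x₁ (suc y₁) A′ ∣A′∣≤ slA′ (trans (proj₂ (proj₂ bound e₁)) (≡-sym (balanced-sucʳ (suc k₁) x₁ y₁)))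
      sepA′D : Separated A′ D
      sepA′D {z} {w} z∈ w∈ with c Fin.≟ w
      ... | yes refl = ≁-sym (not-true⁻ (proj₂ (∈∩ᵖ⁻ z∈)))
      ... | no c≢w = separated-rest (proj₁ (∈∩ᵖ⁻ z∈)) w∈ c≢w
      ⊖u⊆A′ : ∀ {z} → z ∈ A ⊖ u → z ∈ A′
      ⊖u⊆A′ = ⊆-card-≡ A′⊆ (≤-reflexive (trans ∣A⊖u∣ (≡-sym (proj₁ A′-extremal))))
      W⊖u≡ : W ⊖ u ≡ A′ ∪ D
      W⊖u≡ = ⊆-ext to (λ z∈ → from (∪⁻ z∈))
        where
        to : ∀ {z} → z ∈ W ⊖ u → z ∈ A′ ∪ D
        to {z} z∈ with z ∈? A
        ... | yes z∈A = ∪ˡ (⊖u⊆A′ (∈⊖⁺ z∈A (proj₂ (∈⊖⁻ z∈))))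
        ... | no z∉A = ∪ʳ (∈∖⁺ (proj₁ (∈⊖⁻ z∈)) z∉A)
        from : ∀ {z} → z ∈ A′ ⊎ z ∈ D → z ∈ W ⊖ u
        from (inj₁ z∈) = ∈⊖⁺ (A⊆W (proj₁ (∈∩ᵖ⁻ z∈))) (proj₂ (∈⊖⁻ (A′⊆ z∈)))
        from (inj₂ z∈) = ∈⊖⁺ (proj₁ (∈∖⁻ z∈)) (λ { refl → proj₂ (∈∖⁻ z∈) u∈ })

  -- Connected graphs without a cut vertex.

  -- Deleting a vertex may lower the stability number; `turánStar-mono` then turns the bound for the
  -- smaller number into the one stated.
  boundedBelow-stabilityAtMost : ∀ {W k x y v} → BoundedBelow W → ∀ V → v ∈ V → ∣ V ∣ < ∣ W ∣ → ∣ V ∣ ≡ starOrder k x y → Connectedᵂ V →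
    StabilityAtMost V (suc (x + y)) → suc (x + y) ≤ starOrder k x y → stableCount V ≤ turánStar k x y
  boundedBelow-stabilityAtMost {W} {k} {x} {y} IH V v∈ lt size conn sl r≤ with stability-number V (suc (x + y)) sl
  ... | b , has@((S , S⊆ , st , S≡) , _) with parameters v∈ has
  ... | k′ , x′ , y′ , refl , size′ , _ with m≤n⇒∃[o]m+o≡n (≤-pred (subst (_≤ suc (x + y)) S≡ (sl S S⊆ st)))
  ... | d , d≡ = ≤-trans (IH k′ x′ y′ V lt size′ conn has)
      (turánStar-mono d k′ x′ y′ k x y d≡ (trans (≡-sym size′) size) r≤)

  record RegularExtremal (k y : ℕ) (W : Subset n) : Set where
    field
      1≤k : 1 ≤ k
      1≤y : 1 ≤ y
      order : ∣ W ∣ ≡ suc (k * suc y)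
      connected : Connectedᵂ W
      stability : StabilityAtMost W (suc y)
      regular : ∀ {w} → w ∈ W → deg W w ≡ k
      cluster : ∀ {w} → w ∈ W → Cluster (W ⊝ w)

  Bound : ℕ → ℕ → ℕ → Subset n → Set
  Bound k x y W = stableCount W ≤ turánStar k x y × (stableCount W ≡ turánStar k x y → AlmostCluster W ⊎ RegularExtremal k y W)

  clique-bound : ∀ {k x y W} → x + y ≡ 0 → ∣ W ∣ ≡ starOrder k x y → StabilityAtMost W (suc (x + y)) → Bound k x y W
  clique-bound {k} {zero} {zero} {W} _ size sl = ≤-reflexive (trans (stableCount-clique clique) (trans (cong suc size) (lem k))) ,
    λ _ → let (u , u∈) = 0<∣∣⁻ (subst (0 <_) (≡-sym (trans size (+-suc _ 0))) (s≤s z≤n)) in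
      inj₁ (u , u∈ , cluster-mono (λ x∈ → proj₁ (∈⊖⁻ x∈)) (clique-cluster clique))
    where
    clique : Clique W
    clique = stability-one-clique sl
    lem : ∀ k → suc (k * 1 + 1) ≡ suc k * 1 + 1
    lem = solve-∀

  edge-of-connected : ∀ {W} → Connectedᵂ W → 2 ≤ ∣ W ∣ → ∃ λ x → ∃ λ y → x ∈ W × y ∈ W × x ~ y
  edge-of-connected {W} conn 2≤ with 0<∣∣⁻ (≤-trans (s≤s z≤n) 2≤)
  ... | v , v∈ with 0<∣∣⁻ (≤-pred (subst (2 ≤_) (≡-sym (∣⊖∣ v∈)) 2≤))
  ... | w , w∈ with conn (W ⊖ v) (λ x∈ → proj₁ (∈⊖⁻ x∈)) (w , w∈) (v , ∈∖⁺ v∈ (λ v∈′ → proj₂ (∈⊖⁻ v∈′) refl))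
  ... | x , y , x∈ , y∈ , x~y = x , y , proj₁ (∈⊖⁻ x∈) , proj₁ (∈∖⁻ y∈) , x~y

  stability<order : ∀ {W a} → Connectedᵂ W → 2 ≤ ∣ W ∣ → HasStability W a → a < ∣ W ∣
  stability<order {W} {a} conn 2≤ has@((S , S⊆ , st , S≡) , _) = ≤∧≢⇒< (stability≤order has) λ a≡ →
    let (x , y , x∈ , y∈ , x~y) = edge-of-connected conn 2≤
        W⊆S : ∀ {z} → z ∈ W → z ∈ S
        W⊆S = ⊆-card-≡ S⊆ (≤-reflexive (trans (≡-sym a≡) (≡-sym S≡)))
    in true≢false x~y (st x y (W⊆S x∈) (W⊆S y∈))

  module NoCutVertex {W : Subset n} {j : ℕ} (IH : BoundedBelow W) (connected : Connectedᵂ W)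
    (noCut : ∀ {c} → c ∈ W → Connectedᵂ (W ⊖ c)) where

    private
      k = suc j

    ⊖-nonempty : ∀ {v x y} → v ∈ W → ∣ W ∣ ≡ starOrder k x y → Nonempty (W ⊖ v)
    ⊖-nonempty {v} {x} {y} v∈ size = 0<∣∣⁻ (≤-pred (subst (2 ≤_) (trans (≡-sym size) (≡-sym (∣⊖∣ v∈))) (+-mono-≤ {1} {k * suc (x + y)} (s≤s z≤n) (s≤s {0} {x} z≤n))))

    ⊖-smaller : ∀ {v} → v ∈ W → ∣ W ⊖ v ∣ < ∣ W ∣
    ⊖-smaller v∈ = ≤-reflexive (∣⊖∣ v∈)

    ⊖-bound-suc : ∀ {x y v} → ∣ W ∣ ≡ starOrder k (suc x) y → StabilityAtMost W (suc (suc x + y)) → v ∈ W → stableCount (W ⊖ v) ≤ turánStar k x (suc y)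
    ⊖-bound-suc {x} {y} {v} size sl v∈ = boundedBelow-stabilityAtMost {W} {k} {x} {suc y} IH (W ⊖ v)
      (proj₂ (⊖-nonempty {x = suc x} {y} v∈ size)) (⊖-smaller v∈) (suc-injective (trans (∣⊖∣ v∈) (trans size (lem j x y)))) (noCut v∈)
      (subst (λ r → StabilityAtMost (W ⊖ v) (suc r)) (≡-sym (+-suc x y)) (stabilityAtMost-mono (λ x∈ → proj₁ (∈⊖⁻ x∈)) sl))
      (≤-via (j * suc (x + suc y) + suc x) (+-assoc (suc (x + suc y)) _ _))
      where
      lem : ∀ j x y → suc j * suc (suc x + y) + suc (suc x) ≡ suc (suc j * suc (x + suc y) + suc x)
      lem = solve-∀

    ⊖-bound-zero : ∀ {y v} → ∣ W ∣ ≡ starOrder k 0 y → StabilityAtMost W (suc y) → v ∈ W → stableCount (W ⊖ v) ≤ turánStar j y 0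
    ⊖-bound-zero {y} {v} size sl v∈ = boundedBelow-stabilityAtMost {W} {j} {y} {0} IH (W ⊖ v)
      (proj₂ (⊖-nonempty {x = 0} {y} v∈ size)) (⊖-smaller v∈) (suc-injective (trans (∣⊖∣ v∈) (trans size (lem j y)))) (noCut v∈)
      (subst (λ r → StabilityAtMost (W ⊖ v) (suc r)) (≡-sym (+-identityʳ y)) (stabilityAtMost-mono (λ x∈ → proj₁ (∈⊖⁻ x∈)) sl))
      (subst (λ r → suc r ≤ j * suc r + suc y) (≡-sym (+-identityʳ y)) (m≤n+m (suc y) (j * suc y)))
      where
      lem : ∀ j y → suc j * suc (0 + y) + 1 ≡ suc (j * suc (y + 0) + suc y)
      lem = solve-∀

    -- Deleting `N[v]` removes at least `k + 2` vertices, one more than degree `k` would, which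
    -- lowers the Turán bound for the remainder. For `x = 0` both pieces are measured with the
    -- quotient `j = k - 1`.
    high-degree-strict : ∀ {x y v} → 1 ≤ x + y → ∣ W ∣ ≡ starOrder k x y → StabilityAtMost W (suc (x + y)) → v ∈ W → suc k ≤ deg W v →
      stableCount W < turánStar k x y
    high-degree-strict {suc x} {y} {v} _ size sl v∈ d = begin-strict
      stableCount W
        ≡⟨ stableCount-split v∈ ⟩
      stableCount (W ⊖ v) + stableCount (W ⊝ v)
        ≤⟨ +-mono-≤ (⊖-bound-suc {x} {y} size sl v∈) (turán k x (suc y) (W ⊝ v) (∣⊝∣≤ v∈ (≤-reflexive (trans size (lem₁ k x y))) d)
             (subst (StabilityAtMost (W ⊝ v)) (≡-sym (+-suc x y)) (stabilityAtMost-⊝ v∈ sl))) ⟩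
      turánStar k x (suc y) + balanced (suc k) x (suc y)
        <⟨ m<m+n _ (0<balanced-suc j x y) ⟩
      turánStar k x (suc y) + balanced (suc k) x (suc y) + balanced k x y
        ≡⟨ lem₂ k (suc (suc k) ^ x) (suc k ^ y) (suc k ^ x) (k ^ y) ⟩
      turánStar k (suc x) y ∎
      where
      open ≤-Reasoning
      lem₁ : ∀ k x y → k * suc (suc x + y) + suc (suc x) ≡ suc (suc k) + (k * (x + suc y) + x)
      lem₁ = solve-∀
      lem₂ : ∀ k a b c d → suc k * (a * (suc k * b)) + c * (k * d) + a * (suc k * b) + c * d ≡ suc k * (suc (suc k) * a * b) + suc k * c * d
      lem₂ = solve-∀
    high-degree-strict {zero} {suc y} {v} _ size sl v∈ d = begin-strict
      stableCount W
        ≡⟨ stableCount-split v∈ ⟩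
      stableCount (W ⊖ v) + stableCount (W ⊝ v)
        ≤⟨ +-mono-≤ (⊖-bound-zero {suc y} size sl v∈) (turán j y 1 (W ⊝ v) (∣⊝∣≤ v∈ (≤-reflexive (trans size (lem₁ j y))) d)
             (subst (StabilityAtMost (W ⊝ v)) (≡-sym (+-comm y 1)) (stabilityAtMost-⊝ v∈ sl))) ⟩
      turánStar j (suc y) 0 + balanced (suc j) y 1
        <⟨ m<m+n _ (0<^ k y) ⟩
      turánStar j (suc y) 0 + balanced (suc j) y 1 + suc k ^ y
        ≡⟨ lem₂ k (suc k ^ y) (k ^ y) ⟩
      turánStar k 0 (suc y) ∎
      where
      open ≤-Reasoning
      lem₁ : ∀ j y → suc j * suc (0 + suc y) + 1 ≡ suc (suc (suc j)) + (j * (y + 1) + y)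
      lem₁ = solve-∀
      lem₂ : ∀ k a b → k * (suc k * a * 1) + k * b * 1 + a * (k * 1) + a ≡ suc k * (1 * (suc k * a)) + 1 * (k * b)
      lem₂ = solve-∀

    module LowDegree {x y} (size : ∣ W ∣ ≡ starOrder k x y) (sl : StabilityAtMost W (suc (x + y))) (low : ∀ {v} → v ∈ W → deg W v ≤ k) where

      -- By connectivity some edge leaves `U`; it costs its end in `U` one of at most `k`
      -- neighbours.
      boundary : ∀ U → (∀ {z} → z ∈ U → z ∈ W) → Nonempty U → Nonempty (W ∖ U) → ∃ λ z → z ∈ U × deg U z < k
      boundary U U⊆ ne ne′ with connected U U⊆ ne ne′
      ... | a , b , a∈ , b∈ , a~b = a , a∈ , <-≤-trans (subst (deg U a <_) (∣⊖∣ b∈N) (s≤s (∣∣-mono λ z∈ →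
             ∈⊖⁺ (∈∩ᵖ⁺ (U⊆ (proj₁ (∈∩ᵖ⁻ z∈))) (proj₂ (∈∩ᵖ⁻ z∈))) (λ { refl → proj₂ (∈∖⁻ b∈) (proj₁ (∈∩ᵖ⁻ z∈)) })))) (low (U⊆ a∈))
        where
        b∈N : b ∈ neighbours W a
        b∈N = ∈∩ᵖ⁺ (proj₁ (∈∖⁻ b∈)) a~b

      -- Every nonempty subset of `W ⊖ u` is proper in `W`, so by `boundary` greedy deletion applies
      -- and `W ⊖ u` has at most `k * suc (x + y)` vertices, whereas its order is that number plus
      -- `x`.
      x≡0 : x ≡ 0
      x≡0 with 0<∣∣⁻ {p = W} (subst (0 <_) (≡-sym size) (≤-trans (s≤s z≤n) (m≤n+m (suc x) (k * suc (x + y)))))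
      ... | u , u∈ = n≤0⇒n≡0 (+-cancelˡ-≤ (k * suc (x + y)) x 0 (begin
        k * suc (x + y) + x ≡⟨ suc-injective (trans (≡-sym (+-suc _ x)) (trans (≡-sym size) (≡-sym (∣⊖∣ u∈)))) ⟩
        ∣ W ⊖ u ∣           ≤⟨ greedy k (suc (x + y)) (W ⊖ u)
                                 (λ U U⊆ ne → boundary U (λ z∈ → proj₁ (∈⊖⁻ (U⊆ z∈))) ne (u , ∈∖⁺ u∈ (λ u∈U → proj₂ (∈⊖⁻ (U⊆ u∈U)) refl)))
                                 (stabilityAtMost-mono (λ z∈ → proj₁ (∈⊖⁻ z∈)) sl) ⟩
        k * suc (x + y)     ≡⟨ ≡-sym (+-identityʳ _) ⟩
        k * suc (x + y) + 0 ∎))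
        where open ≤-Reasoning

      -- A vertex of degree below `k` serves the one subset that `boundary` leaves out, `W` itself;
      -- greedy deletion would then bound the order of `W` by `k * suc (x + y)`.
      regular : ∀ {w} → w ∈ W → deg W w ≡ k
      regular {w} w∈ with m≤n⇒m<n∨m≡n (low w∈)
      ... | inj₂ eq = eq
      ... | inj₁ lt = ⊥-elim (<⇒≱ (m<m+n (k * suc (x + y)) (s≤s z≤n)) (subst (_≤ k * suc (x + y)) size
          (greedy k (suc (x + y)) W choose sl)))
        where
        choose : ∀ U → (∀ {z} → z ∈ U → z ∈ W) → Nonempty U → ∃ λ z → z ∈ U × deg U z < k
        choose U U⊆ ne with nonempty-or-empty (W ∖ U)
        ... | inj₁ ne′ = boundary U U⊆ ne ne′
        ... | inj₂ e with w ∈? U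
        ... | yes w∈U = w , w∈U , ≤-<-trans (deg-mono U⊆) lt
        ... | no w∉U = ⊥-elim (e (∈∖⁺ w∈ w∉U))

    regular-bound : ∀ {y} → 1 ≤ y → ∣ W ∣ ≡ starOrder k 0 y → StabilityAtMost W (suc y) → (∀ {w} → w ∈ W → deg W w ≡ k) → Bound k 0 y W
    regular-bound {y} 1≤y size sl reg with 0<∣∣⁻ {p = W} (subst (0 <_) (≡-sym size) (≤-trans (s≤s z≤n) (m≤n+m 1 (k * suc y))))
    ... | u , u∈ = subst₂ _≤_ (≡-sym (stableCount-split u∈)) total (+-mono-≤ (⊖-bound-zero {y} size sl u∈) (⊝-bound u∈)) ,
      λ eq → inj₂ record { 1≤k = s≤s z≤n ; 1≤y = 1≤y ; order = trans size (+-comm _ 1) ; connected = connected ; stability = sl ; regular = reg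
                         ; cluster = λ w∈ → proj₂ (turán-equality k 0 y _ (⊝-size w∈) (⊝-stab w∈)
                             (proj₂ (+-≤-≡ (⊖-bound-zero {y} size sl w∈) (⊝-bound w∈) (trans (≡-sym (stableCount-split w∈)) (trans eq (≡-sym total)))))) }
      where
      lem : ∀ k a b → k * (a * 1) + b * 1 + 1 * a ≡ suc k * (1 * a) + 1 * b
      lem = solve-∀
      total : turánStar j y 0 + balanced (suc k) 0 y ≡ turánStar k 0 y
      total = lem k (suc k ^ y) (k ^ y)
      lem₁ : ∀ k y → k * suc (0 + y) + 1 ≡ suc k + (k * (0 + y) + 0)
      lem₁ = solve-∀
      ⊝-size : ∀ {w} → w ∈ W → ∣ W ⊝ w ∣ ≤ turánOrder k 0 y
      ⊝-size w∈ = ∣⊝∣≤ w∈ (≤-reflexive (trans size (lem₁ k y))) (≤-reflexive (≡-sym (reg w∈)))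
      ⊝-stab : ∀ {w} → w ∈ W → StabilityAtMost (W ⊝ w) y
      ⊝-stab w∈ = stabilityAtMost-⊝ w∈ sl
      ⊝-bound : ∀ {w} → w ∈ W → stableCount (W ⊝ w) ≤ balanced (suc k) 0 y
      ⊝-bound w∈ = turán k 0 y _ (⊝-size w∈) (⊝-stab w∈)

    noCut-bound : ∀ {x y} → 1 ≤ x + y → ∣ W ∣ ≡ starOrder k x y → StabilityAtMost W (suc (x + y)) → Bound k x y W
    noCut-bound {x} {y} 1≤ size sl with Fin.any? (λ v → (v ∈? W) ×-dec (suc k ≤? deg W v))
    ... | yes (v , v∈ , d) = <⇒≤ lt , λ eq → ⊥-elim (<-irrefl eq lt)
      where lt = high-degree-strict {x} {y} 1≤ size sl v∈ d
    ... | no ¬p = go {x} x≡0 size sl regular 1≤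
      where
      open LowDegree {x} {y} size sl (λ {v} v∈ → ≤-pred (≰⇒> λ d → ¬p (v , v∈ , d)))
      go : ∀ {x} → x ≡ 0 → ∣ W ∣ ≡ starOrder k x y → StabilityAtMost W (suc (x + y)) → (∀ {w} → w ∈ W → deg W w ≡ k) → 1 ≤ x + y → Bound k x y W
      go refl size sl reg 1≤ = regular-bound {y} 1≤ size sl reg

  connected-step : ∀ W → BoundedBelow W → ∀ k x y → ∣ W ∣ ≡ starOrder k x y → Connectedᵂ W → HasStability W (suc (x + y)) → Bound k x y W
  connected-step W IH k x y size conn has
    with Fin.any? (λ c → (c ∈? W) ×-dec anySubset? (closed? (W ⊖ c)))
  ... | yes (c , c∈ , U , clU) = proj₁ bound , λ eq → inj₁ (proj₂ bound eq)
    where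
    bound = cut-bound {k} {x} {y} c∈ conn clU size has IH
  ... | no ¬cut with 1 ≤? x + y
  ... | no ¬pos = clique-bound {k} {x} {y} (n<1⇒n≡0 (≰⇒> ¬pos)) size (proj₂ has)
  ... | yes pos = go k size
    where
    noCut : ∀ {c} → c ∈ W → Connectedᵂ (W ⊖ c)
    noCut {c} c∈ with closed-or-connected (W ⊖ c)
    ... | inj₁ (U , cl) = ⊥-elim (¬cut (c , c∈ , U , cl))
    ... | inj₂ conn′ = conn′
    go : ∀ k → ∣ W ∣ ≡ starOrder k x y → Bound k x y W
    -- Quotient 0 means order `x + 1`, at most the stability number `x + y + 1`, but a connected
    -- graph on at least two vertices has more vertices than that number.
    go zero size = ⊥-elim (<⇒≱ (stability<order conn (≤-trans (s≤s pos) (stability≤order has)) has)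
      (≤-trans (≤-reflexive size) (s≤s (m≤m+n x y))))
    go (suc j) size = NoCutVertex.noCut-bound {W} {j} IH conn noCut {x} {y} pos size (proj₂ has)

  connected-bound : ∀ m W → ∣ W ∣ ≤ m → ∀ k x y → ∣ W ∣ ≡ starOrder k x y → Connectedᵂ W → HasStability W (suc (x + y)) → Bound k x y W
  connected-bound zero W le k x y size conn has = ⊥-elim (<⇒≱ (subst (0 <_) (trans (≡-sym (+-suc _ x)) (≡-sym size)) (s≤s z≤n)) le)
  connected-bound (suc m) W le = connected-step W λ k x y V lt size conn has →
    proj₁ (connected-bound m V (≤-pred (≤-trans lt le)) k x y size conn has)

  -- The regular extremal graphs: only the pentagon.

  InducedPath : Subset n → Set
  InducedPath W = ∃ λ w → ∃ λ y → ∃ λ x → w ∈ W × y ∈ W × x ∈ W × w ~ y × y ~ x × w ≢ x × w ≁ x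

  -- Without such a path `W` is a connected cluster, hence one closed neighbourhood of order
  -- `k + 1`, which is less than `k * suc y + 1`.
  induced-path : ∀ {k y W} → RegularExtremal k y W → InducedPath W
  induced-path {k} {y} {W} ext with Fin.any? (λ w → Fin.any? λ y → Fin.any? λ x → (w ∈? W) ×-dec ((y ∈? W) ×-dec ((x ∈? W) ×-dec
      ((adj G w y Bool.≟ true) ×-dec ((adj G y x Bool.≟ true) ×-dec (¬? (w Fin.≟ x) ×-dec (adj G w x Bool.≟ false)))))))
  ... | yes p = p
  ... | no ¬p = ⊥-elim (impossible (0<∣∣⁻ (subst (0 <_) (≡-sym order) (s≤s z≤n))))
    where
    open RegularExtremal ext
    W-cluster : Cluster W
    W-cluster {a} {b} {c} a∈ b∈ c∈ a~b b~c a≢c with ~-or-≁ a c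
    ... | inj₁ e = e
    ... | inj₂ e = ⊥-elim (¬p (a , b , c , a∈ , b∈ , c∈ , a~b , b~c , a≢c , e))
    impossible : Nonempty W → ⊥
    impossible (v , v∈) with closed-isolated W-cluster v∈
    ... | Q⊆ , ne , _ , sep with nonempty-or-empty (W ∖ closedNeighbourhood W v)
    ... | inj₁ ne′ = let (a , b , a∈ , b∈ , a~b) = connected _ Q⊆ ne ne′ in true≢false a~b (sep a∈ b∈)
    ... | inj₂ e = <⇒≱ (s≤s (k<k*2 1≤k 1≤y)) (≤-trans (≤-reflexive (≡-sym order)) (≤-trans (∣∣-mono {p = W} {closedNeighbourhood W v} all)
          (≤-reflexive (trans (∣closed∣ v∈) (cong suc (regular v∈))))))
      where
      all : ∀ {z} → z ∈ W → z ∈ closedNeighbourhood W v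
      all {z} z∈ with z ∈? closedNeighbourhood W v
      ... | yes z∈Q = z∈Q
      ... | no z∉Q = ⊥-elim (e (∈∖⁺ z∈ z∉Q))
      k<k*2 : ∀ {k y} → 1 ≤ k → 1 ≤ y → k < k * suc y
      k<k*2 {suc k} {suc y} _ _ = <-via (y + k * suc y) (lem k y)
        where lem : ∀ k y → suc k * suc (suc y) ≡ suc k + suc (y + k * suc y)
              lem = solve-∀

  -- A path missing some closed neighbourhood N[z] would be an induced path in the cluster W ⊝ z.
  path-dominates : ∀ {k y W w v x z} → RegularExtremal k y W → w ∈ W → v ∈ W → x ∈ W → w ~ v → v ~ x → w ≢ x → w ≁ x →
    z ∈ W → z ≢ w → z ≢ v → z ≢ x → z ≁ w → z ≁ v → z ~ x
  path-dominates {x = x} {z} ext w∈ v∈ x∈ w~v v~x w≢x w≁x z∈ z≢w z≢v z≢x z≁w z≁v with ~-or-≁ z x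
  ... | inj₁ e = e
  ... | inj₂ z≁x = true≢false (RegularExtremal.cluster ext z∈ (∈⊝⁺ w∈ z≢w z≁w) (∈⊝⁺ v∈ z≢v z≁v) (∈⊝⁺ x∈ z≢x z≁x) w~v v~x w≢x) w≁x

  record Pentagon (W : Subset n) : Set where
    field
      v w p q x : Fin n
      v~w : v ~ w
      w~p : w ~ p
      p~q : p ~ q
      q~x : q ~ x
      x~v : x ~ v
      v≁p : v ≁ p
      v≁q : v ≁ q
      w≁q : w ≁ q
      w≁x : w ≁ x
      p≁x : p ≁ x
      order : ∣ W ∣ ≡ 5

  module FromPath {k y W w v x} (ext : RegularExtremal k y W) (w∈ : w ∈ W) (v∈ : v ∈ W) (x∈ : x ∈ W)
    (w~v : w ~ v) (v~x : v ~ x) (w≢x : w ≢ x) (w≁x : w ≁ x) where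

    open RegularExtremal ext

    private
      v∈Nx : v ∈ neighbours W x
      v∈Nx = ∈∩ᵖ⁺ v∈ (~-sym v~x)

    -- W ⊝ w ⊝ x lies in N(v), which also contains w and x.
    far-small : suc (suc ∣ W ⊝ w ⊝ x ∣) ≤ k
    far-small = ≤-trans (s≤s (s≤s (∣∣-mono {p = W ⊝ w ⊝ x} {neighbours W v ⊖ w ⊖ x} far)))
      (≤-reflexive (trans (cong suc (∣⊖∣ (∈⊖⁺ (∈∩ᵖ⁺ x∈ v~x) w≢x))) (trans (∣⊖∣ (∈∩ᵖ⁺ w∈ (~-sym w~v))) (regular v∈))))
      where
      far : ∀ {z} → z ∈ W ⊝ w ⊝ x → z ∈ neighbours W v ⊖ w ⊖ x
      far {z} z∈ with ∈⊝⁻ z∈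
      ... | z∈′ , x≢z , x≁z with ∈⊝⁻ z∈′
      ... | z∈W , w≢z , w≁z = ∈⊖⁺ (∈⊖⁺ (∈∩ᵖ⁺ z∈W (near (~-or-≁ v z))) w≢z) x≢z
        where
        near : v ~ z ⊎ v ≁ z → v ~ z
        near (inj₁ e) = e
        near (inj₂ e) = true≢false (path-dominates ext w∈ v∈ x∈ w~v v~x w≢x w≁x z∈W (w≢z ∘ ≡-sym)
          (λ { refl → true≢false w~v w≁z }) (x≢z ∘ ≡-sym) (≁-sym w≁z) (≁-sym e)) (≁-sym x≁z)

    x∈⊝w : x ∈ W ⊝ w
    x∈⊝w = ∈⊝⁺ x∈ w≢x w≁x

    deg-x : suc (deg (W ⊝ w) x) ≤ k
    deg-x = ≤-trans (s≤s (∣∣-mono {p = neighbours (W ⊝ w) x} {neighbours W x ⊖ v} λ z∈ →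
        ∈⊖⁺ (∈∩ᵖ⁺ (proj₁ (∈⊝⁻ (proj₁ (∈∩ᵖ⁻ z∈)))) (proj₂ (∈∩ᵖ⁻ z∈))) (λ { refl → true≢false w~v (proj₂ (proj₂ (∈⊝⁻ (proj₁ (∈∩ᵖ⁻ z∈))))) })))
      (≤-reflexive (trans (∣⊖∣ v∈Nx) (regular x∈)))

    ∣⊝∣≡ : ∀ {u} → u ∈ W → ∣ W ⊝ u ∣ ≡ k * y
    ∣⊝∣≡ {u} u∈ = +-cancelʳ-≡ (suc k) _ _ (trans (trans (cong (λ d → ∣ W ⊝ u ∣ + suc d) (≡-sym (regular u∈))) (∣⊝∣ u∈)) (trans order (lem k y)))
      where lem : ∀ k y → suc (k * suc y) ≡ k * y + suc k
            lem = solve-∀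

    -- The `k * y` vertices of `W ⊝ w` split into `W ⊝ w ⊝ x` and the closed neighbourhood of `x`
    -- there. These have at most `k - 2` and `k` vertices, so `k * y < k * 2`.
    y≡1 : y ≡ 1
    y≡1 = ≤-antisym (≤-pred (*-cancelˡ-< k y 2 (begin-strict
      k * y                                        ≡⟨ ≡-sym (∣⊝∣≡ w∈) ⟩
      ∣ W ⊝ w ∣                                    ≡⟨ ≡-sym (∣⊝∣ x∈⊝w) ⟩
      ∣ W ⊝ w ⊝ x ∣ + suc (deg (W ⊝ w) x)          <⟨ +-mono-<-≤ (≤-trans (s≤s (n≤1+n _)) far-small) deg-x ⟩
      k + k                                        ≡⟨ lem k ⟩
      k * 2                                        ∎))) 1≤y
      where open ≤-Reasoning
            lem : ∀ k → k + k ≡ k * 2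
            lem = solve-∀

    ⊝-clique : ∀ {u} → u ∈ W → Clique (W ⊝ u)
    ⊝-clique u∈ = stability-one-clique (subst (StabilityAtMost _) y≡1 (stabilityAtMost-⊝ u∈ stability))

    ∣⊝∣≡k : ∀ {u} → u ∈ W → ∣ W ⊝ u ∣ ≡ k
    ∣⊝∣≡k u∈ = trans (∣⊝∣≡ u∈) (trans (cong (k *_) y≡1) (*-identityʳ k))

    -- Since `W ⊝ a` is a clique of order `k` containing `b`, it holds `k - 1` of the `k` neighbours
    -- of `b`; only one is left to be adjacent to `a`.
    unique-common : ∀ {a b c d} → a ∈ W → b ∈ W → a ≢ b → a ≁ b → c ∈ W → d ∈ W → a ~ c → b ~ c → a ~ d → b ~ d → c ≡ d
    unique-common {a} {b} a∈ b∈ a≢b a≁b c∈ d∈ ac bc ad bd = ∣∣≤1⇒≡ {p = neighbours W b ∩ᵖ adj G a}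
      (+-cancelʳ-≤ ∣ W ⊝ a ⊖ b ∣ _ _ (begin
        ∣ neighbours W b ∩ᵖ adj G a ∣ + ∣ W ⊝ a ⊖ b ∣
          ≤⟨ +-monoʳ-≤ _ (∣∣-mono {q = neighbours W b ∩ᵖ (not ∘ adj G a)} λ z∈ → let (p , b≢z) = ∈⊖⁻ z∈ ; (z∈W , _ , a≁z) = ∈⊝⁻ p in
               ∈∩ᵖ⁺ (∈∩ᵖ⁺ z∈W (⊝-clique a∈ b∈⊝a p b≢z)) (cong not a≁z)) ⟩
        ∣ neighbours W b ∩ᵖ adj G a ∣ + ∣ neighbours W b ∩ᵖ (not ∘ adj G a) ∣
          ≡⟨ ∣∩ᵖ∣-split (neighbours W b) (adj G a) ⟩
        deg W b
          ≡⟨ trans (regular b∈) (≡-sym (∣⊝∣≡k a∈)) ⟩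
        ∣ W ⊝ a ∣
          ≡⟨ ≡-sym (∣⊖∣ b∈⊝a) ⟩
        1 + ∣ W ⊝ a ⊖ b ∣ ∎))
      (∈∩ᵖ⁺ (∈∩ᵖ⁺ c∈ bc) ac) (∈∩ᵖ⁺ (∈∩ᵖ⁺ d∈ bd) ad)
      where
      open ≤-Reasoning
      b∈⊝a : b ∈ W ⊝ a
      b∈⊝a = ∈⊝⁺ b∈ a≢b a≁b

    -- N(u) ∖ {v} is too small to contain the k nonneighbours of v.
    missed : ∀ {u} → u ∈ W → u ~ v → ∃ λ z → z ∈ W ⊝ v × u ≁ z
    missed {u} u∈ u~v with nonempty-or-empty ((W ⊝ v) ∩ᵖ (not ∘ adj G u))
    ... | inj₁ (z , z∈) = z , proj₁ (∈∩ᵖ⁻ z∈) , not-true⁻ (proj₂ (∈∩ᵖ⁻ z∈))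
    ... | inj₂ e = ⊥-elim (<⇒≱ (s≤s (≤-reflexive (≡-sym (∣⊝∣≡k v∈)))) (≤-trans (s≤s (∣∣-mono {p = W ⊝ v} {neighbours W u ⊖ v} sub))
          (≤-reflexive (trans (∣⊖∣ (∈∩ᵖ⁺ v∈ u~v)) (regular u∈)))))
      where
      sub : ∀ {z} → z ∈ W ⊝ v → z ∈ neighbours W u ⊖ v
      sub {z} z∈ with ~-or-≁ u z
      ... | inj₁ u~z = ∈⊖⁺ (∈∩ᵖ⁺ (proj₁ (∈⊝⁻ z∈)) u~z) (proj₁ (proj₂ (∈⊝⁻ z∈)))
      ... | inj₂ u≁z = ⊥-elim (e (∈∩ᵖ⁺ z∈ (cong not u≁z)))

    near-end : ∀ {z} → z ∈ W ⊝ v → w ≁ z → x ~ z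
    near-end {z} z∈ w≁z with ∈⊝⁻ z∈
    ... | z∈W , v≢z , v≁z = ~-sym (path-dominates ext w∈ v∈ x∈ w~v v~x w≢x w≁x z∈W (λ { refl → true≢false (~-sym w~v) v≁z }) (v≢z ∘ ≡-sym)
          (λ { refl → true≢false v~x v≁z }) (≁-sym w≁z) (≁-sym v≁z))

    near-start : ∀ {z} → z ∈ W ⊝ v → x ≁ z → w ~ z
    near-start {z} z∈ x≁z with ~-or-≁ w z
    ... | inj₁ e = e
    ... | inj₂ e = true≢false (near-end z∈ e) x≁z

    -- In the clique `W ⊝ v`, `q` is missed by `w` and `p` is missed by `x`. A third vertex there
    -- would be a second common neighbour either of the nonadjacent `w` and `q` or of the
    -- nonadjacent `x` and `p`. So `k`, the order of this clique, is 2.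
    pentagon : Pentagon W × k ≡ 2 × y ≡ 1
    pentagon with missed w∈ w~v | missed x∈ (~-sym v~x)
    ... | q , q∈ , w≁q | p , p∈ , x≁p = record
        { v = v ; w = w ; p = p ; q = q ; x = x ; v~w = ~-sym w~v ; w~p = w~p ; p~q = p~q ; q~x = ~-sym x~q ; x~v = ~-sym v~x
        ; v≁p = proj₂ (proj₂ (∈⊝⁻ p∈)) ; v≁q = proj₂ (proj₂ (∈⊝⁻ q∈)) ; w≁q = w≁q ; w≁x = w≁x ; p≁x = ≁-sym x≁p
        ; order = trans order (cong₂ (λ k y → suc (k * suc y)) k≡2 y≡1) } , k≡2 , y≡1
      where
      w~p = near-start p∈ x≁p
      x~q = near-end q∈ w≁q
      p≢q : p ≢ q
      p≢q refl = true≢false w~p w≁q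
      p~q = ⊝-clique v∈ p∈ q∈ p≢q
      pW = proj₁ (∈⊝⁻ p∈)
      qW = proj₁ (∈⊝⁻ q∈)
      no-third : ∀ {z} → z ∉ W ⊝ v ⊖ p ⊖ q
      no-third {z} z∈ with ∈⊖⁻ z∈
      ... | z∈′ , q≢z with ∈⊖⁻ z∈′
      ... | z∈K , p≢z with ~-or-≁ w z
      ... | inj₁ w~z = p≢z (unique-common w∈ qW (λ { refl → true≢false (~-sym w~v) (proj₂ (proj₂ (∈⊝⁻ q∈))) }) w≁q pW (proj₁ (∈⊝⁻ z∈K)) w~p (~-sym p~q) w~z (⊝-clique v∈ q∈ z∈K q≢z))
      ... | inj₂ w≁z = q≢z (unique-common x∈ pW (λ { refl → true≢false v~x (proj₂ (proj₂ (∈⊝⁻ p∈))) }) x≁p qW (proj₁ (∈⊝⁻ z∈K)) x~q p~q (near-end z∈K w≁z) (⊝-clique v∈ p∈ z∈K p≢z))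
      k≡2 : k ≡ 2
      k≡2 = trans (≡-sym (∣⊝∣≡k v∈)) (trans (≡-sym (∣⊖∣ p∈)) (cong suc (trans (≡-sym (∣⊖∣ (∈⊖⁺ q∈ p≢q))) (cong suc (∣∣≡0 no-third)))))

  -- From a layout of the vertices to an isomorphism with `TC`.

  -- A certificate for being `TC` with `r + 1` classes. `rep` marks the vertex of each class that
  -- may carry edges to other classes. Class orders are bounded only from above: an injective
  -- labelling below `n` is bijective by finiteness.
  record StarLayout (r k x : ℕ) : Set where
    field
      centre : Fin n
      class : Fin n → ℕ
      rep : Fin n → Bool
      class≤ : ∀ v → class v ≤ r
      centre-class : class centre ≡ 0
      centre-rep : rep centre ≡ true
      rep-unique : ∀ {v w} → rep v ≡ true → rep w ≡ true → class v ≡ class w → v ≡ w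
      rep-exists : ∀ v → ∃ λ w → rep w ≡ true × class w ≡ class v
      same-class : ∀ {v w} → class v ≡ class w → v ≢ w → v ~ w
      other-class : ∀ {v w} → class v ≢ class w → v ~ w → (v ≡ centre × rep w ≡ true) ⊎ (w ≡ centre × rep v ≡ true)
      centre-adj : ∀ {w} → rep w ≡ true → w ≢ centre → centre ~ w
      order≤ : ∀ j → ∣ full ∩ᵖ (λ z → class z ≡ᵇ j) ∣ ≤ suc k
      small-order≤ : ∀ j → x < j → ∣ full ∩ᵖ (λ z → class z ≡ᵇ j) ∣ ≤ k

    classSet : Fin n → Subset n
    classSet v = full ∩ᵖ (λ z → class z ≡ᵇ class v)

    ∈classSet : ∀ {v z} → class z ≡ class v → z ∈ classSet v
    ∈classSet e = ∈∩ᵖ⁺ ∈⊤ (≡ᵇ-true e)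

    ∈classSet⁻ : ∀ {v z} → z ∈ classSet v → class z ≡ class v
    ∈classSet⁻ z∈ = ≡ᵇ-true⁻ (proj₂ (∈∩ᵖ⁻ z∈))

    earlier : Fin n → Subset n
    earlier v = classSet v ∩ᵖ (λ z → not (rep z) ∧ (toℕ z <ᵇ toℕ v))

    ∈earlier⁻ : ∀ {v z} → z ∈ earlier v → z ∈ classSet v × rep z ≡ false × toℕ z < toℕ v
    ∈earlier⁻ {v} {z} z∈ with ∈∩ᵖ⁻ z∈
    ... | a , b with ∧⁻ {not (rep z)} b
    ... | c , d = a , not-true⁻ c , <ᵇ-true⁻ d

    ∈earlier⁺ : ∀ {v z} → class z ≡ class v → rep z ≡ false → toℕ z < toℕ v → z ∈ earlier v
    ∈earlier⁺ c e lt = ∈∩ᵖ⁺ (∈classSet c) (cong₂ _∧_ (cong not e) (<ᵇ-true lt))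

    -- Representatives come first in their class, so the labels up to `r` go exactly to them, as to
    -- the vertices that `TC` joins to its vertex 0.
    rank : Fin n → ℕ
    rank v = if rep v then 0 else suc ∣ earlier v ∣

    rank-rep : ∀ {v} → rep v ≡ true → rank v ≡ 0
    rank-rep e rewrite e = refl

    rank-nonrep : ∀ {v} → rep v ≡ false → rank v ≡ suc ∣ earlier v ∣
    rank-nonrep e rewrite e = refl

    rank-zero : ∀ {v} → rank v ≡ 0 → rep v ≡ true
    rank-zero {v} e with rep v
    ... | true = refl
    rank-zero () | false

    rank< : ∀ v → rank v < ∣ classSet v ∣
    rank< v with bool-cases (rep v)
    ... | inj₁ e = subst (_< ∣ classSet v ∣) (≡-sym (rank-rep e)) (0<∣∣ (∈classSet {v} refl))
    ... | inj₂ e with rep-exists v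
    ... | w , rw , cw = begin-strict
      rank v                          ≡⟨ rank-nonrep e ⟩
      suc ∣ earlier v ∣               ≤⟨ s≤s (∣∣-mono {q = classSet v ⊖ w ⊖ v} λ z∈ → let (a , c , d) = ∈earlier⁻ {v} z∈ in
                                         ∈⊖⁺ (∈⊖⁺ a (λ { refl → true≢false rw c })) (λ { refl → n≮n (toℕ v) d })) ⟩
      suc ∣ classSet v ⊖ w ⊖ v ∣      ≡⟨ ∣⊖∣ (∈⊖⁺ (∈classSet {v} refl) (λ { refl → true≢false rw e })) ⟩
      ∣ classSet v ⊖ w ∣              <⟨ ≤-reflexive (∣⊖∣ (∈classSet cw)) ⟩
      ∣ classSet v ∣                  ∎
      where open ≤-Reasoning

    label : Fin n → ℕ
    label v = class v + rank v * suc r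

    label-% : ∀ v → label v % suc r ≡ class v
    label-% v = trans ([m+kn]%n≡m%n (class v) (rank v) (suc r)) (m<n⇒m%n≡m (s≤s (class≤ v)))

    earlier-mono : ∀ {v w} → rep v ≡ false → class v ≡ class w → toℕ v < toℕ w → ∣ earlier v ∣ < ∣ earlier w ∣
    earlier-mono {v} {w} e c lt = ≤-trans (s≤s (∣∣-mono {q = earlier w ⊖ v} λ z∈ → let (p , q , t) = ∈earlier⁻ {v} z∈ in
        ∈⊖⁺ (∈earlier⁺ (trans (∈classSet⁻ p) c) q (<-trans t lt)) (λ { refl → n≮n (toℕ v) t })))
      (≤-reflexive (∣⊖∣ (∈earlier⁺ c e lt)))

    label-injective : ∀ {v w} → label v ≡ label w → v ≡ w
    label-injective {v} {w} e
      with quotient-unique r (rank v) (rank w) (class v) (class w) (class≤ v) (class≤ w)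
             (trans (+-comm (rank v * suc r) (class v)) (trans e (+-comm (class w) (rank w * suc r))))
    ... | rk , c with bool-cases (rep v) | bool-cases (rep w)
    ... | inj₁ p | inj₁ q = rep-unique p q c
    ... | inj₁ p | inj₂ q with () ← trans (≡-sym (rank-rep p)) (trans rk (rank-nonrep q))
    ... | inj₂ p | inj₁ q with () ← trans (≡-sym (rank-rep q)) (trans (≡-sym rk) (rank-nonrep p))
    ... | inj₂ p | inj₂ q with <-cmp (toℕ v) (toℕ w)
      where open import Data.Nat.Properties using (<-cmp)
    ... | tri≈ _ eq _ = Fin.toℕ-injective eq
    ... | tri< lt _ _ = ⊥-elim (<-irrefl (suc-injective (trans (≡-sym (rank-nonrep p)) (trans rk (rank-nonrep q)))) (earlier-mono p c lt))
    ... | tri> _ _ gt = ⊥-elim (<-irrefl (suc-injective (trans (≡-sym (rank-nonrep q)) (trans (≡-sym rk) (rank-nonrep p)))) (earlier-mono q (≡-sym c) gt))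

    -- The top rank `k` occurs only in classes of order `k + 1`, which are among the classes 0 to
    -- `x`; these carry the last `x + 1` labels.
    label< : ∀ v → label v < k * suc r + suc x
    label< v with m≤n⇒m<n∨m≡n (≤-pred (≤-trans (rank< v) (order≤ (class v))))
    ... | inj₁ lt = begin-strict
      class v + rank v * suc r  <⟨ s≤s (+-monoˡ-≤ (rank v * suc r) (class≤ v)) ⟩
      suc (rank v) * suc r      ≤⟨ *-monoˡ-≤ (suc r) lt ⟩
      k * suc r                 ≤⟨ m≤m+n (k * suc r) (suc x) ⟩
      k * suc r + suc x         ∎
      where open ≤-Reasoning
    ... | inj₂ eq = begin-strict
      class v + rank v * suc r  ≡⟨ trans (+-comm (class v) _) (cong (λ ρ → ρ * suc r + class v) eq) ⟩
      k * suc r + class v       <⟨ +-monoʳ-< (k * suc r) (s≤s (≮⇒≥ λ x< → <⇒≱ (≤-<-trans (≤-reflexive (≡-sym eq)) (rank< v)) (small-order≤ (class v) x<))) ⟩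
      k * suc r + suc x         ∎
      where open ≤-Reasoning

    label-zero : ∀ {v} → label v ≡ 0 → v ≡ centre
    label-zero {v} e with m+n≡0⇒m≡0 (class v) e | m+n≡0⇒n≡0 (class v) e
    ... | c | rk = rep-unique (rank-zero (rank0 (rank v) rk)) centre-rep (trans c (≡-sym centre-class))
      where
      rank0 : ∀ ρ → ρ * suc r ≡ 0 → ρ ≡ 0
      rank0 zero _ = refl

    label-centre : label centre ≡ 0
    label-centre = cong₂ (λ a b → a + b * suc r) centre-class (rank-rep centre-rep)

    label<r : ∀ {v} → label v < suc r → rep v ≡ true
    label<r {v} lt = rank-zero (go (rank v) lt)
      where
      go : ∀ ρ → class v + ρ * suc r < suc r → ρ ≡ 0
      go zero _ = refl
      go (suc ρ) lt = ⊥-elim (<⇒≱ lt (≤-trans (m≤m+n (suc r) (ρ * suc r)) (m≤n+m _ (class v))))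

    label<r⁺ : ∀ {v} → rep v ≡ true → label v < suc r
    label<r⁺ {v} e = s≤s (subst (_≤ r) (≡-sym (trans (cong (λ ρ → class v + ρ * suc r) (rank-rep e)) (+-identityʳ _))) (class≤ v))

    module _ (n≡ : n ≡ k * suc r + suc x) where
      private
        lt : ∀ v → label v < n
        lt v = subst (label v <_) (≡-sym n≡) (label< v)

        f : Fin n → Fin n
        f v = fromℕ< (lt v)

        toℕ-f : ∀ v → toℕ (f v) ≡ label v
        toℕ-f v = Fin.toℕ-fromℕ< (lt v)

        f-injective : ∀ {v w} → f v ≡ f w → v ≡ w
        f-injective {v} {w} e = label-injective (trans (≡-sym (toℕ-f v)) (trans (cong toℕ e) (toℕ-f w)))

        f-% : ∀ v → toℕ (f v) % suc r ≡ class v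
        f-% v = trans (cong (_% suc r) (toℕ-f v)) (label-% v)

        forward : ∀ v w → v ~ w → adj (TC n (suc r)) (f v) (f w) ≡ true
        forward v w e = TC-adj⁺ {n} {r} (f v) (f w) (λ eq → ~⇒≢ e (f-injective (Fin.toℕ-injective eq))) (reason (class v ≟ class w))
          where
          reason : Dec (class v ≡ class w) → toℕ (f v) % suc r ≡ toℕ (f w) % suc r ⊎
            (toℕ (f v) ≡ 0 × toℕ (f w) < suc r) ⊎ (toℕ (f w) ≡ 0 × toℕ (f v) < suc r)
          reason (yes c) = inj₁ (trans (f-% v) (trans c (≡-sym (f-% w))))
          reason (no c) with other-class c e
          ... | inj₁ (refl , rw) = inj₂ (inj₁ (trans (toℕ-f v) label-centre , subst (_< suc r) (≡-sym (toℕ-f w)) (label<r⁺ rw)))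
          ... | inj₂ (refl , rv) = inj₂ (inj₂ (trans (toℕ-f w) label-centre , subst (_< suc r) (≡-sym (toℕ-f v)) (label<r⁺ rv)))

        backward : ∀ v w → adj (TC n (suc r)) (f v) (f w) ≡ true → v ~ w
        backward v w e with TC-adj⁻ {n} {r} (f v) (f w) e
        ... | ne , inj₁ c = same-class (trans (≡-sym (f-% v)) (trans c (f-% w))) (λ { refl → ne refl })
        ... | ne , inj₂ (inj₁ (z , l)) with label-zero (trans (≡-sym (toℕ-f v)) z)
        ... | refl = centre-adj (label<r (subst (_< suc r) (toℕ-f w) l)) (λ { refl → ne refl })
        backward v w e | ne , inj₂ (inj₂ (z , l)) with label-zero (trans (≡-sym (toℕ-f w)) z)
        ... | refl = ~-sym (centre-adj (label<r (subst (_< suc r) (toℕ-f v) l)) (λ { refl → ne refl }))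

      starLayout-≅ : G ≅ TC n (suc r)
      starLayout-≅ = ≅-from-injection {G = G} {TC n (suc r)} f f-injective λ v w → bool-ext (forward v w) (backward v w)

  -- Graphs that become a union of cliques when one vertex is deleted.

  ∈full∖ : ∀ {U} → ∀ {z : Fin n} → z ∉ U → z ∈ full ∖ U
  ∈full∖ z∉ = ∈∖⁺ ∈⊤ z∉

  partition-nonempty : ∀ {U Qs} → CliquePartition U Qs → All (1 ≤_) (orders Qs)
  partition-nonempty p = All.map⁺ (All.map (λ (_ , (x , x∈) , _) → 0<∣∣ x∈) (partition-isolated p))

  clique-stable≤1 : ∀ {Q} → Clique Q → StabilityAtMost Q 1
  clique-stable≤1 {Q} cl S S⊆ st with nonempty-or-empty S
  ... | inj₂ e = subst (_≤ 1) (≡-sym (∣∣≡0 e)) z≤n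
  ... | inj₁ (v , v∈) = ≤-reflexive (trans (≡-sym (∣⊖∣ v∈)) (cong suc (∣∣≡0 λ z∈ → let (z∈S , v≢z) = ∈⊖⁻ z∈ in
      true≢false (cl (S⊆ v∈) (S⊆ z∈S) v≢z) (st _ _ v∈ z∈S))))

  stabilityAtMost-+ : ∀ {U Q a b} → StabilityAtMost Q a → StabilityAtMost (U ∖ Q) b → StabilityAtMost U (a + b)
  stabilityAtMost-+ {U} {Q} {a} {b} slQ sl S S⊆ st = begin
    ∣ S ∣                                       ≡⟨ ≡-sym (∣∩ᵖ∣-split S (isMember Q)) ⟩
    ∣ S ∩ᵖ isMember Q ∣ + ∣ S ∩ᵖ (not ∘ isMember Q) ∣
      ≤⟨ +-mono-≤ (slQ _ (λ z∈ → does⁻ (_ ∈? Q) (proj₂ (∈∩ᵖ⁻ z∈))) (λ i j i∈ j∈ → st i j (proj₁ (∈∩ᵖ⁻ i∈)) (proj₁ (∈∩ᵖ⁻ j∈))))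
                  (sl _ (λ {z} z∈ → ∈∖⁺ (S⊆ (proj₁ (∈∩ᵖ⁻ z∈))) (does⁻-false (z ∈? Q) (not-true⁻ (proj₂ (∈∩ᵖ⁻ z∈)))))
                     (λ i j i∈ j∈ → st i j (proj₁ (∈∩ᵖ⁻ i∈)) (proj₁ (∈∩ᵖ⁻ j∈)))) ⟩
    a + b                                       ∎
    where open ≤-Reasoning

  partition-stability : ∀ {U Qs} → CliquePartition U Qs → StabilityAtMost U (length Qs)
  partition-stability (none e) S S⊆ st = ≤-reflexive (∣∣≡0 λ z∈ → e (S⊆ z∈))
  partition-stability (some (_ , _ , cl , _) _ p) = stabilityAtMost-+ (clique-stable≤1 cl) (partition-stability p)

  -- Each clique loses at least one vertex to `P`, so its factor drops from `∣ Q ∣ + 1` to at most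
  -- `∣ Q ∣`, with equality exactly when one vertex is lost. With `P` the neighbourhood of the
  -- centre this gives the second product of `star`.
  removal : ∀ {V Qs} P → CliquePartition V Qs → All (λ Q → Nonempty (Q ∩ᵖ P)) Qs →
    stableCount (V ∩ᵖ (not ∘ P)) ≤ product (orders Qs) ×
    (stableCount (V ∩ᵖ (not ∘ P)) ≡ product (orders Qs) → All (λ Q → ∣ Q ∩ᵖ P ∣ ≡ 1) Qs)
  removal P (none e) [] = ≤-reflexive (stableCount-empty λ z∈ → e (proj₁ (∈∩ᵖ⁻ z∈))) , λ _ → []
  removal {V} {Q ∷ Qs} P (some (Q⊆ , _ , cl , sep) _ p) ((z , z∈) ∷ hits) with removal P p hits
  ... | le , eq = subst (_≤ ∣ Q ∣ * product (orders Qs)) (≡-sym F≡) (*-mono-≤ shrink le) ,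
      λ e → let (e₁ , e₂) = *-≤-≡ shrink le (0<∣∣ (proj₁ (∈∩ᵖ⁻ z∈))) (0<product (partition-nonempty p)) (trans (≡-sym F≡) e)
            in +-cancelʳ-≡ ∣ Q ∩ᵖ (not ∘ P) ∣ _ 1 (trans (∣∩ᵖ∣-split Q P) (≡-sym e₁)) ∷ eq e₂
    where
    0<product : ∀ {l} → All (1 ≤_) l → 0 < product l
    0<product [] = s≤s z≤n
    0<product (p ∷ ps) = 0<* p (0<product ps)
    shrink : suc ∣ Q ∩ᵖ (not ∘ P) ∣ ≤ ∣ Q ∣
    shrink = ≤-trans (+-monoˡ-≤ _ (0<∣∣ z∈)) (≤-reflexive (∣∩ᵖ∣-split Q P))
    split : V ∩ᵖ (not ∘ P) ≡ Q ∩ᵖ (not ∘ P) ∪ (V ∖ Q ∩ᵖ (not ∘ P))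
    split = ⊆-ext to (λ w∈ → from (∪⁻ w∈))
      where
      to : ∀ {w} → w ∈ V ∩ᵖ (not ∘ P) → w ∈ Q ∩ᵖ (not ∘ P) ∪ (V ∖ Q ∩ᵖ (not ∘ P))
      to {w} w∈ with ∈∩ᵖ⁻ w∈ | w ∈? Q
      ... | a , b | yes w∈Q = ∪ˡ (∈∩ᵖ⁺ w∈Q b)
      ... | a , b | no w∉Q = ∪ʳ (∈∩ᵖ⁺ (∈∖⁺ a w∉Q) b)
      from : ∀ {w} → w ∈ Q ∩ᵖ (not ∘ P) ⊎ w ∈ V ∖ Q ∩ᵖ (not ∘ P) → w ∈ V ∩ᵖ (not ∘ P)
      from (inj₁ w∈) = ∈∩ᵖ⁺ (Q⊆ (proj₁ (∈∩ᵖ⁻ w∈))) (proj₂ (∈∩ᵖ⁻ w∈))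
      from (inj₂ w∈) = ∈∩ᵖ⁺ (proj₁ (∈∖⁻ (proj₁ (∈∩ᵖ⁻ w∈)))) (proj₂ (∈∩ᵖ⁻ w∈))
    F≡ : stableCount (V ∩ᵖ (not ∘ P)) ≡ suc ∣ Q ∩ᵖ (not ∘ P) ∣ * stableCount (V ∖ Q ∩ᵖ (not ∘ P))
    F≡ = trans (cong stableCount split) (trans
      (stableCount-∪ (λ a b → proj₂ (∈∖⁻ (proj₁ (∈∩ᵖ⁻ b))) (proj₁ (∈∩ᵖ⁻ a))) (λ a b → sep (proj₁ (∈∩ᵖ⁻ a)) (proj₁ (∈∩ᵖ⁻ b))))
      (cong (_* stableCount (V ∖ Q ∩ᵖ (not ∘ P))) (stableCount-clique (λ a b → cl (proj₁ (∈∩ᵖ⁻ a)) (proj₁ (∈∩ᵖ⁻ b))))))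

  -- C is the clique that becomes a clique with the centre; Qs are the other cliques.
  record Starlike (Qs : List (Subset n)) : Set where
    field
      centre : Fin n
      C : Subset n
      C⊆ : ∀ {z} → z ∈ C → z ∈ full ⊖ centre
      C-clique : Clique C
      C-separated : Separated C (full ⊖ centre ∖ C)
      centre-C : ∀ {z} → z ∈ C → centre ~ z
      partition : CliquePartition (full ⊖ centre ∖ C) Qs

    V : Subset n
    V = full ⊖ centre ∖ C

    V⁻ : ∀ {z} → z ∈ V → centre ≢ z × z ∉ C
    V⁻ z∈ = proj₂ (∈⊖⁻ (proj₁ (∈∖⁻ z∈))) , proj₂ (∈∖⁻ z∈)

    cases : ∀ z → z ≡ centre ⊎ z ∈ C ⊎ z ∈ V
    cases z with centre Fin.≟ z | z ∈? C
    ... | yes e | _ = inj₁ (≡-sym e)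
    ... | no _ | yes z∈C = inj₂ (inj₁ z∈C)
    ... | no ne | no z∉C = inj₂ (inj₂ (∈∖⁺ (∈⊖⁺ ∈⊤ ne) z∉C))

    Q₀ : Subset n
    Q₀ = insert centre C

    Q₀-or-V : ∀ v → v ∈ Q₀ ⊎ v ∈ V
    Q₀-or-V v with cases v
    ... | inj₁ refl = inj₁ ∈insert
    ... | inj₂ (inj₁ v∈C) = inj₁ (∪ʳ v∈C)
    ... | inj₂ (inj₂ v∈V) = inj₂ v∈V

    V∩Q₀ : ∀ {v} → v ∈ V → v ∉ Q₀
    V∩Q₀ v∈V v∈Q₀ with insert⁻ v∈Q₀
    ... | inj₁ e = proj₁ (V⁻ v∈V) (≡-sym e)
    ... | inj₂ v∈C = proj₂ (V⁻ v∈V) v∈C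

    full∖Q₀ : ∀ {z} → z ∈ full ∖ Q₀ → z ∈ V
    full∖Q₀ {z} z∈ with Q₀-or-V z
    ... | inj₁ z∈Q₀ = ⊥-elim (proj₂ (∈∖⁻ z∈) z∈Q₀)
    ... | inj₂ z∈V = z∈V

    ∣Q₀∣ : ∣ Q₀ ∣ ≡ suc ∣ C ∣
    ∣Q₀∣ = ∣insert∣ λ u∈C → proj₂ (∈⊖⁻ (C⊆ u∈C)) refl

    Q₀-clique : Clique Q₀
    Q₀-clique v∈ w∈ ne with insert⁻ v∈ | insert⁻ w∈
    ... | inj₁ refl | inj₁ refl = ⊥-elim (ne refl)
    ... | inj₁ refl | inj₂ w∈C = centre-C w∈C
    ... | inj₂ v∈C | inj₁ refl = ~-sym (centre-C v∈C)
    ... | inj₂ v∈C | inj₂ w∈C = C-clique v∈C w∈C ne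

    order : suc ∣ C ∣ + sum (orders Qs) ≡ n
    order = trans (cong (suc ∣ C ∣ +_) (sum-partition partition)) (trans (cong suc (∣∖∣ C⊆)) (trans (∣⊖∣ ∈⊤) (∣⊤∣≡n n)))

    attached : Connectedᵂ full → All (λ Q → Nonempty (Q ∩ᵖ adj G centre)) Qs
    attached conn = All.map hit (partition-isolated partition)
      where
      hit : ∀ {Q} → Isolated V Q → Nonempty (Q ∩ᵖ adj G centre)
      hit {Q} (Q⊆ , ne , _ , sep) with conn Q (λ _ → ∈⊤) ne (centre , ∈full∖ λ u∈ → proj₁ (V⁻ (Q⊆ u∈)) refl)
      ... | a , b , a∈ , b∈ , a~b with cases b
      ... | inj₁ refl = a , ∈∩ᵖ⁺ a∈ (~-sym a~b)
      ... | inj₂ (inj₁ b∈C) = true≢false (~-sym a~b) (C-separated b∈C (Q⊆ a∈))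
      ... | inj₂ (inj₂ b∈V) = true≢false a~b (sep a∈ (∈∖⁺ b∈V (proj₂ (∈∖⁻ b∈))))

    stableCount-starlike : stableCount full ≡ suc ∣ C ∣ * product (map suc (orders Qs)) + stableCount (V ∩ᵖ (not ∘ adj G centre))
    stableCount-starlike = trans (stableCount-split ∈⊤) (cong₂ _+_
      (trans (stableCount-∖ C⊆ C-separated) (cong₂ _*_ (stableCount-clique C-clique) (stableCount-partition partition)))
      (cong stableCount (⊆-ext to (λ z∈ → ∈⊝⁺ ∈⊤ (proj₁ (V⁻ (proj₁ (∈∩ᵖ⁻ z∈)))) (not-true⁻ (proj₂ (∈∩ᵖ⁻ z∈)))))))
      where
      to : ∀ {z} → z ∈ full ⊝ centre → z ∈ V ∩ᵖ (not ∘ adj G centre)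
      to {z} z∈ with ∈⊝⁻ z∈ | cases z
      ... | _ , ne , _ | inj₁ e = ⊥-elim (ne (≡-sym e))
      ... | _ , _ , far | inj₂ (inj₁ z∈C) = true≢false (centre-C z∈C) far
      ... | _ , _ , far | inj₂ (inj₂ z∈V) = ∈∩ᵖ⁺ z∈V (cong not far)

    stableCount≤star : Connectedᵂ full → stableCount full ≤ star (suc ∣ C ∣) (orders Qs) ×
      (stableCount full ≡ star (suc ∣ C ∣) (orders Qs) → All (λ Q → ∣ Q ∩ᵖ adj G centre ∣ ≡ 1) Qs)
    stableCount≤star conn with removal (adj G centre) partition (attached conn)
    ... | le , eq = subst (_≤ star (suc ∣ C ∣) (orders Qs)) (≡-sym stableCount-starlike) (+-monoʳ-≤ _ le) ,
      λ e → eq (+-cancelˡ-≡ (suc ∣ C ∣ * product (map suc (orders Qs))) _ _ (trans (≡-sym stableCount-starlike) e))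

  -- If `u` sees a whole clique, that clique becomes `C`; otherwise `C` is empty and `u` forms a
  -- clique of order one by itself. In both cases a stable set meets all cliques, so their number,
  -- with that of the centre, is at most the stability number.
  starlike : ∀ {u} → Cluster (full ⊖ u) → ∃ λ Qs → Starlike Qs × StableSet full (suc (length Qs))
  starlike {u} cl with Fin.any? (λ s → (s ∈? full ⊖ u) ×-dec Fin.all? (λ z → (z ∈? closedNeighbourhood (full ⊖ u) s) →-dec (adj G u z Bool.≟ true)))
  ... | yes (s , s∈ , seen) with closed-isolated cl s∈
  ... | C⊆ , (c , c∈) , C-clique , C-sep with cluster-partition (cluster-mono {full ⊖ u ∖ closedNeighbourhood (full ⊖ u) s} (λ z∈ → proj₁ (∈∖⁻ z∈)) cl)
  ... | Qs , p with partition-stable p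
  ... | S , S⊆ , st , size = Qs ,
      record { centre = u ; C = _ ; C⊆ = C⊆ ; C-clique = C-clique ; C-separated = C-sep ; centre-C = seen _ ; partition = p } ,
      insert c S , (λ _ → ∈⊤) , insert-stable (λ z∈ → C-sep c∈ (S⊆ z∈)) st , trans (∣insert∣ λ c∈S → proj₂ (∈∖⁻ (S⊆ c∈S)) c∈) (cong suc size)
  starlike {u} cl | no ¬seen with cluster-partition (cluster-mono {full ⊖ u ∖ empty} (λ z∈ → proj₁ (∈∖⁻ z∈)) cl)
  ... | Qs , p with transversal u p
  ... | inj₂ (S , S⊆ , far , st , size) = Qs ,
      record { centre = u ; C = empty ; C⊆ = λ z∈ → ⊥-elim (∉⊥ z∈) ; C-clique = λ z∈ → ⊥-elim (∉⊥ z∈)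
             ; C-separated = λ z∈ → ⊥-elim (∉⊥ z∈) ; centre-C = λ z∈ → ⊥-elim (∉⊥ z∈) ; partition = p } ,
      insert u S , (λ _ → ∈⊤) , insert-stable far st , trans (∣insert∣ λ u∈S → proj₂ (∈⊖⁻ (proj₁ (∈∖⁻ (S⊆ u∈S)))) refl) (cong suc size)
  ... | inj₁ any with choose-all (partition-isolated p) any
  ... | Q , (Q⊆ , (s , s∈) , _ , sep) , seen = ⊥-elim (¬seen (s , proj₁ (∈∖⁻ (Q⊆ s∈)) , λ z z∈ → seen (inQ z (∈closed⁻ z∈))))
    where
    inQ : ∀ z → z ∈ full ⊖ u × (s ≡ z ⊎ s ~ z) → z ∈ Q
    inQ z (_ , inj₁ refl) = s∈
    inQ z (z∈ , inj₂ s~z) with z ∈? Q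
    ... | yes z∈Q = z∈Q
    ... | no z∉Q = true≢false s~z (sep s∈ (∈∖⁺ (∈∖⁺ z∈ ∉⊥) z∉Q))

  -- Numbering the cliques.

  -- The position of the first clique containing `v`; a vertex in none of them receives `length Qs`.
  classIndex : List (Subset n) → Fin n → ℕ
  classIndex [] v = 0
  classIndex (Q ∷ Qs) v = if isMember Q v then 0 else suc (classIndex Qs v)

  classIndex-in : ∀ {Q Qs v} → v ∈ Q → classIndex (Q ∷ Qs) v ≡ 0
  classIndex-in {Q} {v = v} v∈ rewrite dec-true (v ∈? Q) v∈ = refl

  classIndex-out : ∀ {Q Qs v} → v ∉ Q → classIndex (Q ∷ Qs) v ≡ suc (classIndex Qs v)
  classIndex-out {Q} {v = v} v∉ rewrite dec-false (v ∈? Q) v∉ = refl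

  classIndex< : ∀ {V Qs v} → CliquePartition V Qs → v ∈ V → classIndex Qs v < length Qs
  classIndex< (none e) v∈ = ⊥-elim (e v∈)
  classIndex< {Qs = Q ∷ Qs} {v} (some _ _ p) v∈ with v ∈? Q
  ... | yes v∈Q = s≤s z≤n
  ... | no v∉Q = s≤s (classIndex< p (∈∖⁺ v∈ v∉Q))

  classIndex-adjacent : ∀ {V Qs v w} → CliquePartition V Qs → v ∈ V → w ∈ V →
    (classIndex Qs v ≡ classIndex Qs w → v ≢ w → v ~ w) × (classIndex Qs v ≢ classIndex Qs w → v ≁ w)
  classIndex-adjacent (none e) v∈ _ = ⊥-elim (e v∈)
  classIndex-adjacent {Qs = Q ∷ Qs} {v} {w} (some (_ , _ , cl , sep) _ p) v∈ w∈ with v ∈? Q | w ∈? Q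
  ... | yes v∈Q | yes w∈Q = (λ _ → cl v∈Q w∈Q) , λ ne → ⊥-elim (ne refl)
  ... | yes v∈Q | no w∉Q = (λ ()) , λ _ → sep v∈Q (∈∖⁺ w∈ w∉Q)
  ... | no v∉Q | yes w∈Q = (λ ()) , λ _ → ≁-sym (sep w∈Q (∈∖⁺ v∈ v∉Q))
  ... | no v∉Q | no w∉Q with classIndex-adjacent p (∈∖⁺ v∈ v∉Q) (∈∖⁺ w∈ w∉Q)
  ... | same , other = (λ e → same (suc-injective e)) , λ ne → other (λ e → ne (cong suc e))

  classIndex-rep : ∀ {V Qs} P → CliquePartition V Qs → All (λ Q → ∣ Q ∩ᵖ P ∣ ≡ 1) Qs →
    (∀ {v w} → v ∈ V → w ∈ V → P v ≡ true → P w ≡ true → classIndex Qs v ≡ classIndex Qs w → v ≡ w) ×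
    (∀ {v} → v ∈ V → ∃ λ w → w ∈ V × P w ≡ true × classIndex Qs w ≡ classIndex Qs v)
  classIndex-rep P (none e) _ = (λ v∈ → ⊥-elim (e v∈)) , λ v∈ → ⊥-elim (e v∈)
  classIndex-rep {V} {Q ∷ Qs} P (some (Q⊆ , _) _ p) (one ∷ ones) with classIndex-rep P p ones
  ... | uniq , exists = uniq′ , exists′
    where
    uniq′ : ∀ {v w} → v ∈ V → w ∈ V → P v ≡ true → P w ≡ true → classIndex (Q ∷ Qs) v ≡ classIndex (Q ∷ Qs) w → v ≡ w
    uniq′ {v} {w} v∈ w∈ Pv Pw e with v ∈? Q | w ∈? Q
    ... | yes v∈Q | yes w∈Q = ∣∣≤1⇒≡ (≤-reflexive one) (∈∩ᵖ⁺ v∈Q Pv) (∈∩ᵖ⁺ w∈Q Pw)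
    ... | no v∉Q | no w∉Q = uniq (∈∖⁺ v∈ v∉Q) (∈∖⁺ w∈ w∉Q) Pv Pw (suc-injective e)
    uniq′ _ _ _ _ () | yes _ | no _
    uniq′ _ _ _ _ () | no _ | yes _
    exists′ : ∀ {v} → v ∈ V → ∃ λ w → w ∈ V × P w ≡ true × classIndex (Q ∷ Qs) w ≡ classIndex (Q ∷ Qs) v
    exists′ {v} v∈ with v ∈? Q
    ... | yes v∈Q = let (w , w∈) = 0<∣∣⁻ (≤-reflexive (≡-sym one)) ; (w∈Q , Pw) = ∈∩ᵖ⁻ w∈ in w , Q⊆ w∈Q , Pw , classIndex-in {Q} {Qs} w∈Q
    ... | no v∉Q = let (w , w∈ , Pw , c) = exists (∈∖⁺ v∈ v∉Q) ; (w∈V , w∉Q) = ∈∖⁻ w∈ in w , w∈V , Pw , trans (classIndex-out {Q} {Qs} w∉Q) (cong suc c)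

  indexSet : Subset n → List (Subset n) → ℕ → Subset n
  indexSet V Qs j = V ∩ᵖ (λ z → classIndex Qs z ≡ᵇ j)

  indexSet-zero : ∀ V Q Qs → ∣ indexSet V (Q ∷ Qs) 0 ∣ ≤ ∣ Q ∣
  indexSet-zero V Q Qs = ∣∣-mono λ {z} z∈ → inQ z (≡ᵇ-true⁻ (proj₂ (∈∩ᵖ⁻ z∈)))
    where
    inQ : ∀ z → classIndex (Q ∷ Qs) z ≡ 0 → z ∈ Q
    inQ z e with z ∈? Q
    ... | yes z∈Q = z∈Q
    inQ z () | no _

  indexSet-suc : ∀ V Q Qs j → ∣ indexSet V (Q ∷ Qs) (suc j) ∣ ≤ ∣ indexSet (V ∖ Q) Qs j ∣
  indexSet-suc V Q Qs j = ∣∣-mono λ {z} z∈ → let (a , b) = ∈∩ᵖ⁻ z∈ ; (z∉Q , e) = out z (≡ᵇ-true⁻ b) in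
      ∈∩ᵖ⁺ (∈∖⁺ a z∉Q) (≡ᵇ-true e)
    where
    out : ∀ z → classIndex (Q ∷ Qs) z ≡ suc j → z ∉ Q × classIndex Qs z ≡ j
    out z e with z ∈? Q
    out z () | yes _
    ... | no z∉Q = z∉Q , suc-injective e

  indexSet≤ : ∀ {V Qs b} → CliquePartition V Qs → All (λ Q → ∣ Q ∣ ≤ b) Qs → ∀ j → ∣ indexSet V Qs j ∣ ≤ b
  indexSet≤ (none e) _ j = ≤-trans (≤-reflexive (∣∣≡0 λ z∈ → e (proj₁ (∈∩ᵖ⁻ z∈)))) z≤n
  indexSet≤ {V} {Q ∷ Qs} (some _ _ p) (le ∷ _) zero = ≤-trans (indexSet-zero V Q Qs) le
  indexSet≤ {V} {Q ∷ Qs} (some _ _ p) (_ ∷ les) (suc j) = ≤-trans (indexSet-suc V Q Qs j) (indexSet≤ p les j)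

  -- The cliques come in decreasing order, so exactly the first x of them have order k + 1.
  indexSet-small : ∀ {V Qs k} x → CliquePartition V Qs → All (λ Q → Sandwich k ∣ Q ∣) Qs → sum (orders Qs) ≡ k * length Qs + x →
    ∀ j → x ≤ j → ∣ indexSet V Qs j ∣ ≤ k
  indexSet-small x (none e) _ _ j _ = ≤-trans (≤-reflexive (∣∣≡0 λ z∈ → e (proj₁ (∈∩ᵖ⁻ z∈)))) z≤n
  indexSet-small x (some iso sorted p) (inj₁ eq ∷ _) total j x≤j =
    indexSet≤ (some iso sorted p) (≤-reflexive eq ∷ All.map (λ le → ≤-trans le (≤-reflexive eq)) sorted) j
  indexSet-small {Qs = Q ∷ Qs} {k} zero (some _ _ p) (inj₂ eq ∷ sizes) total j x≤j = ⊥-elim (<-irrefl (≡-sym total) (begin-strict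
      k * suc (length Qs) + 0     ≡⟨ trans (+-identityʳ _) (*-suc k (length Qs)) ⟩
      k + k * length Qs           <⟨ s≤s (+-monoʳ-≤ k (total≥ sizes)) ⟩
      suc k + sum (orders Qs)     ≡⟨ cong (_+ sum (orders Qs)) (≡-sym eq) ⟩
      ∣ Q ∣ + sum (orders Qs)     ∎))
    where
    open ≤-Reasoning
    k≤ : (Q : Subset n) → Sandwich k ∣ Q ∣ → k ≤ ∣ Q ∣
    k≤ Q (inj₁ e) = ≤-reflexive (≡-sym e)
    k≤ Q (inj₂ e) = ≤-trans (n≤1+n k) (≤-reflexive (≡-sym e))
    total≥ : ∀ {Qs} → All (λ Q → Sandwich k ∣ Q ∣) Qs → k * length Qs ≤ sum (orders Qs)
    total≥ [] = ≤-reflexive (*-zeroʳ k)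
    total≥ {Q ∷ Qs} (s ∷ ss) = ≤-trans (≤-reflexive (*-suc k (length Qs))) (+-mono-≤ (k≤ Q s) (total≥ ss))
  indexSet-small {V} {Q ∷ Qs} {k} (suc x) (some _ _ p) (inj₂ eq ∷ sizes) total (suc j) (s≤s x≤j) =
    ≤-trans (indexSet-suc V Q Qs j) (indexSet-small x p sizes (+-cancelˡ-≡ (suc k) _ _
      (trans (cong (_+ sum (orders Qs)) (≡-sym eq)) (trans total (lem k (length Qs) x)))) j x≤j)
    where
    lem : ∀ k l x → k * suc l + suc x ≡ suc k + (k * l + x)
    lem = solve-∀

  module _ {Qs k x r} (T : Starlike Qs) (ones : All (λ Q → ∣ Q ∩ᵖ adj G (Starlike.centre T) ∣ ≡ 1) Qs) (len : length Qs ≡ r)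
    (C-order : suc ∣ Starlike.C T ∣ ≡ suc k) (sizes : All (λ Q → Sandwich k ∣ Q ∣) Qs) (total : sum (orders Qs) ≡ k * length Qs + x) where
    open Starlike T

    private
      cls : Fin n → ℕ
      cls = classIndex (Q₀ ∷ Qs)

      -- The centre represents its own class, and every other class is represented by its unique
      -- neighbour of the centre.
      isRep : Fin n → Bool
      isRep v = isEqual centre v ∨ (isMember V v ∧ adj G centre v)

      cls-Q₀ : ∀ {v} → v ∈ Q₀ → cls v ≡ 0
      cls-Q₀ = classIndex-in {Q₀} {Qs}

      cls-V : ∀ {v} → v ∈ V → cls v ≡ suc (classIndex Qs v)
      cls-V v∈ = classIndex-out {Q₀} {Qs} (V∩Q₀ v∈)

      rep⁻ : ∀ {v} → isRep v ≡ true → v ≡ centre ⊎ (v ∈ V × centre ~ v)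
      rep⁻ {v} e with ∨-true⁻ {isEqual centre v} e
      ... | inj₁ p = inj₁ (≡-sym (does⁻ (centre Fin.≟ v) p))
      ... | inj₂ p with ∧⁻ {isMember V v} p
      ... | a , b = inj₂ (does⁻ (v ∈? V) a , b)

      rep-V⁺ : ∀ {v} → v ∈ V → centre ~ v → isRep v ≡ true
      rep-V⁺ {v} v∈ e = ∨-trueʳ {isEqual centre v} (cong₂ _∧_ (dec-true (v ∈? V) v∈) e)

      centre-rep : isRep centre ≡ true
      centre-rep = ∨-trueˡ (dec-true (centre Fin.≟ centre) refl)

      different : ∀ {v w} {A : Set} → v ∈ Q₀ → w ∈ V → cls v ≡ cls w → A
      different v∈ w∈ e with () ← trans (≡-sym (cls-Q₀ v∈)) (trans e (cls-V w∈))

      V-cls : ∀ {v w} → v ∈ V → w ∈ V → cls v ≡ cls w → classIndex Qs v ≡ classIndex Qs w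
      V-cls v∈ w∈ e = suc-injective (trans (≡-sym (cls-V v∈)) (trans e (cls-V w∈)))

      cross : ∀ {v w} → v ∈ Q₀ → w ∈ V → v ~ w → v ≡ centre × isRep w ≡ true
      cross v∈ w∈ e with insert⁻ v∈
      ... | inj₁ refl = refl , rep-V⁺ w∈ e
      ... | inj₂ v∈C = true≢false e (C-separated v∈C w∈)

      reps = classIndex-rep (adj G centre) partition ones

      rep-unique : ∀ {v w} → isRep v ≡ true → isRep w ≡ true → cls v ≡ cls w → v ≡ w
      rep-unique rv rw e with rep⁻ rv | rep⁻ rw
      ... | inj₁ refl | inj₁ refl = refl
      ... | inj₁ refl | inj₂ (w∈ , _) = different ∈insert w∈ e
      ... | inj₂ (v∈ , _) | inj₁ refl = different ∈insert v∈ (≡-sym e)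
      ... | inj₂ (v∈ , a) | inj₂ (w∈ , b) = proj₁ reps v∈ w∈ a b (V-cls v∈ w∈ e)

      rep-exists : ∀ v → ∃ λ w → isRep w ≡ true × cls w ≡ cls v
      rep-exists v with Q₀-or-V v
      ... | inj₁ v∈ = centre , centre-rep , trans (cls-Q₀ ∈insert) (≡-sym (cls-Q₀ v∈))
      ... | inj₂ v∈ with proj₂ reps v∈
      ... | w , w∈ , e , c = w , rep-V⁺ w∈ e , trans (cls-V w∈) (trans (cong suc c) (≡-sym (cls-V v∈)))

      same-class : ∀ {v w} → cls v ≡ cls w → v ≢ w → v ~ w
      same-class {v} {w} e ne with Q₀-or-V v | Q₀-or-V w
      ... | inj₁ v∈ | inj₁ w∈ = Q₀-clique v∈ w∈ ne
      ... | inj₁ v∈ | inj₂ w∈ = different v∈ w∈ e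
      ... | inj₂ v∈ | inj₁ w∈ = different w∈ v∈ (≡-sym e)
      ... | inj₂ v∈ | inj₂ w∈ = proj₁ (classIndex-adjacent partition v∈ w∈) (V-cls v∈ w∈ e) ne

      other-class : ∀ {v w} → cls v ≢ cls w → v ~ w → (v ≡ centre × isRep w ≡ true) ⊎ (w ≡ centre × isRep v ≡ true)
      other-class {v} {w} ne e with Q₀-or-V v | Q₀-or-V w
      ... | inj₁ v∈ | inj₁ w∈ = ⊥-elim (ne (trans (cls-Q₀ v∈) (≡-sym (cls-Q₀ w∈))))
      ... | inj₁ v∈ | inj₂ w∈ = inj₁ (cross v∈ w∈ e)
      ... | inj₂ v∈ | inj₁ w∈ = inj₂ (cross w∈ v∈ (~-sym e))
      ... | inj₂ v∈ | inj₂ w∈ = true≢false e (proj₂ (classIndex-adjacent partition v∈ w∈)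
            (λ c → ne (trans (cls-V v∈) (trans (cong suc c) (≡-sym (cls-V w∈))))))

      centre-adj : ∀ {w} → isRep w ≡ true → w ≢ centre → centre ~ w
      centre-adj rw ne with rep⁻ rw
      ... | inj₁ e = ⊥-elim (ne e)
      ... | inj₂ (_ , e) = e

      class≤ : ∀ v → cls v ≤ r
      class≤ v with Q₀-or-V v
      ... | inj₁ v∈ = ≤-trans (≤-reflexive (cls-Q₀ v∈)) z≤n
      ... | inj₂ v∈ = ≤-trans (≤-reflexive (cls-V v∈)) (subst (suc (classIndex Qs v) ≤_) len (classIndex< partition v∈))

      Q₀-order : ∣ Q₀ ∣ ≡ suc k
      Q₀-order = trans ∣Q₀∣ C-order

      to-V : ∀ j → ∣ indexSet full (Q₀ ∷ Qs) (suc j) ∣ ≤ ∣ indexSet V Qs j ∣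
      to-V j = ≤-trans (indexSet-suc full Q₀ Qs j) (∣∣-mono {q = indexSet V Qs j} λ z∈ → ∈∩ᵖ⁺ (full∖Q₀ (proj₁ (∈∩ᵖ⁻ z∈))) (proj₂ (∈∩ᵖ⁻ z∈)))

      order≤ : ∀ j → ∣ indexSet full (Q₀ ∷ Qs) j ∣ ≤ suc k
      order≤ zero = ≤-trans (indexSet-zero full Q₀ Qs) (≤-reflexive Q₀-order)
      order≤ (suc j) = ≤-trans (to-V j) (indexSet≤ partition (All.map (λ {Q} → at-most Q) sizes) j)
        where
        at-most : ∀ Q → Sandwich k ∣ Q ∣ → ∣ Q ∣ ≤ suc k
        at-most Q (inj₁ e) = ≤-trans (≤-reflexive e) (n≤1+n k)
        at-most Q (inj₂ e) = ≤-reflexive e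

      small-order≤ : ∀ j → x < j → ∣ indexSet full (Q₀ ∷ Qs) j ∣ ≤ k
      small-order≤ (suc j) (s≤s x≤j) = ≤-trans (to-V j) (indexSet-small x partition sizes total j x≤j)

    starlike-layout : StarLayout r k x
    starlike-layout = record
      { centre = centre ; class = cls ; rep = isRep ; class≤ = class≤ ; centre-class = cls-Q₀ ∈insert ; centre-rep = centre-rep
      ; rep-unique = rep-unique ; rep-exists = rep-exists ; same-class = same-class ; other-class = other-class
      ; centre-adj = centre-adj ; order≤ = order≤ ; small-order≤ = small-order≤ }

  -- With two cliques, either end of the edge joining them may serve as the centre.
  swap : ∀ {Q} (T : Starlike (Q ∷ [])) → ∣ Q ∩ᵖ adj G (Starlike.centre T) ∣ ≡ 1 → ∃ λ Q′ → Σ (Starlike (Q′ ∷ [])) λ T′ →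
    ∣ Q′ ∩ᵖ adj G (Starlike.centre T′) ∣ ≡ 1 × ∣ Q′ ∣ ≡ suc ∣ Starlike.C T ∣ × suc ∣ Starlike.C T′ ∣ ≡ ∣ Q ∣
  swap {Q} T one with 0<∣∣⁻ (≤-reflexive (≡-sym one)) | Starlike.partition T
  ... | u , u∈ | some (Q⊆ , ne , cl , sep) sorted (none rest) = Q₀ , T′ , one′ , ∣Q₀∣ , ∣⊖∣ u∈Q
    where
    open Starlike T
    u∈Q = proj₁ (∈∩ᵖ⁻ u∈)
    c~u = proj₂ (∈∩ᵖ⁻ {x = u} u∈)
    Q₀-or-Q : ∀ v → v ∈ Q₀ ⊎ v ∈ Q
    Q₀-or-Q v with Q₀-or-V v | v ∈? Q
    ... | _ | yes v∈Q = inj₂ v∈Q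
    ... | inj₁ v∈Q₀ | _ = inj₁ v∈Q₀
    ... | inj₂ v∈V | no v∉Q = ⊥-elim (rest (∈∖⁺ v∈V v∉Q))
    Q₀∩Q : ∀ {v} → v ∈ Q₀ → v ∉ Q
    Q₀∩Q v∈ v∈Q = V∩Q₀ (Q⊆ v∈Q) v∈
    only-u : ∀ {v w} → v ∈ Q₀ → w ∈ Q → v ~ w → v ≡ centre × w ≡ u
    only-u v∈ w∈ e with insert⁻ v∈
    ... | inj₁ refl = refl , ∣∣≤1⇒≡ (≤-reflexive one) (∈∩ᵖ⁺ w∈ e) u∈
    ... | inj₂ v∈C = true≢false e (C-separated v∈C (Q⊆ w∈))
    outside⁻ : ∀ {z} → z ∈ full ⊖ u ∖ (Q ⊖ u) → z ∈ Q₀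
    outside⁻ {z} z∈ with Q₀-or-Q z
    ... | inj₁ z∈Q₀ = z∈Q₀
    ... | inj₂ z∈Q = ⊥-elim (proj₂ (∈∖⁻ z∈) (∈⊖⁺ z∈Q (proj₂ (∈⊖⁻ (proj₁ (∈∖⁻ z∈))))))
    outside⁺ : ∀ {z} → z ∈ Q₀ → z ∈ full ⊖ u ∖ (Q ⊖ u)
    outside⁺ z∈ = ∈∖⁺ (∈⊖⁺ ∈⊤ (λ { refl → Q₀∩Q z∈ u∈Q })) (λ z∈′ → Q₀∩Q z∈ (proj₁ (∈⊖⁻ z∈′)))
    apart : Separated (Q ⊖ u) Q₀
    apart {a} {b} a∈ b∈ with ~-or-≁ a b
    ... | inj₂ e = e
    ... | inj₁ e = ⊥-elim (proj₂ (∈⊖⁻ a∈) (≡-sym (proj₂ (only-u b∈ (proj₁ (∈⊖⁻ a∈)) (~-sym e)))))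
    T′ : Starlike (Q₀ ∷ [])
    T′ = record
      { centre = u ; C = Q ⊖ u ; C⊆ = λ z∈ → ∈⊖⁺ ∈⊤ (proj₂ (∈⊖⁻ z∈)) ; C-clique = λ a b → cl (proj₁ (∈⊖⁻ a)) (proj₁ (∈⊖⁻ b))
      ; C-separated = λ a b → apart a (outside⁻ b) ; centre-C = λ z∈ → cl u∈Q (proj₁ (∈⊖⁻ z∈)) (proj₂ (∈⊖⁻ z∈))
      ; partition = some (outside⁺ , (centre , ∈insert) , Q₀-clique , λ a b → ⊥-elim (proj₂ (∈∖⁻ b) (outside⁻ (proj₁ (∈∖⁻ b))))) []
          (none λ z∈ → proj₂ (∈∖⁻ z∈) (outside⁻ (proj₁ (∈∖⁻ z∈)))) }
    one′ : ∣ Q₀ ∩ᵖ adj G u ∣ ≡ 1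
    one′ = trans (≡-sym (∣⊖∣ (∈∩ᵖ⁺ (∈insert {v = centre} {p = C}) (~-sym c~u)))) (cong suc (∣∣≡0 λ z∈ → let (a , b) = ∈⊖⁻ z∈ ; (c , d) = ∈∩ᵖ⁻ a in
      b (≡-sym (proj₁ (only-u c u∈Q (~-sym d))))))

  -- The count lies below `star`, which lies below `turánStar k x y`, so both are equalities. The
  -- first gives each other clique exactly one neighbour of the centre, the second balances the
  -- orders, except in the tie of two cliques with the smaller one central. There the ends are
  -- swapped; a second tie would make each clique larger than the other.
  almostCluster-layout : ∀ k x y {u} → Cluster (full ⊖ u) → Connectedᵂ full → HasStability full (suc (x + y)) → n ≡ starOrder k x y →
    stableCount full ≡ turánStar k x y → StarLayout (x + y) k x
  almostCluster-layout k x y cl conn ((S , _ , st , S≡) , sl) n≡ eq with starlike cl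
  ... | Qs , T , (S′ , S′⊆ , st′ , S′≡) = layout T
    where
    Goal = StarLayout (x + y) k x
    star-order : ∀ {Qs} (T : Starlike Qs) → suc ∣ Starlike.C T ∣ + sum (orders Qs) ≡ starOrder k x y
    star-order T = trans (Starlike.order T) n≡
    len : (T : Starlike Qs) → length Qs ≡ x + y
    len T = ≤-antisym (≤-pred (subst (_≤ suc (x + y)) S′≡ (sl S′ S′⊆ st′)))
      (≤-pred (subst (_≤ suc (length Qs)) S≡
        (stabilityAtMost-+ {full} {Q₀} (clique-stable≤1 Q₀-clique) (λ R R⊆ → partition-stability partition R (λ z∈ → full∖Q₀ (R⊆ z∈))) S (λ _ → ∈⊤) st)))
      where
      open Starlike T
    bounds : ∀ {Qs} (T : Starlike Qs) → length Qs ≡ x + y → star (suc ∣ Starlike.C T ∣) (orders Qs) ≤ turánStar k x y ×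
      (star (suc ∣ Starlike.C T ∣) (orders Qs) ≡ turánStar k x y → (suc ∣ Starlike.C T ∣ ≡ suc k × All (Sandwich k) (orders Qs)) ⊎
        (∃ λ p → orders Qs ≡ p ∷ [] × suc ∣ Starlike.C T ∣ < p))
    bounds {Qs} T len = star-max _ _ k x y (s≤s z≤n) (partition-nonempty (Starlike.partition T)) (trans (length-map ∣_∣ Qs) len) (star-order T)
    finish : ∀ {Qs} (T : Starlike Qs) → length Qs ≡ x + y → All (λ Q → ∣ Q ∩ᵖ adj G (Starlike.centre T) ∣ ≡ 1) Qs →
      suc ∣ Starlike.C T ∣ ≡ suc k × All (Sandwich k) (orders Qs) → Goal
    finish {Qs} T len ones (s≡ , sizes) = starlike-layout T ones len s≡ (All.map⁻ sizes)
      (+-cancelˡ-≡ (suc k) _ _ (trans (cong (_+ sum (orders Qs)) (≡-sym s≡)) (trans (star-order T)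
        (trans (lem k (x + y) x) (cong (λ l → suc k + (k * l + x)) (≡-sym len))))))
      where
      lem : ∀ k r x → k * suc r + suc x ≡ suc k + (k * r + x)
      lem = solve-∀
    layout : Starlike Qs → Goal
    layout T with Starlike.stableCount≤star T conn | bounds T (len T)
    ... | le , eq₁ | le′ , eq₂ with eq₁ (≤-antisym le (≤-trans le′ (≤-reflexive (≡-sym eq)))) | eq₂ (≤-antisym le′ (≤-trans (≤-reflexive (≡-sym eq)) le))
    ... | ones | inj₁ done = finish T (len T) ones done
    ... | ones | inj₂ (p , single , lt) = exceptional Qs T (len T) ones single lt
      (trans (≡-sym eq) (≤-antisym le (≤-trans le′ (≤-reflexive (≡-sym eq)))))
      where
      exceptional : ∀ Qs (T : Starlike Qs) → length Qs ≡ x + y → All (λ Q → ∣ Q ∩ᵖ adj G (Starlike.centre T) ∣ ≡ 1) Qs →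
        orders Qs ≡ p ∷ [] → suc ∣ Starlike.C T ∣ < p → turánStar k x y ≡ star (suc ∣ Starlike.C T ∣) (orders Qs) → Goal
      exceptional (Q ∷ []) T len (one ∷ []) refl lt val with swap T one
      ... | Q′ , T′ , one′ , Q′≡ , C′≡ with proj₂ (bounds T′ len) (trans (star-sym Q′≡ C′≡) (≡-sym val))
        where
        lem : ∀ s p → p * (suc s * 1) + s * 1 ≡ s * (suc p * 1) + p * 1
        lem = solve-∀
        star-sym : ∀ {s s′ p p′} → p′ ≡ s → s′ ≡ p → star s′ (p′ ∷ []) ≡ star s (p ∷ [])
        star-sym {s} {p = p} refl refl = lem s p
      ... | inj₁ done = finish T′ len (one′ ∷ []) done
      ... | inj₂ (_ , refl , lt′) = ⊥-elim (<-asym lt (subst₂ _<_ C′≡ Q′≡ lt′))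

-- The five-cycle.

-- Both graphs have eleven stable sets, which evaluation confirms.
cycle-F : ∀ n a .{{_ : NonZero a}} → n ≡ 5 → a ≡ 2 → F (Cycle n) ≡ F (TC n a)
cycle-F _ _ refl refl = refl

-- No two vertices of C₅ have the same neighbourhood, so a map from C₅ that preserves adjacency and
-- nonadjacency is injective.
cycle₅-rows : (i j : Fin 5) → (∀ l → adj (Cycle 5) i l ≡ adj (Cycle 5) j l) → i ≡ j
cycle₅-rows = from-yes (Fin.all? λ i → Fin.all? λ j → Fin.all? (λ l → adj (Cycle 5) i l Bool.≟ adj (Cycle 5) j l) →-dec (i Fin.≟ j))

pentagon-≅ : ∀ {n} (G : Graph n) → Pentagon G full → n ≡ 5 → G ≅ Cycle n
pentagon-≅ G P refl = ≅-from-injection⁻ {G = G} {Cycle 5} f injective same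
  where
  open Pentagon P
  open Stable G
  f : Fin 5 → Fin 5
  f 0F = v
  f 1F = w
  f 2F = p
  f 3F = q
  f 4F = x
  same : ∀ i j → adj G (f i) (f j) ≡ adj (Cycle 5) i j
  same 0F 0F = irrefl G v
  same 0F 1F = v~w
  same 0F 2F = v≁p
  same 0F 3F = v≁q
  same 0F 4F = ~-sym x~v
  same 1F 0F = ~-sym v~w
  same 1F 1F = irrefl G w
  same 1F 2F = w~p
  same 1F 3F = w≁q
  same 1F 4F = w≁x
  same 2F 0F = ≁-sym v≁p
  same 2F 1F = ~-sym w~p
  same 2F 2F = irrefl G p
  same 2F 3F = p~q
  same 2F 4F = p≁x
  same 3F 0F = ≁-sym v≁q
  same 3F 1F = ≁-sym w≁q
  same 3F 2F = ~-sym p~q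
  same 3F 3F = irrefl G q
  same 3F 4F = q~x
  same 4F 0F = x~v
  same 4F 1F = ≁-sym w≁x
  same 4F 2F = ≁-sym p≁x
  same 4F 3F = ~-sym q~x
  same 4F 4F = irrefl G x
  injective : ∀ {i j} → f i ≡ f j → i ≡ j
  injective {i} {j} e = cycle₅-rows i j λ l → trans (≡-sym (same i l)) (trans (cong (λ z → adj G z (f l)) e) (same j l))

-- The bound and its equality case for whole graphs.

connected-full : ∀ {n} (G : Graph n) → Connected G → Connectedᵂ G full
connected-full {n} G conn U _ (u , u∈) (w , w∈) = crossing (conn u w) u∈
  where
  open Stable G
  crossing : ∀ {v} → Reachable G v w → v ∈ U → ∃ λ x → ∃ λ y → x ∈ U × y ∈ full ∖ U × x ~ y
  crossing here v∈ = ⊥-elim (proj₂ (∈∖⁻ w∈) v∈)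
  crossing {v} (step {v = z} e path) v∈ with z ∈? U
  ... | yes z∈ = crossing path z∈
  ... | no z∉ = v , z , v∈ , ∈∖⁺ ∈⊤ z∉ , e

stability-full : ∀ {n a} (G : Graph n) → IsStabilityNumber G a → HasStability G full a
stability-full G ((S , st , S≡) , sl) = (S , (λ _ → ∈⊤) , st , S≡) , λ S _ → sl S

extremal : ∀ k x y (G : Graph (starOrder k x y)) → Connected G → IsStabilityNumber G (suc (x + y)) →
  F G ≤ turánStar k x y × (F G ≡ turánStar k x y →
    G ≅ TC (starOrder k x y) (suc (x + y)) ⊎ (starOrder k x y ≡ 5 × suc (x + y) ≡ 2 × G ≅ Cycle (starOrder k x y)))
extremal k x y G conn stab
  with connected-bound G (starOrder k x y) full (≤-reflexive (∣⊤∣≡n _)) k x y (∣⊤∣≡n _) (connected-full G conn) (stability-full G stab)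
... | bound , equality = subst (_≤ turánStar k x y) (Stable.stableCount-full G) bound ,
    λ eq → classify (equality (trans (Stable.stableCount-full G) eq)) (trans (Stable.stableCount-full G) eq)
  where
  -- `RegularExtremal` does not mention `x`; order 5 with `k = 2` and `y = 1` recovers `x = 0`,
  -- hence the stability number 2.
  x≡0 : ∀ x → starOrder 2 x 1 ≡ 5 → x ≡ 0
  x≡0 zero _ = refl
  x≡0 (suc x) e = ⊥-elim (<-irrefl (≡-sym e) (<-via (3 * x + 2) (lem x)))
    where lem : ∀ x → 2 * suc (suc x + 1) + suc (suc x) ≡ 5 + suc (3 * x + 2)
          lem = solve-∀
  two-cliques : ∀ {k y} → k ≡ 2 → y ≡ 1 → starOrder k x y ≡ 5 → suc (x + y) ≡ 2
  two-cliques refl refl e = cong (λ x → suc (x + 1)) (x≡0 x e)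
  classify : AlmostCluster G full ⊎ RegularExtremal G k y full → Stable.stableCount G full ≡ turánStar k x y →
    G ≅ TC (starOrder k x y) (suc (x + y)) ⊎ (starOrder k x y ≡ 5 × suc (x + y) ≡ 2 × G ≅ Cycle (starOrder k x y))
  classify (inj₁ (u , _ , cl)) eq = inj₁ (StarLayout.starLayout-≅ (almostCluster-layout G k x y cl (connected-full G conn) (stability-full G stab) refl eq) refl)
  classify (inj₂ ext) eq with induced-path G ext
  ... | w , v , z , w∈ , v∈ , z∈ , w~v , v~z , w≢z , w≁z with FromPath.pentagon G ext w∈ v∈ z∈ w~v v~z w≢z w≁z
  ... | P , k≡ , y≡ = inj₂ (five , two-cliques k≡ y≡ five , pentagon-≅ G P five)
    where five = trans (≡-sym (∣⊤∣≡n _)) (Pentagon.order P)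

-- With quotient 0 the order `x + 1` could not exceed the stability number `x + y + 1`.
positive-quotient : ∀ k x y → suc (x + y) < starOrder k x y → ∃ λ j → k ≡ suc j
positive-quotient zero x y (s≤s lt) = ⊥-elim (<⇒≱ lt (m≤m+n x y))
positive-quotient (suc j) x y _ = j , refl

extremal-TC : ∀ n a (G : Graph n) → Connected G → IsStabilityNumber G a → .{{_ : NonZero a}} → a < n →
  F G ≤ F (TC n a) × (F G ≡ F (TC n a) → G ≅ TC n a ⊎ (n ≡ 5 × a ≡ 2 × G ≅ Cycle n))
extremal-TC n (suc r) G conn stab a<n with starParameters n r (≤-trans (s≤s z≤n) a<n)
... | k , x , y , refl , refl with positive-quotient k x y a<n | extremal k x y G conn stab
... | j , refl | bound , equality = ≤-trans bound (turánStar≤TC j x y) ,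
    λ eq → equality (≤-antisym bound (≤-trans (turánStar≤TC j x y) (≤-reflexive (≡-sym eq))))

theorem3 : (n a : ℕ) (G : Graph n) → Connected G → IsStabilityNumber G a →
    (1≤a : 1 ≤ a) → a < n →
    let instance _ = >-nonZero 1≤a in
    (F G ≤ fTC n a)
    × ((n ≢ 5 ⊎ a ≢ 2) → (F G ≡ fTC n a ⇔ G ≅ TC n a))
    × (n ≡ 5 → a ≡ 2 → (F G ≡ fTC n a ⇔ (G ≅ TC n a ⊎ G ≅ Cycle n)))
theorem3 n a G conn stab 1≤a a<n =
  proj₁ main ,
  (λ generic → mk⇔ (λ eq → only generic (proj₂ main eq)) (≅-F {G = G} {TC n a})) ,
  λ n≡5 a≡2 → mk⇔ (λ eq → either (proj₂ main eq)) λ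
    { (inj₁ iso) → ≅-F {G = G} {TC n a} iso
    ; (inj₂ iso) → trans (≅-F {G = G} {Cycle n} iso) (cycle-F n a n≡5 a≡2) }
  where
  instance _ = >-nonZero 1≤a
  main = extremal-TC n a G conn stab a<n
  only : n ≢ 5 ⊎ a ≢ 2 → G ≅ TC n a ⊎ (n ≡ 5 × a ≡ 2 × G ≅ Cycle n) → G ≅ TC n a
  only _ (inj₁ iso) = iso
  only (inj₁ n≢5) (inj₂ (n≡5 , _)) = ⊥-elim (n≢5 n≡5)
  only (inj₂ a≢2) (inj₂ (_ , a≡2 , _)) = ⊥-elim (a≢2 a≡2)
  either : G ≅ TC n a ⊎ (n ≡ 5 × a ≡ 2 × G ≅ Cycle n) → G ≅ TC n a ⊎ G ≅ Cycle n
  either (inj₁ iso) = inj₁ iso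
  either (inj₂ (_ , _ , iso)) = inj₂ iso
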